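{- For every $n\in\mathbb N$ and positive integers $b_1,b_2$, let $$\mathcal N_2(b_1,b_2;n)=\#\{(x_1,x_2,x_3,x_4)\in\mathbb Z^4:\ b_1(x_1^2+x_1x_2+x_2^2)+b_2(x_3^2+x_3x_4+x_4^2)=n\}.$$ Then for every $n\in\mathbb N$: \begin{align*} \mathcal N_2(1,2;n)&=6\sigma(n)-12\sigma(n/2)+18\sigma(n/3)-36\sigma(n/6),\\ \mathcal N_2(1,4;n)&=6\sigma(n)-18\sigma(n/2)-18\sigma(n/3)+24\sigma(n/4)+54\sigma(n/6)-72\sigma(n/12),\\ \mathcal N_2(1,8;n)&=\tfrac32\sigma(n)-\tfrac92\sigma(n/2)+\tfrac92\sigma(n/3)+9\sigma(n/4)-\tfrac{27}{2}\sigma(n/6)-12\sigma(n/8)\\ &\quad+27\sigma(n/12)-36\sigma(n/24)+\tfrac92\tau_{2,24}(n),\\ \mathcal N_2(1,16;n)&=\tfrac32\sigma(n)-\tfrac92\sigma(n/2)-\tfrac92\sigma(n/3)+9\sigma(n/4)+\tfrac{27}{2}\sigma(n/6)-18\sigma(n/8)\\ &\quad-27\sigma(n/12)+24\sigma(n/16)+54\sigma(n/24)-72\sigma(n/48)+\tfrac92\tau_{2,48}(n). \end{align*}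
   Context: $\sigma(m)$ denotes the sum of the positive divisors of $m$ for $m\in\mathbb N$, and $\sigma(x)=0$ if $x$ is not a positive integer (so $\sigma(n/d)=0$ when $d\nmid n$). Let $q=e^{2\pi i z}$ with $\mathrm{Im}(z)>0$ and $\eta(z)=q^{1/24}\prod_{m\ge1}(1-q^m)$ be the Dedekind eta function. The integers $\tau_{2,24}(n)$ and $\tau_{2,48}(n)$ are defined by the $q$-expansions $$\eta(2z)\eta(4z)\eta(6z)\eta(12z)=\sum_{n\ge1}\tau_{2,24}(n)q^n,\qquad \frac{\eta(4z)^4\eta(12z)^4}{\eta(2z)\eta(6z)\eta(8z)\eta(24z)}=\sum_{n\ge1}\tau_{2,48}(n)q^n.$$ -}

module Defs where

open import Data.Nat as ℕ using (ℕ; zero; suc; NonZero)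
open import Data.Nat.DivMod using (_/_)
open import Data.Nat.Divisibility using (_∣?_)
open import Data.Integer as ℤ using (ℤ; +_; -[1+_])
open import Data.List using (List; []; _∷_; length; foldr; map; upTo)
open import Data.List.Membership.Propositional using (_∈_)
open import Data.List.Relation.Unary.Unique.Propositional using (Unique)
open import Data.Product using (Σ; _×_; _,_)
open import Function.Bundles using (_⇔_)
open import Relation.Nullary.Decidable using (does)
open import Data.Bool using (if_then_else_)
open import Relation.Binary.PropositionalEquality using (_≡_)

-- σ m = sum of the positive divisors of m  (so σ 0 = 0).
σ : ℕ → ℕ
σ m = foldr ℕ._+_ 0 (map (λ i → if does (suc i ∣? m) then suc i else 0) (upTo m))

-- σ[ n / d ] = σ(n/d), with σ(x) = 0 when x is not a positive integer
-- (i.e. 0 when d ∤ n, and σ 0 = 0 handles n = 0).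
σ[_/_] : ℕ → (d : ℕ) → .{{NonZero d}} → ℤ
σ[ n / d ] = if does (d ∣? n) then + σ (n / d) else + 0

ℤ⁴ : Set
ℤ⁴ = ℤ × ℤ × ℤ × ℤ

HasCard : (ℤ⁴ → Set) → ℕ → Set
HasCard P k = Σ (List ℤ⁴) λ L → Unique L × (∀ x → (x ∈ L) ⇔ P x) × (length L ≡ k)

Q : ℤ → ℤ → ℤ
Q x y = x ℤ.* x ℤ.+ x ℤ.* y ℤ.+ y ℤ.* y

𝒩₂[_,_,_]≡_ : ℕ → ℕ → ℕ → ℕ → Set
𝒩₂[ b₁ , b₂ , n ]≡ k =
  HasCard (λ { (x₁ , x₂ , x₃ , x₄) → (+ b₁) ℤ.* Q x₁ x₂ ℤ.+ (+ b₂) ℤ.* Q x₃ x₄ ≡ + n }) k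

-- Formal power series in q with integer coefficients, as coefficient functions

Series : Set
Series = ℕ → ℤ

sumTo : ℕ → (ℕ → ℤ) → ℤ
sumTo zero    f = f 0
sumTo (suc n) f = sumTo n f ℤ.+ f (suc n)

oneS : Series
oneS zero    = + 1
oneS (suc _) = + 0

_⊛_ : Series → Series → Series
(f ⊛ g) n = sumTo n (λ i → f i ℤ.* g (n ℕ.∸ i))

powS : Series → ℕ → Series
powS f zero    = oneS
powS f (suc k) = f ⊛ powS f k

-- 1 - q^a   (a ≥ 1)
oneMinus : ℕ → Series
oneMinus a n = if does (n ℕ.≟ 0) then + 1 else (if does (n ℕ.≟ a) then ℤ.- (+ 1) else + 0)

-- 1/(1 - q^a) = Σ_j q^{a j}   (a ≥ 1)
geomS : (a : ℕ) → .{{NonZero a}} → Series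
geomS a n = if does (a ∣? n) then + 1 else + 0

factorS : (a : ℕ) → .{{NonZero a}} → ℤ → Series
factorS a (+ k)      = powS (oneMinus a) k
factorS a -[1+ k ]   = powS (geomS a) (suc k)

-- An eta quotient ∏_k η(a_k z)^{r_k} is given by a list of pairs (a_k , r_k),
-- with a_k ≥ 1 (stored as a_k = suc a).
-- etaProdTrunc spec M = ∏_{m=1}^{M} ∏_k (1 - q^{a_k m})^{r_k}.
etaFactors : List (ℕ × ℤ) → ℕ → Series
etaFactors []             m = oneS
etaFactors ((a , r) ∷ s)  m = factorS (suc a ℕ.* suc m) r ⊛ etaFactors s m

etaProdTrunc : List (ℕ × ℤ) → ℕ → Series
etaProdTrunc s zero    = oneS
etaProdTrunc s (suc M) = etaFactors s M ⊛ etaProdTrunc s M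

-- Coefficient of q^N in the infinite product ∏_{m≥1} ∏_k (1 - q^{a_k m})^{r_k}:
-- factors with m > N are ≡ 1 mod q^{N+1}, so truncating at m ≤ N is exact.
prodCoeff : List (ℕ × ℤ) → ℕ → ℤ
prodCoeff s N = etaProdTrunc s N N

-- Both eta quotients below have leading power q^{Σ a_k r_k / 24} = q^1,
-- so the coefficient of q^n is the coefficient of q^{n-1} of the product
-- (and is 0 for n = 0).

-- η(2z)η(4z)η(6z)η(12z)
spec24 : List (ℕ × ℤ)
spec24 = (1 , + 1) ∷ (3 , + 1) ∷ (5 , + 1) ∷ (11 , + 1) ∷ []

-- η(4z)^4 η(12z)^4 / (η(2z)η(6z)η(8z)η(24z))
spec48 : List (ℕ × ℤ)
spec48 = (3 , + 4) ∷ (11 , + 4) ∷ (1 , -[1+ 0 ]) ∷ (5 , -[1+ 0 ]) ∷ (7 , -[1+ 0 ]) ∷ (23 , -[1+ 0 ]) ∷ []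

τ₂,₂₄ : ℕ → ℤ
τ₂,₂₄ zero    = + 0
τ₂,₂₄ (suc n) = prodCoeff spec24 n

τ₂,₄₈ : ℕ → ℤ
τ₂,₄₈ zero    = + 0
τ₂,₄₈ (suc n) = prodCoeff spec48 n

{-# OPTIONS --safe #-}

-- Let a(q) = Σ q^{x² + xy + y²}, so that 𝒩₂(1, b; n) is the coefficient of qⁿ in a(q) a(q^b). Splitting the hexagonal
-- lattice by residues modulo 2 gives, with Y = q ψ(q²) ψ(q⁶),
--     a(q) = a(q⁴) + 6Y,    φ(-q) φ(-q³) = a(q⁴) - 2Y,    a(q²)² = a(q⁴)² + 12Y².
-- The first and third relation determine a(q) = 1 + 6q + ⋯ uniquely. Liouville's method, applied to the sums of
-- χ(a) χ(b) over a x + b y = n (χ the nontrivial character modulo 3), shows that 1 + 6 Σ χ(d) q^{de} satisfies them as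
-- well, so this series is a(q); the same method evaluates a(q)² and Y(q) a(q²) in terms of
-- S = Σ σ(n) qⁿ. Then
--   * a(q) a(q²) = a(q²) a(q⁴) + 6 Y(q) a(q²) determines a(q) a(q²) recursively;
--   * 2 a(q) a(q⁴) = a(q)² - 3 a(q²)² + 4 a(q⁴)²;
--   * 4 a(q) a(q⁸)  = a(q) a(q²) - a(q²) a(q⁴) + 4 a(q⁴) a(q⁸) + 18 Y(q) φ(-q²) φ(-q⁶);
--   * 4 a(q) a(q¹⁶) = a(q) a(q⁴) - a(q⁴)² + 4 a(q⁴) a(q¹⁶) + 18 Y(q) φ(-q⁴) φ(-q¹²);
-- and Gauss' product formulas for ψ(q) and φ(-q) identify the last terms with the two eta quotients.

module Submission where

open import Defs
open import Algebra.Bundles using (CommutativeRing)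
open import Algebra.Properties.AbelianGroup using (∙-cancelʳ)
open import Algebra.Properties.CommutativeSemigroup using (interchange)
import Algebra.Solver.Ring as RingSolver
open import Algebra.Solver.Ring.AlmostCommutativeRing using (fromCommutativeRing; _-Raw-AlmostCommutative⟶_)
open import Data.Bool using (Bool; true; false; if_then_else_; not; _xor_; _∧_)
open import Data.Empty using (⊥-elim)
open import Data.Integer as ℤ using (ℤ; +_; -[1+_]; -_; _+_; _-_; _*_; ∣_∣)
import Data.Integer.DivMod as ℤD
import Data.Integer.Properties as ℤP
open import Data.Integer.Tactic.RingSolver using (solve-∀)
open import Data.List using (List; []; _∷_; _++_; length; foldr; map; concatMap; filter; deduplicate; cartesianProduct; upTo)
open import Data.List.Membership.Propositional using (_∈_; find; lose)
open import Data.List.Membership.Propositional.Properties using (∈-filter⁺; ∈-filter⁻; ∈-deduplicate⁺; ∈-deduplicate⁻; ∈-cartesianProduct⁺; ∈-cartesianProduct⁻; ∈-map⁺; ∈-map⁻; ∈-++⁺ˡ; ∈-++⁺ʳ; ∈-++⁻; ∈-upTo⁺; ∈-upTo⁻; ∈-concatMap⁺; ∈-concatMap⁻)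
open import Data.List.Membership.Propositional.Properties.WithK using (unique∧set⇒bag)
open import Data.List.Properties using (upTo-∷ʳ; length-map)
open import Data.List.Relation.Binary.BagAndSetEquality using (∼bag⇒↭)
open import Data.List.Relation.Binary.Permutation.Propositional as Perm using (_↭_)
open import Data.List.Relation.Unary.All as All using ([])
open import Data.List.Relation.Unary.AllPairs using ([]; _∷_)
open import Data.List.Relation.Unary.Any using (here; there)
open import Data.List.Relation.Unary.Unique.DecPropositional.Properties using (deduplicate-!)
open import Data.List.Relation.Unary.Unique.Propositional using (Unique)
import Data.List.Relation.Unary.Unique.Propositional.Properties as Uniq
open import Data.Maybe using (Maybe; just; nothing)
open import Data.Nat as ℕ using (ℕ; zero; suc; NonZero; _≤_; _<_; z≤n; s≤s)
open import Data.Nat.DivMod using (_/_; m*n/n≡m)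
open import Data.Nat.Divisibility using (_∣_; _∣?_; divides; m∣m*n; ∣m∣n⇒∣m+n; ∣-refl; _∣0)
import Data.Nat.Properties as ℕP
open import Data.Nat.Tactic.RingSolver using () renaming (solve-∀ to solveℕ-∀)
open import Data.Product using (Σ; _×_; _,_; proj₁; proj₂; swap)
import Data.Product.Properties as ×P
open import Data.Sum using (_⊎_; inj₁; inj₂; [_,_]′)
import Data.Sum.Properties as ⊎P
open import Data.Unit using (⊤; tt)
import Data.Unit.Properties as ⊤P
open import Function using (_∘_; id; mk⇔)
open import Relation.Binary using (DecidableEquality)
open import Relation.Binary.PropositionalEquality using (_≡_; refl; sym; trans; cong; cong₂; subst; module ≡-Reasoning)
import Relation.Binary.Reasoning.Setoid as SetoidReasoning
open import Relation.Nullary using (¬_; Dec; yes; no)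
open import Relation.Nullary.Decidable using (does; dec-true; dec-false; from-yes)

-- Finite sums over lists

-- That x² + xy + y² represents n ≥ 1 in 6 Σ χ(d) ways, d running over the divisors of n, is usually
-- read off from unique factorisation in the Eisenstein integers or from the dimension of a space of
-- modular forms. Both are avoided: the relations under q ↦ q² and q ↦ q⁴ are rigid enough to
-- determine the series. The obstacle is the product of two Lambert series, a sum over a x + b y = n
-- without a termwise evaluation. It yields because χ(a) χ(b) = F(a - b) - F(a + b), where `F` is
-- the indicator of the multiples of 3: splitting the first part by a ⋚ b and the second by x ⋚ y
-- leaves, besides diagonal terms, two sums over the same form (a + b) x + b y, which an auxiliary
-- sum compares. No space of cusp forms enters either. The formulas with the coefficients 4 and 18
-- are polynomial identities in a(q⁴), a(q^b), Y(q) and one more Y(q^c), and 18 is the multiple that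
-- eliminates Y(q) Y(q^c). Basic identities of series come from weight-preserving bijections of
-- index sets with finite fibres, so only integer coefficients occur.

+-congʳ : ∀ x {y z : ℤ} → y ≡ z → x + y ≡ x + z
+-congʳ x refl = refl

sumL : {I : Set} → (I → ℤ) → List I → ℤ
sumL f []       = + 0
sumL f (x ∷ xs) = f x + sumL f xs

sumL-cong : {I : Set} {f g : I → ℤ} (xs : List I) → (∀ {i} → i ∈ xs → f i ≡ g i) → sumL f xs ≡ sumL g xs
sumL-cong []       eq = refl
sumL-cong (x ∷ xs) eq = cong₂ _+_ (eq (here refl)) (sumL-cong xs (eq ∘ there))

sumL-↭ : {I : Set} (f : I → ℤ) {xs ys : List I} → xs ↭ ys → sumL f xs ≡ sumL f ys
sumL-↭ f Perm.refl         = refl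
sumL-↭ f (Perm.prep x p)   = +-congʳ (f x) (sumL-↭ f p)
sumL-↭ f (Perm.trans p q)  = trans (sumL-↭ f p) (sumL-↭ f q)
sumL-↭ f {xs = _ ∷ _ ∷ xs} {ys = _ ∷ _ ∷ ys} (Perm.swap x y p) = begin
  f x + (f y + sumL f xs) ≡⟨ cong (λ s → f x + (f y + s)) (sumL-↭ f p) ⟩
  f x + (f y + sumL f ys) ≡⟨ sym (ℤP.+-assoc (f x) (f y) _) ⟩
  f x + f y + sumL f ys ≡⟨ cong (_+ sumL f ys) (ℤP.+-comm (f x) (f y)) ⟩
  f y + f x + sumL f ys ≡⟨ ℤP.+-assoc (f y) (f x) _ ⟩
  f y + (f x + sumL f ys) ∎
  where open ≡-Reasoning

sumL-set : {I : Set} (f : I → ℤ) {xs ys : List I} → Unique xs → Unique ys →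
  (∀ {i} → i ∈ xs → i ∈ ys) → (∀ {i} → i ∈ ys → i ∈ xs) → sumL f xs ≡ sumL f ys
sumL-set f ux uy to from = sumL-↭ f (∼bag⇒↭ (unique∧set⇒bag ux uy (mk⇔ to from)))

sumL-++ : {I : Set} (f : I → ℤ) (xs ys : List I) → sumL f (xs ++ ys) ≡ sumL f xs + sumL f ys
sumL-++ f []       ys = sym (ℤP.+-identityˡ _)
sumL-++ f (x ∷ xs) ys = trans (+-congʳ (f x) (sumL-++ f xs ys)) (sym (ℤP.+-assoc (f x) _ _))

sumL-map : {I J : Set} (f : J → ℤ) (h : I → J) (xs : List I) → sumL f (map h xs) ≡ sumL (f ∘ h) xs
sumL-map f h []       = refl
sumL-map f h (x ∷ xs) = +-congʳ (f (h x)) (sumL-map f h xs)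

sumL-concatMap : {I J : Set} (f : J → ℤ) (h : I → List J) (xs : List I) →
  sumL f (concatMap h xs) ≡ sumL (λ i → sumL f (h i)) xs
sumL-concatMap f h []       = refl
sumL-concatMap f h (x ∷ xs) = trans (sumL-++ f (h x) _) (+-congʳ (sumL f (h x)) (sumL-concatMap f h xs))

sumL-*ˡ : {I : Set} (c : ℤ) (f : I → ℤ) (xs : List I) → sumL (λ i → c * f i) xs ≡ c * sumL f xs
sumL-*ˡ c f []       = sym (ℤP.*-zeroʳ c)
sumL-*ˡ c f (x ∷ xs) = trans (+-congʳ (c * f x) (sumL-*ˡ c f xs)) (sym (ℤP.*-distribˡ-+ c (f x) _))

sumL-+ : {I : Set} (f g : I → ℤ) (xs : List I) → sumL (λ i → f i + g i) xs ≡ sumL f xs + sumL g xs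
sumL-+ f g []       = refl
sumL-+ f g (x ∷ xs) = begin
  f x + g x + sumL (λ i → f i + g i) xs ≡⟨ +-congʳ (f x + g x) (sumL-+ f g xs) ⟩
  f x + g x + (sumL f xs + sumL g xs) ≡⟨ interchange ℤP.+-commutativeSemigroup (f x) (g x) _ _ ⟩
  f x + sumL f xs + (g x + sumL g xs) ∎
  where
  open ≡-Reasoning

sumL-cartesianProduct : {I J : Set} (f : I → ℤ) (g : J → ℤ) (xs : List I) (ys : List J) →
  sumL (λ p → f (proj₁ p) * g (proj₂ p)) (cartesianProduct xs ys) ≡ sumL f xs * sumL g ys
sumL-cartesianProduct f g []       ys = sym (ℤP.*-zeroˡ (sumL g ys))
sumL-cartesianProduct f g (x ∷ xs) ys = begin
  sumL h (map (x ,_) ys ++ cartesianProduct xs ys) ≡⟨ sumL-++ h (map (x ,_) ys) _ ⟩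
  sumL h (map (x ,_) ys) + sumL h (cartesianProduct xs ys) ≡⟨ cong₂ _+_ (trans (sumL-map h (x ,_) ys) (sumL-*ˡ (f x) g ys)) (sumL-cartesianProduct f g xs ys) ⟩
  f x * sumL g ys + sumL f xs * sumL g ys ≡⟨ sym (ℤP.*-distribʳ-+ (sumL g ys) (f x) _) ⟩
  (f x + sumL f xs) * sumL g ys ∎
  where
  open ≡-Reasoning
  h = λ p → f (proj₁ p) * g (proj₂ p)

sumTo-cong : ∀ n {f g : ℕ → ℤ} → (∀ i → i ≤ n → f i ≡ g i) → sumTo n f ≡ sumTo n g
sumTo-cong zero    eq = eq 0 z≤n
sumTo-cong (suc n) eq = cong₂ _+_ (sumTo-cong n (λ i i≤n → eq i (ℕP.m≤n⇒m≤1+n i≤n))) (eq (suc n) ℕP.≤-refl)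

sumL-upTo : ∀ n (f : ℕ → ℤ) → sumL f (upTo (suc n)) ≡ sumL f (upTo n) + f n
sumL-upTo n f = trans (cong (sumL f) (sym (upTo-∷ʳ n))) (trans (sumL-++ f (upTo n) _) (+-congʳ (sumL f (upTo n)) (ℤP.+-identityʳ (f n))))

sumTo≡sumL : ∀ n (f : ℕ → ℤ) → sumTo n f ≡ sumL f (upTo (suc n))
sumTo≡sumL zero    f = sym (ℤP.+-identityʳ (f 0))
sumTo≡sumL (suc n) f = trans (cong (_+ f (suc n)) (sumTo≡sumL n f)) (sym (sumL-upTo (suc n) f))

unique-map : {I J : Set} (h : I → J) {xs : List I} → (∀ {i j} → i ∈ xs → j ∈ xs → h i ≡ h j → i ≡ j) →
  Unique xs → Unique (map h xs)
unique-map h         inj []       = []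
unique-map h {x ∷ xs} inj (x∉ ∷ u) = All.tabulate fresh ∷ unique-map h (λ p q → inj (there p) (there q)) u
  where
  fresh : ∀ {j} → j ∈ map h xs → ¬ (h x ≡ j)
  fresh p eq with ∈-map⁻ h p
  ... | i , i∈xs , refl = All.lookup x∉ i∈xs (inj (here refl) (there i∈xs) eq)

-- `key` recovers from an entry the block it came from, so different blocks are disjoint.
unique-concatMap : {I J : Set} (key : J → I) (h : I → List J) → (∀ {i j} → j ∈ h i → key j ≡ i) →
  (∀ i → Unique (h i)) → {xs : List I} → Unique xs → Unique (concatMap h xs)
unique-concatMap key h k u []                = []
unique-concatMap key h k u {x ∷ xs} (x∉ ∷ v) = Uniq.++⁺ (u x) (unique-concatMap key h k u v) disjoint
  where
  disjoint : ∀ {j} → (j ∈ h x) × (j ∈ concatMap h xs) → _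
  disjoint (p , q) with find (∈-concatMap⁻ h {xs} q)
  ... | i , i∈xs , j∈hi = All.lookup x∉ i∈xs (trans (sym (k p)) (k j∈hi))

-- Formal power series

infix 4 _≈_
record _≈_ (f g : Series) : Set where
  constructor ext
  field at : ∀ n → f n ≡ g n
open _≈_

≈-refl : ∀ {f} → f ≈ f
≈-refl = ext λ _ → refl

≈-sym : ∀ {f g} → f ≈ g → g ≈ f
≈-sym p = ext λ n → sym (at p n)

≈-trans : ∀ {f g h} → f ≈ g → g ≈ h → f ≈ h
≈-trans p q = ext λ n → trans (at p n) (at q n)

infixl 6 _⊕_
infixl 7 _·_
infix  8 ⊖_

opaque
  _·_ : Series → Series → Series
  f · g = f ⊛ g

  _⊕_ : Series → Series → Series
  (f ⊕ g) n = f n + g n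

  ⊖_ : Series → Series
  (⊖ f) n = - f n

  ·≈⊛ : ∀ {f g} → f · g ≈ f ⊛ g
  ·≈⊛ = ≈-refl

  ⊕-at : ∀ {f g} n → (f ⊕ g) n ≡ f n + g n
  ⊕-at n = refl

  ⊖-at : ∀ {f} n → (⊖ f) n ≡ - f n
  ⊖-at n = refl

  ⊕-cong : ∀ {f f′ g g′} → f ≈ f′ → g ≈ g′ → f ⊕ g ≈ f′ ⊕ g′
  ⊕-cong p q = ext λ n → cong₂ _+_ (at p n) (at q n)

  ·-cong : ∀ {f f′ g g′} → f ≈ f′ → g ≈ g′ → f · g ≈ f′ · g′
  ·-cong p q = ext λ n → sumTo-cong n λ i _ → cong₂ _*_ (at p i) (at q (n ℕ.∸ i))

zeroS : Series
zeroS _ = + 0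

-- Weighted classes and their generating functions

-- The list  box n  contains every element of weight at most n, so each weight has a finite fibre.
record Weighted (I : Set) : Set where
  field
    _≟_ : DecidableEquality I
    wt  : I → ℕ
    box : ℕ → List I
    ∈-box : ∀ {n} i → wt i ≤ n → i ∈ box n

open Weighted using (wt; box; ∈-box)

module _ {I : Set} (w : Weighted I) where
  open Weighted w using (_≟_)

  fibre : ℕ → List I
  fibre n = deduplicate _≟_ (filter (λ i → wt w i ℕ.≟ n) (box w n))

  fibre-unique : ∀ n → Unique (fibre n)
  fibre-unique n = deduplicate-! _≟_ _

  ∈-fibre⁺ : ∀ {n} i → wt w i ≡ n → i ∈ fibre n
  ∈-fibre⁺ {n} i eq = ∈-deduplicate⁺ _≟_ (∈-filter⁺ (λ i → wt w i ℕ.≟ n) (∈-box w i (ℕP.≤-reflexive eq)) eq)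

  ∈-fibre⁻ : ∀ {n i} → i ∈ fibre n → wt w i ≡ n
  ∈-fibre⁻ {n} p = proj₂ (∈-filter⁻ (λ i → wt w i ℕ.≟ n) {xs = box w n} (∈-deduplicate⁻ _≟_ _ p))

  ⟦_⟧ : (I → ℤ) → Series
  ⟦_⟧ f n = sumL f (fibre n)

  -- Coefficients do not depend on the chosen `box`: any repetition-free enumeration of the elements
  -- of weight n computes them.
  ⟦⟧-list : ∀ f n {xs} → Unique xs → (∀ {i} → i ∈ xs → wt w i ≡ n) → (∀ i → wt w i ≡ n → i ∈ xs) →
    ⟦_⟧ f n ≡ sumL f xs
  ⟦⟧-list f n u sound complete =
    sumL-set f (fibre-unique n) u (λ p → complete _ (∈-fibre⁻ p)) (λ p → ∈-fibre⁺ _ (sound p))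

  ⟦⟧-cong : ∀ {f g} → (∀ i → f i ≡ g i) → ⟦_⟧ f ≈ ⟦_⟧ g
  ⟦⟧-cong eq = ext λ n → sumL-cong (fibre n) (λ {i} _ → eq i)

  ⟦⟧-+ : ∀ f g → ⟦_⟧ (λ i → f i + g i) ≈ ⟦_⟧ f ⊕ ⟦_⟧ g
  ⟦⟧-+ f g = ext λ n → trans (sumL-+ f g (fibre n)) (sym (⊕-at n))

infix 0 _≅_
record _≅_ (I J : Set) : Set where
  field
    to : I → J
    from : J → I
    from-to : ∀ i → from (to i) ≡ i
    to-from : ∀ j → to (from j) ≡ j

⟦⟧-bij : {I J : Set} (w : Weighted I) (v : Weighted J) (b : I ≅ J) {f : I → ℤ} {g : J → ℤ} →
  (∀ i → wt v (_≅_.to b i) ≡ wt w i) → (∀ i → f i ≡ g (_≅_.to b i)) → ⟦ w ⟧ f ≈ ⟦ v ⟧ g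
⟦⟧-bij w v b {f} {g} wt-eq f≡g = ext λ n → begin
  sumL f (fibre w n) ≡⟨ sumL-cong (fibre w n) (λ {i} _ → f≡g i) ⟩
  sumL (g ∘ to) (fibre w n) ≡⟨ sym (sumL-map g to (fibre w n)) ⟩
  sumL g (map to (fibre w n)) ≡⟨ sym (⟦⟧-list v g n (unique-map to (λ _ _ → injective) (fibre-unique w n)) sound complete) ⟩
  ⟦ v ⟧ g n ∎
  where
  open ≡-Reasoning
  open _≅_ b
  injective : ∀ {i j} → to i ≡ to j → i ≡ j
  injective {i} {j} eq = trans (sym (from-to i)) (trans (cong from eq) (from-to j))
  sound : ∀ {n j} → j ∈ map to (fibre w n) → wt v j ≡ n
  sound p with ∈-map⁻ to p
  ... | i , i∈ , refl = trans (wt-eq i) (∈-fibre⁻ w i∈)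
  complete : ∀ {n} j → wt v j ≡ n → j ∈ map to (fibre w n)
  complete {n} j eq = subst (_∈ map to (fibre w n)) (to-from j)
    (∈-map⁺ to (∈-fibre⁺ w (from j) (trans (sym (wt-eq (from j))) (trans (cong (wt v) (to-from j)) eq))))

⟦⟧-reweigh : {I : Set} (w v : Weighted I) {f g : I → ℤ} →
  (∀ i → wt v i ≡ wt w i) → (∀ i → f i ≡ g i) → ⟦ w ⟧ f ≈ ⟦ v ⟧ g
⟦⟧-reweigh w v = ⟦⟧-bij w v record { to = id ; from = id ; from-to = λ _ → refl ; to-from = λ _ → refl }

infixr 7 _⊗_
infixr 6 _⊞_

_⊗_ : {I J : Set} → Weighted I → Weighted J → Weighted (I × J)
w ⊗ v = record
  { _≟_   = ×P.≡-dec (Weighted._≟_ w) (Weighted._≟_ v)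
  ; wt    = λ (i , j) → wt w i ℕ.+ wt v j
  ; box   = λ n → cartesianProduct (box w n) (box v n)
  ; ∈-box = λ (i , j) le → ∈-cartesianProduct⁺
      (∈-box w i (ℕP.≤-trans (ℕP.m≤m+n _ _) le)) (∈-box v j (ℕP.≤-trans (ℕP.m≤n+m _ _) le))
  }

_⊞_ : {I J : Set} → Weighted I → Weighted J → Weighted (I ⊎ J)
w ⊞ v = record
  { _≟_   = ⊎P.≡-dec (Weighted._≟_ w) (Weighted._≟_ v)
  ; wt    = [ wt w , wt v ]′
  ; box   = λ n → map inj₁ (box w n) ++ map inj₂ (box v n)
  ; ∈-box = λ { (inj₁ i) le → ∈-++⁺ˡ (∈-map⁺ inj₁ (∈-box w i le))
              ; (inj₂ j) le → ∈-++⁺ʳ _ (∈-map⁺ inj₂ (∈-box v j le)) }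
  }

-- The left inverse `r` serves only to carry the boxes back along `g`; its values off the image of
-- `g` are harmless extra entries.
pull : {I J : Set} → DecidableEquality J → (g : J → I) (r : I → J) → (∀ j → r (g j) ≡ j) → Weighted I → Weighted J
pull _≟_ g r r∘g w = record
  { _≟_   = _≟_
  ; wt    = λ j → wt w (g j)
  ; box   = λ n → map r (box w n)
  ; ∈-box = λ {n} j le → subst (_∈ map r (box w n)) (r∘g j) (∈-map⁺ r (∈-box w (g j) le))
  }

scale : {I : Set} (k : ℕ) .{{_ : NonZero k}} → Weighted I → Weighted I
scale k w = record
  { _≟_   = Weighted._≟_ w
  ; wt    = λ i → k ℕ.* wt w i
  ; box   = box w
  ; ∈-box = λ i le → ∈-box w i (ℕP.≤-trans (ℕP.m≤n*m _ k) le)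
  }

point : ℕ → Weighted ⊤
point k = record { _≟_ = ⊤P._≟_ ; wt = λ _ → k ; box = λ _ → tt ∷ [] ; ∈-box = λ _ _ → here refl }

nat : Weighted ℕ
nat = record { _≟_ = ℕ._≟_ ; wt = id ; box = upTo ∘ suc ; ∈-box = λ _ le → ∈-upTo⁺ (s≤s le) }

⟦⊞⟧ : {I J : Set} (w : Weighted I) (v : Weighted J) (h : I ⊎ J → ℤ) →
  ⟦ w ⊞ v ⟧ h ≈ ⟦ w ⟧ (h ∘ inj₁) ⊕ ⟦ v ⟧ (h ∘ inj₂)
⟦⊞⟧ w v h = ext λ n → begin
  ⟦ w ⊞ v ⟧ h n ≡⟨ ⟦⟧-list (w ⊞ v) h n (unique n) sound complete ⟩
  sumL h (map inj₁ (fibre w n) ++ map inj₂ (fibre v n)) ≡⟨ sumL-++ h (map inj₁ (fibre w n)) _ ⟩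
  sumL h (map inj₁ (fibre w n)) + sumL h (map inj₂ (fibre v n)) ≡⟨ cong₂ _+_ (sumL-map h inj₁ (fibre w n)) (sumL-map h inj₂ (fibre v n)) ⟩
  ⟦ w ⟧ (h ∘ inj₁) n + ⟦ v ⟧ (h ∘ inj₂) n ≡⟨ ⊕-at n ⟨
  (⟦ w ⟧ (h ∘ inj₁) ⊕ ⟦ v ⟧ (h ∘ inj₂)) n ∎
  where
  open ≡-Reasoning
  disjoint : ∀ {xs ys k} → (k ∈ map inj₁ xs) × (k ∈ map inj₂ ys) → _
  disjoint (p , q) with ∈-map⁻ inj₁ p | ∈-map⁻ inj₂ q
  ... | _ , _ , refl | _ , _ , ()
  unique : ∀ n → Unique (map inj₁ (fibre w n) ++ map inj₂ (fibre v n))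
  unique n = Uniq.++⁺ (Uniq.map⁺ ⊎P.inj₁-injective (fibre-unique w n)) (Uniq.map⁺ ⊎P.inj₂-injective (fibre-unique v n)) disjoint
  sound : ∀ {n k} → k ∈ map inj₁ (fibre w n) ++ map inj₂ (fibre v n) → wt (w ⊞ v) k ≡ n
  sound {n} p with ∈-++⁻ (map inj₁ (fibre w n)) p
  ... | inj₁ q with ∈-map⁻ inj₁ q
  ...   | i , i∈ , refl = ∈-fibre⁻ w i∈
  sound {n} p | inj₂ q with ∈-map⁻ inj₂ q
  ...   | j , j∈ , refl = ∈-fibre⁻ v j∈
  complete : ∀ {n} k → wt (w ⊞ v) k ≡ n → k ∈ map inj₁ (fibre w n) ++ map inj₂ (fibre v n)
  complete (inj₁ i) eq = ∈-++⁺ˡ (∈-map⁺ inj₁ (∈-fibre⁺ w i eq))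
  complete (inj₂ j) eq = ∈-++⁺ʳ _ (∈-map⁺ inj₂ (∈-fibre⁺ v j eq))

-- Sorting the pairs of total weight n by the weight k of the first component gives the Cauchy
-- product.
⟦⊗⟧ : {I J : Set} (w : Weighted I) (v : Weighted J) (f : I → ℤ) (g : J → ℤ) →
  ⟦ w ⊗ v ⟧ (λ p → f (proj₁ p) * g (proj₂ p)) ≈ ⟦ w ⟧ f · ⟦ v ⟧ g
⟦⊗⟧ w v f g = ext λ n → begin
  ⟦ w ⊗ v ⟧ h n ≡⟨ ⟦⟧-list (w ⊗ v) h n (unique n) (sound n) (complete n) ⟩
  sumL h (concatMap (pairs n) (upTo (suc n))) ≡⟨ sumL-concatMap h (pairs n) (upTo (suc n)) ⟩
  sumL (λ k → sumL h (pairs n k)) (upTo (suc n)) ≡⟨ sym (sumTo≡sumL n _) ⟩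
  sumTo n (λ k → sumL h (pairs n k)) ≡⟨ sumTo-cong n (λ k _ → sumL-cartesianProduct f g (fibre w k) (fibre v (n ℕ.∸ k))) ⟩
  (⟦ w ⟧ f ⊛ ⟦ v ⟧ g) n ≡⟨ at ·≈⊛ n ⟨
  (⟦ w ⟧ f · ⟦ v ⟧ g) n ∎
  where
  open ≡-Reasoning
  h = λ p → f (proj₁ p) * g (proj₂ p)
  pairs : ℕ → ℕ → List _
  pairs n k = cartesianProduct (fibre w k) (fibre v (n ℕ.∸ k))
  unique : ∀ n → Unique (concatMap (pairs n) (upTo (suc n)))
  unique n = unique-concatMap (wt w ∘ proj₁) (pairs n)
    (λ {k} p → ∈-fibre⁻ w (proj₁ (∈-cartesianProduct⁻ (fibre w k) _ p)))
    (λ k → Uniq.cartesianProduct⁺ (fibre-unique w k) (fibre-unique v (n ℕ.∸ k)))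
    (Uniq.upTo⁺ (suc n))
  sound : ∀ n {p} → p ∈ concatMap (pairs n) (upTo (suc n)) → wt (w ⊗ v) p ≡ n
  sound n {p} q with find (∈-concatMap⁻ (pairs n) {upTo (suc n)} q)
  ... | k , k∈ , p∈ with ∈-cartesianProduct⁻ (fibre w k) _ p∈
  ...   | i∈ , j∈ = trans (cong₂ ℕ._+_ (∈-fibre⁻ w i∈) (∈-fibre⁻ v j∈)) (ℕP.m+[n∸m]≡n (ℕ.s≤s⁻¹ (∈-upTo⁻ k∈)))
  complete : ∀ n p → wt (w ⊗ v) p ≡ n → p ∈ concatMap (pairs n) (upTo (suc n))
  complete n (i , j) refl = ∈-concatMap⁺ (pairs n) (lose
    (∈-upTo⁺ (s≤s (ℕP.m≤m+n (wt w i) (wt v j))))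
    (∈-cartesianProduct⁺ (∈-fibre⁺ w i refl) (∈-fibre⁺ v j (sym (ℕP.m+n∸m≡n (wt w i) (wt v j))))))

⟦nat⟧ : ∀ f → ⟦ nat ⟧ f ≈ f
⟦nat⟧ f = ext λ n → trans
  (⟦⟧-list nat f n {n ∷ []} ([] ∷ []) (λ { (here eq) → eq }) (λ _ eq → here eq))
  (ℤP.+-identityʳ (f n))

-- Every series is a generating function over `nat`, so commutativity, associativity and
-- distributivity of the product become statements about index sets.
·-def : ∀ f g → f · g ≈ ⟦ nat ⊗ nat ⟧ (λ p → f (proj₁ p) * g (proj₂ p))
·-def f g = ≈-trans (·-cong (≈-sym (⟦nat⟧ f)) (≈-sym (⟦nat⟧ g))) (≈-sym (⟦⊗⟧ nat nat f g))

·-comm : ∀ f g → f · g ≈ g · f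
·-comm f g = ≈-trans (·-def f g) (≈-trans
  (⟦⟧-bij (nat ⊗ nat) (nat ⊗ nat)
    (record { to = swap ; from = swap ; from-to = λ _ → refl ; to-from = λ _ → refl })
    (λ (i , j) → ℕP.+-comm j i) (λ (i , j) → ℤP.*-comm (f i) (g j)))
  (≈-sym (·-def g f)))

·-assoc : ∀ f g h → (f · g) · h ≈ f · (g · h)
·-assoc f g h = ≈-trans (·-cong (·-def f g) (≈-sym (⟦nat⟧ h))) (≈-trans (≈-sym (⟦⊗⟧ (nat ⊗ nat) nat _ h)) (≈-trans
  (⟦⟧-bij ((nat ⊗ nat) ⊗ nat) (nat ⊗ nat ⊗ nat)
    (record { to = λ ((i , j) , k) → i , j , k ; from = λ (i , j , k) → (i , j) , k ; from-to = λ _ → refl ; to-from = λ _ → refl })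
    (λ ((i , j) , k) → sym (ℕP.+-assoc i j k)) (λ ((i , j) , k) → ℤP.*-assoc (f i) (g j) (h k)))
  (≈-trans (⟦⊗⟧ nat (nat ⊗ nat) f _) (·-cong (⟦nat⟧ f) (≈-sym (·-def g h))))))

opaque
  κ : ℤ → Series
  κ c zero    = c
  κ c (suc _) = + 0

  κ-zero : ∀ c → κ c 0 ≡ c
  κ-zero c = refl

  κ-suc : ∀ c n → κ c (suc n) ≡ + 0
  κ-suc c n = refl

  κ≈⟦⟧ : ∀ c → κ c ≈ ⟦ point 0 ⟧ (λ _ → c)
  κ≈⟦⟧ c = ext λ
    { zero    → sym (ℤP.+-identityʳ c)
    ; (suc n) → sym (⟦⟧-list (point 0) (λ _ → c) (suc n) {[]} [] (λ ()) (λ _ ())) }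

κ-· : ∀ c f n → (κ c · f) n ≡ c * f n
κ-· c f = at (≈-trans (·-cong (κ≈⟦⟧ c) (≈-sym (⟦nat⟧ f))) (≈-trans (≈-sym (⟦⊗⟧ (point 0) nat _ f)) (≈-trans
  (⟦⟧-bij (point 0 ⊗ nat) nat
    (record { to = proj₂ ; from = tt ,_ ; from-to = λ _ → refl ; to-from = λ _ → refl })
    (λ _ → refl) (λ _ → refl))
  (⟦nat⟧ (λ n → c * f n)))))

opaque
  unfolding κ

  κ-1 : κ (+ 1) ≈ oneS
  κ-1 = ext λ { zero → refl ; (suc _) → refl }

·-identityˡ : ∀ f → oneS · f ≈ f
·-identityˡ f = ≈-trans (·-cong (≈-sym κ-1) ≈-refl) (ext λ n → trans (κ-· (+ 1) f n) (ℤP.*-identityˡ (f n)))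

opaque
  unfolding _⊕_

  ·-distribˡ : ∀ f g h → f · (g ⊕ h) ≈ f · g ⊕ f · h
  ·-distribˡ f g h = ≈-trans (·-def f (g ⊕ h)) (≈-trans
    (⟦⟧-cong (nat ⊗ nat) (λ (i , j) → ℤP.*-distribˡ-+ (f i) (g j) (h j)))
    (≈-trans (⟦⟧-+ (nat ⊗ nat) _ _) (⊕-cong (≈-sym (·-def f g)) (≈-sym (·-def f h)))))

  ⊕-assoc : ∀ f g h → (f ⊕ g) ⊕ h ≈ f ⊕ (g ⊕ h)
  ⊕-assoc f g h = ext λ n → ℤP.+-assoc (f n) (g n) (h n)

  ⊕-comm : ∀ f g → f ⊕ g ≈ g ⊕ f
  ⊕-comm f g = ext λ n → ℤP.+-comm (f n) (g n)

  ⊕-identityˡ : ∀ f → zeroS ⊕ f ≈ f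
  ⊕-identityˡ f = ext λ n → ℤP.+-identityˡ (f n)

  ⊖-inverseˡ : ∀ f → ⊖ f ⊕ f ≈ zeroS
  ⊖-inverseˡ f = ext λ n → ℤP.+-inverseˡ (f n)

  ⊖-cong : ∀ {f g} → f ≈ g → ⊖ f ≈ ⊖ g
  ⊖-cong p = ext λ n → cong -_ (at p n)

seriesRing : CommutativeRing _ _
seriesRing = record
  { Carrier = Series ; _≈_ = _≈_ ; _+_ = _⊕_ ; _*_ = _·_ ; -_ = ⊖_ ; 0# = zeroS ; 1# = oneS
  ; isCommutativeRing = record
    { isRing = record
      { +-isAbelianGroup = record
        { isGroup = record
          { isMonoid = record
            { isSemigroup = record
              { isMagma = record
                { isEquivalence = record { refl = ≈-refl ; sym = ≈-sym ; trans = ≈-trans }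
                ; ∙-cong = ⊕-cong }
              ; assoc = ⊕-assoc }
            ; identity = ⊕-identityˡ , (λ f → ≈-trans (⊕-comm f zeroS) (⊕-identityˡ f)) }
          ; inverse = ⊖-inverseˡ , (λ f → ≈-trans (⊕-comm f (⊖ f)) (⊖-inverseˡ f))
          ; ⁻¹-cong = ⊖-cong }
        ; comm = ⊕-comm }
      ; *-cong = ·-cong
      ; *-assoc = ·-assoc
      ; *-identity = ·-identityˡ , (λ f → ≈-trans (·-comm f oneS) (·-identityˡ f))
      ; distrib = ·-distribˡ , λ f g h → ≈-trans (·-comm (g ⊕ h) f)
          (≈-trans (·-distribˡ f g h) (⊕-cong (·-comm f g) (·-comm f h))) }
    ; *-comm = ·-comm } }

opaque
  unfolding _⊕_ κ

  κ-+ : ∀ c d → κ (c + d) ≈ κ c ⊕ κ d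
  κ-+ c d = ext λ { zero → refl ; (suc _) → refl }

  κ-* : ∀ c d → κ (c * d) ≈ κ c · κ d
  κ-* c d = ext λ { zero → sym (κ-· c (κ d) 0) ; (suc n) → sym (trans (κ-· c (κ d) (suc n)) (ℤP.*-zeroʳ c)) }

  κ-neg : ∀ c → κ (- c) ≈ ⊖ κ c
  κ-neg c = ext λ { zero → refl ; (suc _) → refl }

  κ-0 : κ (+ 0) ≈ zeroS
  κ-0 = ext λ { zero → refl ; (suc _) → refl }

coefficient≟ : ∀ c d → Maybe (κ c ≈ κ d)
coefficient≟ c d with c ℤP.≟ d
... | yes refl = just ≈-refl
... | no  _    = nothing

κ-morphism : CommutativeRing.rawRing ℤP.+-*-commutativeRing -Raw-AlmostCommutative⟶ fromCommutativeRing seriesRing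
κ-morphism = record { ⟦_⟧ = κ ; +-homo = κ-+ ; *-homo = κ-* ; -‿homo = κ-neg ; 0-homo = κ-0 ; 1-homo = κ-1 }

module SeriesSolver = RingSolver
  (CommutativeRing.rawRing ℤP.+-*-commutativeRing)
  (fromCommutativeRing seriesRing)
  κ-morphism
  coefficient≟
  using (solve; con; _:+_; _:*_; :-_; _:=_)

open SeriesSolver

module ≈-Reasoning = SetoidReasoning (CommutativeRing.setoid seriesRing)

-- dil k substitutes qᵏ for q.
opaque
  dil : (k : ℕ) .{{_ : NonZero k}} → Series → Series
  dil k f n = if does (k ∣? n) then f (n / k) else + 0

  dil-at : ∀ k .{{_ : NonZero k}} f n → dil k f n ≡ (if does (k ∣? n) then f (n / k) else + 0)
  dil-at k f n = refl

  dil-multiple : ∀ k .{{_ : NonZero k}} f m → dil k f (k ℕ.* m) ≡ f m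
  dil-multiple k f m rewrite dec-true (k ∣? (k ℕ.* m)) (m∣m*n m) =
    cong f (trans (cong (_/ k) (ℕP.*-comm k m)) (m*n/n≡m m k))

  dil-nonmultiple : ∀ k .{{_ : NonZero k}} f n → ¬ (k ∣ n) → dil k f n ≡ + 0
  dil-nonmultiple k f n k∤n rewrite dec-false (k ∣? n) k∤n = refl

dil-elim : ∀ k .{{_ : NonZero k}} (P : ℕ → Set) → (∀ m → P (k ℕ.* m)) → (∀ n → ¬ (k ∣ n) → P n) → ∀ n → P n
dil-elim k P multiple nonmultiple n with k ∣? n
... | yes (divides m refl) = subst P (ℕP.*-comm k m) (multiple m)
... | no k∤n               = nonmultiple n k∤n

-- Through this, the rules for `dil` reduce to arithmetic of weights: distributivity for products,
-- associativity for iterated substitutions.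
⟦scale⟧ : {I : Set} (k : ℕ) .{{_ : NonZero k}} (w : Weighted I) (f : I → ℤ) → ⟦ scale k w ⟧ f ≈ dil k (⟦ w ⟧ f)
⟦scale⟧ k w f = ext (dil-elim k (λ n → ⟦ scale k w ⟧ f n ≡ dil k (⟦ w ⟧ f) n)
  (λ m → trans
    (⟦⟧-list (scale k w) f (k ℕ.* m) (fibre-unique w m)
      (λ p → cong (k ℕ.*_) (∈-fibre⁻ w p)) (λ i eq → ∈-fibre⁺ w i (ℕP.*-cancelˡ-≡ (wt w i) m k eq)))
    (sym (dil-multiple k (⟦ w ⟧ f) m)))
  (λ n k∤n → trans
    (⟦⟧-list (scale k w) f n {[]} [] (λ ()) (λ i eq → ⊥-elim (k∤n (divides (wt w i) (trans (sym eq) (ℕP.*-comm k (wt w i)))))))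
    (sym (dil-nonmultiple k (⟦ w ⟧ f) n k∤n))))

dil-cong : ∀ k .{{_ : NonZero k}} {f g} → f ≈ g → dil k f ≈ dil k g
dil-cong k {f} {g} p = ext (dil-elim k (λ n → dil k f n ≡ dil k g n)
  (λ m → trans (dil-multiple k f m) (trans (at p m) (sym (dil-multiple k g m))))
  (λ n k∤n → trans (dil-nonmultiple k f n k∤n) (sym (dil-nonmultiple k g n k∤n))))

dil≈⟦⟧ : ∀ k .{{_ : NonZero k}} f → dil k f ≈ ⟦ scale k nat ⟧ f
dil≈⟦⟧ k f = ≈-trans (dil-cong k (≈-sym (⟦nat⟧ f))) (≈-sym (⟦scale⟧ k nat f))

dil-· : ∀ k .{{_ : NonZero k}} f g → dil k (f · g) ≈ dil k f · dil k g
dil-· k f g = begin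
  dil k (f · g) ≈⟨ dil-cong k (·-def f g) ⟩
  dil k (⟦ nat ⊗ nat ⟧ h) ≈⟨ ⟦scale⟧ k (nat ⊗ nat) h ⟨
  ⟦ scale k (nat ⊗ nat) ⟧ h ≈⟨ ⟦⟧-reweigh (scale k (nat ⊗ nat)) (scale k nat ⊗ scale k nat)
        (λ (i , j) → sym (ℕP.*-distribˡ-+ k i j)) (λ _ → refl) ⟩
  ⟦ scale k nat ⊗ scale k nat ⟧ h ≈⟨ ⟦⊗⟧ (scale k nat) (scale k nat) f g ⟩
  ⟦ scale k nat ⟧ f · ⟦ scale k nat ⟧ g ≈⟨ ·-cong (dil≈⟦⟧ k f) (dil≈⟦⟧ k g) ⟨
  dil k f · dil k g ∎
  where
  open ≈-Reasoning
  h = λ p → f (proj₁ p) * g (proj₂ p)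

dil-dil : ∀ k l .{{_ : NonZero k}} .{{_ : NonZero l}} .{{_ : NonZero (k ℕ.* l)}} f → dil k (dil l f) ≈ dil (k ℕ.* l) f
dil-dil k l f = begin
  dil k (dil l f) ≈⟨ dil-cong k (dil≈⟦⟧ l f) ⟩
  dil k (⟦ scale l nat ⟧ f) ≈⟨ ⟦scale⟧ k (scale l nat) f ⟨
  ⟦ scale k (scale l nat) ⟧ f ≈⟨ ⟦⟧-reweigh (scale k (scale l nat)) (scale (k ℕ.* l) nat) (ℕP.*-assoc k l) (λ _ → refl) ⟩
  ⟦ scale (k ℕ.* l) nat ⟧ f ≈⟨ dil≈⟦⟧ (k ℕ.* l) f ⟨
  dil (k ℕ.* l) f ∎
  where open ≈-Reasoning

dil-⊕ : ∀ k .{{_ : NonZero k}} f g → dil k (f ⊕ g) ≈ dil k f ⊕ dil k g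
dil-⊕ k f g = ≈-trans (dil≈⟦⟧ k (f ⊕ g)) (≈-trans (≈-trans (⟦⟧-cong (scale k nat) (λ _ → ⊕-at _)) (⟦⟧-+ (scale k nat) f g)) (≈-sym (⊕-cong (dil≈⟦⟧ k f) (dil≈⟦⟧ k g))))

dil-κ : ∀ k .{{_ : NonZero k}} c → dil k (κ c) ≈ κ c
dil-κ k c = begin
  dil k (κ c) ≈⟨ dil-cong k (κ≈⟦⟧ c) ⟩
  dil k (⟦ point 0 ⟧ (λ _ → c)) ≈⟨ ⟦scale⟧ k (point 0) _ ⟨
  ⟦ scale k (point 0) ⟧ (λ _ → c) ≈⟨ ⟦⟧-reweigh (scale k (point 0)) (point 0) (λ _ → sym (ℕP.*-zeroʳ k)) (λ _ → refl) ⟩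
  ⟦ point 0 ⟧ (λ _ → c) ≈⟨ κ≈⟦⟧ c ⟨
  κ c ∎
  where open ≈-Reasoning

dil-κ· : ∀ k .{{_ : NonZero k}} c f → dil k (κ c · f) ≈ κ c · dil k f
dil-κ· k c f = ≈-trans (dil-· k (κ c) f) (·-cong (dil-κ k c) ≈-refl)

-- The quadratic forms as weights

ints : ℕ → List ℤ
ints n = map +_ (upTo (suc n)) ++ map -[1+_] (upTo n)

∈-ints : ∀ {n} x → ∣ x ∣ ≤ n → x ∈ ints n
∈-ints (+ i)      le = ∈-++⁺ˡ (∈-map⁺ +_ (∈-upTo⁺ (s≤s le)))
∈-ints -[1+ i ]   le = ∈-++⁺ʳ _ (∈-map⁺ -[1+_] (∈-upTo⁺ le))

_≟²_ : DecidableEquality (ℤ × ℤ)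
_≟²_ = ×P.≡-dec ℤP._≟_ ℤP._≟_

sq : ℤ → ℕ
sq x = ∣ x ∣ ℕ.* ∣ x ∣

+sq : ∀ x → + sq x ≡ x * x
+sq (+ n)      = ℤP.pos-* n n
+sq -[1+ n ]   = refl

n≤n*n : ∀ n → n ≤ n ℕ.* n
n≤n*n zero    = z≤n
n≤n*n (suc n) = ℕP.m≤m*n (suc n) (suc n)

-- The sum of three squares makes the form nonnegative and bounds both coordinates by twice its
-- value, which provides the finite boxes.
2Q : ∀ x y → + 2 * (x * x + x * y + y * y) ≡ x * x + y * y + (x + y) * (x + y)
2Q = solve-∀

2∣Q∣ : ∀ x y → 2 ℕ.* ∣ Q x y ∣ ≡ sq x ℕ.+ sq y ℕ.+ sq (x + y)
2∣Q∣ x y = begin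
  2 ℕ.* ∣ Q x y ∣ ≡⟨ ℤP.abs-* (+ 2) (Q x y) ⟨
  ∣ + 2 * Q x y ∣ ≡⟨ cong ∣_∣ (2Q x y) ⟩
  ∣ x * x + y * y + (x + y) * (x + y) ∣ ≡⟨ cong ∣_∣ (cong₂ _+_ (cong₂ _+_ (+sq x) (+sq y)) (+sq (x + y))) ⟨
  sq x ℕ.+ sq y ℕ.+ sq (x + y) ∎
  where
  open ≡-Reasoning

Q≥0 : ∀ x y → + ∣ Q x y ∣ ≡ Q x y
Q≥0 x y = nonneg (Q x y) (begin
  + 2 * Q x y ≡⟨ 2Q x y ⟩
  x * x + y * y + (x + y) * (x + y) ≡⟨ cong₂ _+_ (cong₂ _+_ (+sq x) (+sq y)) (+sq (x + y)) ⟨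
  + (sq x ℕ.+ sq y ℕ.+ sq (x + y)) ∎)
  where
  open ≡-Reasoning
  nonneg : ∀ z {m} → + 2 * z ≡ + m → + ∣ z ∣ ≡ z
  nonneg (+ n)    _  = refl
  nonneg -[1+ n ] ()

∣x∣≤2∣Q∣ : ∀ x y → ∣ x ∣ ≤ 2 ℕ.* ∣ Q x y ∣
∣x∣≤2∣Q∣ x y = ℕP.≤-trans (n≤n*n ∣ x ∣) (ℕP.≤-trans (ℕP.≤-trans (ℕP.m≤m+n (sq x) (sq y)) (ℕP.m≤m+n _ _)) (ℕP.≤-reflexive (sym (2∣Q∣ x y))))

∣y∣≤2∣Q∣ : ∀ x y → ∣ y ∣ ≤ 2 ℕ.* ∣ Q x y ∣
∣y∣≤2∣Q∣ x y = ℕP.≤-trans (n≤n*n ∣ y ∣) (ℕP.≤-trans (ℕP.≤-trans (ℕP.m≤n+m (sq y) (sq x)) (ℕP.m≤m+n _ _)) (ℕP.≤-reflexive (sym (2∣Q∣ x y))))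

hexagonal : Weighted (ℤ × ℤ)
hexagonal = record
  { _≟_   = _≟²_
  ; wt    = λ (x , y) → ∣ Q x y ∣
  ; box   = λ n → cartesianProduct (ints (2 ℕ.* n)) (ints (2 ℕ.* n))
  ; ∈-box = λ (x , y) le → ∈-cartesianProduct⁺
      (∈-ints x (ℕP.≤-trans (∣x∣≤2∣Q∣ x y) (ℕP.*-monoʳ-≤ 2 le)))
      (∈-ints y (ℕP.≤-trans (∣y∣≤2∣Q∣ x y) (ℕP.*-monoʳ-≤ 2 le)))
  }

squares : Weighted ℤ
squares = record
  { _≟_ = ℤP._≟_ ; wt = sq ; box = ints ; ∈-box = λ x le → ∈-ints x (ℕP.≤-trans (n≤n*n ∣ x ∣) le) }

pronic : ℤ → ℕ
pronic (+ k)      = k ℕ.* suc k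
pronic -[1+ k ]   = k ℕ.* suc k

+pronic : ∀ k → + pronic k ≡ k * k + k
+pronic (+ k) = trans (ℤP.pos-* k (suc k)) (lemma (+ k))
  where
  lemma : ∀ k → k * (+ 1 + k) ≡ k * k + k
  lemma = solve-∀
+pronic -[1+ k ] = trans (ℤP.pos-* k (suc k)) (lemma (+ k))
  where
  lemma : ∀ k → k * (+ 1 + k) ≡ - (+ 1 + k) * - (+ 1 + k) + - (+ 1 + k)
  lemma = solve-∀

k≤pronic : ∀ k → k ≤ k ℕ.* suc k
k≤pronic k = ℕP.m≤m*n k (suc k)

pronics : Weighted ℤ
pronics = record
  { _≟_ = ℤP._≟_ ; wt = pronic ; box = ints ∘ suc
  ; ∈-box = λ { (+ k)    le → ∈-ints (+ k) (ℕP.m≤n⇒m≤1+n (ℕP.≤-trans (k≤pronic k) le))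
              ; -[1+ k ] le → ∈-ints -[1+ k ] (s≤s (ℕP.≤-trans (k≤pronic k) le)) } }

pronicsℕ : Weighted ℕ
pronicsℕ = record
  { _≟_ = ℕ._≟_ ; wt = λ k → k ℕ.* suc k ; box = upTo ∘ suc
  ; ∈-box = λ k le → ∈-upTo⁺ (s≤s (ℕP.≤-trans (k≤pronic k) le)) }

one : {I : Set} → I → ℤ
one _ = + 1

-- Splitting integers by parity

join : ℤ ⊎ ℤ → ℤ
join (inj₁ u) = + 2 * u
join (inj₂ u) = + 2 * u + + 1

half : ℤ → ℤ
half x = x ℤD./ℕ 2

halve : ℤ → ℤ ⊎ ℤ
halve x with x ℤD.%ℕ 2
... | zero  = inj₁ (half x)
... | suc _ = inj₂ (half x)

join-halve : ∀ x → join (halve x) ≡ x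
join-halve x with x ℤD.%ℕ 2 | ℤD.a≡a%ℕn+[a/ℕn]*n x 2 | ℤD.n%ℕd<d x 2
... | zero        | eq | _ = trans (trans (ℤP.*-comm (+ 2) (half x)) (sym (ℤP.+-identityˡ _))) (sym eq)
... | suc zero    | eq | _ = trans (trans (cong (_+ + 1) (ℤP.*-comm (+ 2) (half x))) (ℤP.+-comm (half x * + 2) (+ 1))) (sym eq)
... | suc (suc _) | _  | s≤s (s≤s ())

2*≢odd : ∀ u v → ¬ (+ 2 * u ≡ + 2 * v + + 1)
2*≢odd u v eq = impossible ∣ u - v ∣ (trans (sym (ℤP.abs-* (+ 2) (u - v))) (cong ∣_∣ (begin
  + 2 * (u - v) ≡⟨ distrib u v ⟩
  + 2 * u - + 2 * v ≡⟨ cong (_- + 2 * v) eq ⟩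
  + 2 * v + + 1 - + 2 * v ≡⟨ lemma v ⟩
  + 1 ∎)))
  where
  open ≡-Reasoning
  distrib : ∀ u v → + 2 * (u - v) ≡ + 2 * u - + 2 * v
  distrib = solve-∀
  lemma : ∀ v → + 2 * v + + 1 - + 2 * v ≡ + 1
  lemma = solve-∀
  impossible : ∀ n → ¬ (2 ℕ.* n ≡ 1)
  impossible zero    ()
  impossible (suc n) e with trans (sym (ℕP.+-suc n (n ℕ.+ 0))) (ℕP.suc-injective e)
  ... | ()

join-injective : ∀ i j → join i ≡ join j → i ≡ j
join-injective (inj₁ u) (inj₁ v) eq = cong inj₁ (ℤP.*-cancelˡ-≡ (+ 2) u v eq)
join-injective (inj₁ u) (inj₂ v) eq = ⊥-elim (2*≢odd u v eq)
join-injective (inj₂ u) (inj₁ v) eq = ⊥-elim (2*≢odd v u (sym eq))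
join-injective (inj₂ u) (inj₂ v) eq = cong inj₂ (ℤP.*-cancelˡ-≡ (+ 2) u v (∙-cancelʳ ℤP.+-0-abelianGroup (+ 1) _ _ eq))

halve-join : ∀ i → halve (join i) ≡ i
halve-join i = join-injective _ _ (join-halve (join i))

half-even : ∀ u → half (+ 2 * u) ≡ u
half-even u with (+ 2 * u) ℤD.%ℕ 2 | halve-join (inj₁ u)
... | zero  | eq = inj₁-inj eq
  where
  inj₁-inj : ∀ {a b : ℤ} → _≡_ {A = ℤ ⊎ ℤ} (inj₁ a) (inj₁ b) → a ≡ b
  inj₁-inj refl = refl
... | suc _ | ()

half-odd : ∀ u → half (+ 2 * u + + 1) ≡ u
half-odd u with (+ 2 * u + + 1) ℤD.%ℕ 2 | halve-join (inj₂ u)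
... | suc _  | eq = inj₂-inj eq
  where
  inj₂-inj : ∀ {a b : ℤ} → _≡_ {A = ℤ ⊎ ℤ} (inj₂ a) (inj₂ b) → a ≡ b
  inj₂-inj refl = refl
... | zero | ()

module _ {J : Set} where

  -- `half` rounds down, so it is a left inverse of both u ↦ 2u and u ↦ 2u + 1.
  evenˣ oddˣ : DecidableEquality (ℤ × J) → Weighted (ℤ × J) → Weighted (ℤ × J)
  evenˣ _≟_ = pull _≟_ (λ (u , j) → + 2 * u , j) (λ (x , j) → half x , j) (λ (u , j) → cong (_, j) (half-even u))
  oddˣ  _≟_ = pull _≟_ (λ (u , j) → + 2 * u + + 1 , j) (λ (x , j) → half x , j) (λ (u , j) → cong (_, j) (half-odd u))

  evenʸ oddʸ : DecidableEquality (J × ℤ) → Weighted (J × ℤ) → Weighted (J × ℤ)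
  evenʸ _≟_ = pull _≟_ (λ (j , u) → j , + 2 * u) (λ (j , x) → j , half x) (λ (j , u) → cong (j ,_) (half-even u))
  oddʸ  _≟_ = pull _≟_ (λ (j , u) → j , + 2 * u + + 1) (λ (j , x) → j , half x) (λ (j , u) → cong (j ,_) (half-odd u))

  parityˣ : (ℤ × J) ⊎ (ℤ × J) ≅ ℤ × J
  parityˣ = record
    { to      = [ (λ (u , j) → + 2 * u , j) , (λ (u , j) → + 2 * u + + 1 , j) ]′
    ; from    = λ (x , j) → tag j (halve x)
    ; from-to = λ { (inj₁ (u , j)) → cong (tag j) (halve-join (inj₁ u)) ; (inj₂ (u , j)) → cong (tag j) (halve-join (inj₂ u)) }
    ; to-from = λ (x , j) → trans (untag j (halve x)) (cong (_, j) (join-halve x)) }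
    where
    tag : J → ℤ ⊎ ℤ → (ℤ × J) ⊎ (ℤ × J)
    tag j = [ (λ u → inj₁ (u , j)) , (λ u → inj₂ (u , j)) ]′
    untag : ∀ j i → [ (λ (u , j) → + 2 * u , j) , (λ (u , j) → + 2 * u + + 1 , j) ]′ (tag j i) ≡ (join i , j)
    untag j (inj₁ u) = refl
    untag j (inj₂ u) = refl

  parityʸ : (J × ℤ) ⊎ (J × ℤ) ≅ J × ℤ
  parityʸ = record
    { to      = [ (λ (j , u) → j , + 2 * u) , (λ (j , u) → j , + 2 * u + + 1) ]′
    ; from    = λ (j , x) → tag j (halve x)
    ; from-to = λ { (inj₁ (j , u)) → cong (tag j) (halve-join (inj₁ u)) ; (inj₂ (j , u)) → cong (tag j) (halve-join (inj₂ u)) }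
    ; to-from = λ (j , x) → trans (untag j (halve x)) (cong (j ,_) (join-halve x)) }
    where
    tag : J → ℤ ⊎ ℤ → (J × ℤ) ⊎ (J × ℤ)
    tag j = [ (λ u → inj₁ (j , u)) , (λ u → inj₂ (j , u)) ]′
    untag : ∀ j i → [ (λ (j , u) → j , + 2 * u) , (λ (j , u) → j , + 2 * u + + 1) ]′ (tag j i) ≡ (j , join i)
    untag j (inj₁ u) = refl
    untag j (inj₂ u) = refl

  splitˣ : ∀ ≟ (w : Weighted (ℤ × J)) f →
    ⟦ w ⟧ f ≈ ⟦ evenˣ ≟ w ⟧ (λ (u , j) → f (+ 2 * u , j)) ⊕ ⟦ oddˣ ≟ w ⟧ (λ (u , j) → f (+ 2 * u + + 1 , j))
  splitˣ ≟ w f = ≈-trans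
    (≈-sym (⟦⟧-bij (evenˣ ≟ w ⊞ oddˣ ≟ w) w parityˣ {g = f} (λ { (inj₁ _) → refl ; (inj₂ _) → refl }) (λ _ → refl)))
    (⟦⊞⟧ (evenˣ ≟ w) (oddˣ ≟ w) _)

  splitʸ : ∀ ≟ (w : Weighted (J × ℤ)) f →
    ⟦ w ⟧ f ≈ ⟦ evenʸ ≟ w ⟧ (λ (j , u) → f (j , + 2 * u)) ⊕ ⟦ oddʸ ≟ w ⟧ (λ (j , u) → f (j , + 2 * u + + 1))
  splitʸ ≟ w f = ≈-trans
    (≈-sym (⟦⟧-bij (evenʸ ≟ w ⊞ oddʸ ≟ w) w parityʸ {g = f} (λ { (inj₁ _) → refl ; (inj₂ _) → refl }) (λ _ → refl)))
    (⟦⊞⟧ (evenʸ ≟ w) (oddʸ ≟ w) _)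

-- The theta series of the hexagonal lattice

hex₀₀ hex₀₁ hex₁₀ hex₁₁ : Weighted (ℤ × ℤ)
hex₀₀ = evenˣ _≟²_ (evenʸ _≟²_ hexagonal)
hex₀₁ = evenˣ _≟²_ (oddʸ _≟²_ hexagonal)
hex₁₀ = oddˣ _≟²_ (evenʸ _≟²_ hexagonal)
hex₁₁ = oddˣ _≟²_ (oddʸ _≟²_ hexagonal)

a : Series
a = ⟦ hexagonal ⟧ one

-- The points with x odd and y even; the other two nonzero classes modulo 2 contribute the same series.
H : Series
H = ⟦ hex₁₀ ⟧ one

hex₀₀≈ : ⟦ hex₀₀ ⟧ one ≈ dil 4 a
hex₀₀≈ = ≈-trans (⟦⟧-reweigh hex₀₀ (scale 4 hexagonal) (λ (u , v) → quadruple u v) (λ _ → refl)) (⟦scale⟧ 4 hexagonal one)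
  where
  quadruple : ∀ u v → 4 ℕ.* ∣ Q u v ∣ ≡ ∣ Q (+ 2 * u) (+ 2 * v) ∣
  quadruple u v = trans (sym (ℤP.abs-* (+ 4) (Q u v))) (cong ∣_∣ (lemma u v))
    where
    lemma : ∀ u v → + 4 * (u * u + u * v + v * v) ≡ + 2 * u * (+ 2 * u) + + 2 * u * (+ 2 * v) + + 2 * v * (+ 2 * v)
    lemma = solve-∀

hex₀₁≈H : ⟦ hex₀₁ ⟧ one ≈ H
hex₀₁≈H = ⟦⟧-bij hex₀₁ hex₁₀ (record { to = swap ; from = swap ; from-to = λ _ → refl ; to-from = λ _ → refl })
  (λ (u , v) → cong ∣_∣ (Q-swap (+ 2 * v + + 1) (+ 2 * u))) (λ _ → refl)
  where
  Q-swap : ∀ x y → x * x + x * y + y * y ≡ y * y + y * x + x * x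
  Q-swap = solve-∀

-- The automorphism (x, y) ↦ (-x - y, y) of the form keeps y and makes the sum of two odd
-- coordinates the new, even, first one.
hex₁₁≈H : ⟦ hex₁₁ ⟧ one ≈ H
hex₁₁≈H = ≈-trans (⟦⟧-bij hex₁₁ hex₀₁
  (record { to = turn ; from = turn ; from-to = λ (u , v) → cong (_, v) (back u v) ; to-from = λ (u , v) → cong (_, v) (back u v) })
  (λ (u , v) → cong ∣_∣ (weight u v)) (λ _ → refl)) hex₀₁≈H
  where
  turn : ℤ × ℤ → ℤ × ℤ
  turn (u , v) = - u - v - + 1 , v
  back : ∀ u v → - (- u - v - + 1) - v - + 1 ≡ u
  back = solve-∀
  weight : ∀ u v → Q (+ 2 * (- u - v - + 1)) (+ 2 * v + + 1) ≡ Q (+ 2 * u + + 1) (+ 2 * v + + 1)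
  weight u v = turned (+ 2 * u + + 1) (+ 2 * v + + 1) (+ 2 * (- u - v - + 1)) (negated u v)
    where
    negated : ∀ u v → + 2 * (- u - v - + 1) ≡ - (+ 2 * u + + 1 + (+ 2 * v + + 1))
    negated = solve-∀
    Q-turn : ∀ x y → - (x + y) * - (x + y) + - (x + y) * y + y * y ≡ x * x + x * y + y * y
    Q-turn = solve-∀
    turned : ∀ x y z → z ≡ - (x + y) → Q z y ≡ Q x y
    turned x y z refl = Q-turn x y

odd-rows : ⟦ oddʸ _≟²_ hexagonal ⟧ one ≈ H ⊕ H
odd-rows = ≈-trans (splitˣ _≟²_ (oddʸ _≟²_ hexagonal) one) (⊕-cong hex₀₁≈H hex₁₁≈H)

a≈a₄+3H : a ≈ dil 4 a ⊕ κ (+ 3) · H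
a≈a₄+3H = begin
  a ≈⟨ splitʸ _≟²_ hexagonal one ⟩
  ⟦ evenʸ _≟²_ hexagonal ⟧ one ⊕ ⟦ oddʸ _≟²_ hexagonal ⟧ one ≈⟨ ⊕-cong (splitˣ _≟²_ (evenʸ _≟²_ hexagonal) one) odd-rows ⟩
  ⟦ hex₀₀ ⟧ one ⊕ H ⊕ (H ⊕ H) ≈⟨ ⊕-cong (⊕-cong hex₀₀≈ ≈-refl) ≈-refl ⟩
  dil 4 a ⊕ H ⊕ (H ⊕ H) ≈⟨ solve 2 (λ a H → a :+ H :+ (H :+ H) := a :+ con (+ 3) :* H) ≈-refl (dil 4 a) H ⟩
  dil 4 a ⊕ κ (+ 3) · H ∎
  where
  open ≈-Reasoning

opaque
  mono : ℕ → Series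
  mono k = ⟦ point k ⟧ one

  ⟦point⟧ : ∀ k → ⟦ point k ⟧ one ≈ mono k
  ⟦point⟧ k = ≈-refl

-- ψ(q²)
ψ² : Series
ψ² = ⟦ pronicsℕ ⟧ one

pronics≈2ψ² : ⟦ pronics ⟧ one ≈ κ (+ 2) · ψ²
pronics≈2ψ² = begin
  ⟦ pronics ⟧ one ≈⟨ ⟦⟧-bij (pronicsℕ ⊞ pronicsℕ) pronics signs (λ { (inj₁ _) → refl ; (inj₂ _) → refl }) (λ _ → refl) ⟨
  ⟦ pronicsℕ ⊞ pronicsℕ ⟧ one ≈⟨ ⟦⊞⟧ pronicsℕ pronicsℕ one ⟩
  ψ² ⊕ ψ² ≈⟨ solve 1 (λ x → x :+ x := con (+ 2) :* x) ≈-refl ψ² ⟩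
  κ (+ 2) · ψ² ∎
  where
  open ≈-Reasoning
  signs : ℕ ⊎ ℕ ≅ ℤ
  signs = record
    { to = [ +_ , -[1+_] ]′ ; from = λ { (+ n) → inj₁ n ; -[1+ n ] → inj₂ n }
    ; from-to = λ { (inj₁ _) → refl ; (inj₂ _) → refl } ; to-from = λ { (+ _) → refl ; -[1+ _ ] → refl } }

κ-cancel : ∀ c .{{_ : ℤ.NonZero c}} {f g} → κ c · f ≈ κ c · g → f ≈ g
κ-cancel c {f} {g} p = ext λ n → ℤP.*-cancelˡ-≡ c (f n) (g n) (trans (sym (κ-· c f n)) (trans (at p n) (κ-· c g n)))

-- qψ(q²)ψ(q⁶)
Y : Series
Y = mono 1 · (ψ² · dil 3 ψ²)

-- On the rows y = 2k + 1 the form is 1 + (j² + j) + 3 (k² + k) with j = x + k. These rows contain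
-- two of the three nonzero classes, hence 2H; each sum over j or k in ℤ counts every pronic number
-- twice, hence 4Y.
H≈2Y : H ≈ κ (+ 2) · Y
H≈2Y = κ-cancel (+ 2) (begin
  κ (+ 2) · H ≈⟨ solve 1 (λ x → con (+ 2) :* x := x :+ x) ≈-refl H ⟩
  H ⊕ H ≈⟨ odd-rows ⟨
  ⟦ oddʸ _≟²_ hexagonal ⟧ one ≈⟨ ⟦⟧-bij (oddʸ _≟²_ hexagonal) (point 1 ⊗ pronics ⊗ scale 3 pronics) diagonalise (λ (x , k) → ℤP.+-injective (weight x k)) (λ _ → refl) ⟩
  ⟦ point 1 ⊗ pronics ⊗ scale 3 pronics ⟧ one ≈⟨ ⟦⊗⟧ (point 1) (pronics ⊗ scale 3 pronics) one one ⟩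
  ⟦ point 1 ⟧ one · ⟦ pronics ⊗ scale 3 pronics ⟧ one ≈⟨ ·-cong (⟦point⟧ 1) (⟦⊗⟧ pronics (scale 3 pronics) one one) ⟩
  mono 1 · (⟦ pronics ⟧ one · ⟦ scale 3 pronics ⟧ one) ≈⟨ ·-cong ≈-refl (·-cong pronics≈2ψ² (≈-trans (⟦scale⟧ 3 pronics one) (≈-trans (dil-cong 3 pronics≈2ψ²) (dil-κ· 3 (+ 2) ψ²)))) ⟩
  mono 1 · (κ (+ 2) · ψ² · (κ (+ 2) · dil 3 ψ²)) ≈⟨ solve 3 (λ m x y → m :* (con (+ 2) :* x :* (con (+ 2) :* y)) := con (+ 2) :* (con (+ 2) :* (m :* (x :* y)))) ≈-refl (mono 1) ψ² (dil 3 ψ²) ⟩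
  κ (+ 2) · (κ (+ 2) · Y) ∎)
  where
  open ≈-Reasoning
  diagonalise : ℤ × ℤ ≅ ⊤ × ℤ × ℤ
  diagonalise = record
    { to = λ (x , k) → tt , x + k , k ; from = λ (tt , j , k) → j - k , k
    ; from-to = λ (x , k) → cong (_, k) (back x k) ; to-from = λ (tt , j , k) → cong (λ z → tt , z , k) (forth j k) }
    where
    back : ∀ x k → x + k - k ≡ x
    back = solve-∀
    forth : ∀ j k → j - k + k ≡ j
    forth = solve-∀
  weight : ∀ x k → + (1 ℕ.+ (pronic (x + k) ℕ.+ 3 ℕ.* pronic k)) ≡ + ∣ Q x (+ 2 * k + + 1) ∣
  weight x k = trans (cong₂ (λ s t → + 1 + (s + t)) (+pronic (x + k)) (trans (ℤP.pos-* 3 (pronic k)) (cong (+ 3 *_) (+pronic k))))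
    (trans (identity x k) (sym (Q≥0 x (+ 2 * k + + 1))))
    where
    identity : ∀ x k → + 1 + ((x + k) * (x + k) + (x + k) + + 3 * (k * k + k)) ≡
      x * x + x * (+ 2 * k + + 1) + (+ 2 * k + + 1) * (+ 2 * k + + 1)
    identity = solve-∀

-- (-1)ˣ
sgn : ℤ → ℤ
sgn x = [ (λ _ → + 1) , (λ _ → - + 1) ]′ (halve x)

sgn-even : ∀ u → sgn (+ 2 * u) ≡ + 1
sgn-even u = cong [ _ , _ ]′ (halve-join (inj₁ u))

sgn-odd : ∀ u → sgn (+ 2 * u + + 1) ≡ - + 1
sgn-odd u = cong [ _ , _ ]′ (halve-join (inj₂ u))

sgn-+ : ∀ x y → sgn (x + y) ≡ sgn x * sgn y
sgn-+ x y = subst (λ x → sgn (x + y) ≡ sgn x * sgn y) (join-halve x)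
  (subst (λ y → sgn (join (halve x) + y) ≡ sgn (join (halve x)) * sgn y) (join-halve y) (lemma (halve x) (halve y)))
  where
  ee : ∀ u v → + 2 * u + + 2 * v ≡ + 2 * (u + v)
  ee = solve-∀
  eo : ∀ u v → + 2 * u + (+ 2 * v + + 1) ≡ + 2 * (u + v) + + 1
  eo = solve-∀
  oe : ∀ u v → + 2 * u + + 1 + + 2 * v ≡ + 2 * (u + v) + + 1
  oe = solve-∀
  oo : ∀ u v → + 2 * u + + 1 + (+ 2 * v + + 1) ≡ + 2 * (u + v + + 1)
  oo = solve-∀
  lemma : ∀ i j → sgn (join i + join j) ≡ sgn (join i) * sgn (join j)
  lemma (inj₁ u) (inj₁ v) = trans (trans (cong sgn (ee u v)) (sgn-even (u + v))) (sym (cong₂ _*_ (sgn-even u) (sgn-even v)))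
  lemma (inj₁ u) (inj₂ v) = trans (trans (cong sgn (eo u v)) (sgn-odd (u + v))) (sym (cong₂ _*_ (sgn-even u) (sgn-odd v)))
  lemma (inj₂ u) (inj₁ v) = trans (trans (cong sgn (oe u v)) (sgn-odd (u + v))) (sym (cong₂ _*_ (sgn-odd u) (sgn-even v)))
  lemma (inj₂ u) (inj₂ v) = trans (trans (cong sgn (oo u v)) (sgn-even (u + v + + 1))) (sym (cong₂ _*_ (sgn-odd u) (sgn-odd v)))

sgn² : ∀ x → sgn x * sgn x ≡ + 1
sgn² x with halve x
... | inj₁ _ = refl
... | inj₂ _ = refl

-- φ(-q)
φ⁻ : Series
φ⁻ = ⟦ squares ⟧ sgn

⟦⟧-neg : {I : Set} (w : Weighted I) (f : I → ℤ) → ⟦ w ⟧ (λ i → - f i) ≈ ⊖ ⟦ w ⟧ f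
⟦⟧-neg w f = ext λ n → trans (lemma (fibre w n)) (sym (⊖-at n))
  where
  lemma : ∀ xs → sumL (λ i → - f i) xs ≡ - sumL f xs
  lemma []       = refl
  lemma (x ∷ xs) = trans (+-congʳ (- f x) (lemma xs)) (sym (ℤP.neg-distrib-+ (f x) (sumL f xs)))

-- On the rows y = 2s the form is (x + s)² + 3s², and the product of the two signs is (-1)^(x + 2s)
-- = (-1)^x. So even x contribute positively and odd x negatively.
φ⁻φ⁻₃≈a₄-H : φ⁻ · dil 3 φ⁻ ≈ dil 4 a ⊕ ⊖ H
φ⁻φ⁻₃≈a₄-H = begin
  φ⁻ · dil 3 φ⁻ ≈⟨ ·-cong ≈-refl (⟦scale⟧ 3 squares sgn) ⟨
  φ⁻ · ⟦ scale 3 squares ⟧ sgn ≈⟨ ⟦⊗⟧ squares (scale 3 squares) sgn sgn ⟨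
  ⟦ squares ⊗ scale 3 squares ⟧ (λ (u , s) → sgn u * sgn s) ≈⟨ ⟦⟧-bij (evenʸ _≟²_ hexagonal) (squares ⊗ scale 3 squares) diagonalise
        (λ (x , s) → ℤP.+-injective (weight x s)) (λ (x , s) → signs x s) ⟨
  ⟦ evenʸ _≟²_ hexagonal ⟧ (λ (x , s) → sgn x) ≈⟨ splitˣ _≟²_ (evenʸ _≟²_ hexagonal) _ ⟩
  ⟦ hex₀₀ ⟧ (λ (u , s) → sgn (+ 2 * u)) ⊕ ⟦ hex₁₀ ⟧ (λ (u , s) → sgn (+ 2 * u + + 1))
        ≈⟨ ⊕-cong (⟦⟧-cong hex₀₀ (λ (u , _) → sgn-even u)) (⟦⟧-cong hex₁₀ (λ (u , _) → sgn-odd u)) ⟩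
  ⟦ hex₀₀ ⟧ one ⊕ ⟦ hex₁₀ ⟧ (λ i → - one i) ≈⟨ ⊕-cong hex₀₀≈ (⟦⟧-neg hex₁₀ one) ⟩
  dil 4 a ⊕ ⊖ H ∎
  where
  open ≈-Reasoning
  diagonalise : ℤ × ℤ ≅ ℤ × ℤ
  diagonalise = record
    { to = λ (x , s) → x + s , s ; from = λ (u , s) → u - s , s
    ; from-to = λ (x , s) → cong (_, s) (back x s) ; to-from = λ (u , s) → cong (_, s) (forth u s) }
    where
    back : ∀ x k → x + k - k ≡ x
    back = solve-∀
    forth : ∀ j k → j - k + k ≡ j
    forth = solve-∀
  signs : ∀ x s → sgn x ≡ sgn (x + s) * sgn s
  signs x s = sym (trans (cong (_* sgn s) (sgn-+ x s)) (trans (ℤP.*-assoc (sgn x) (sgn s) (sgn s))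
    (trans (cong (sgn x *_) (sgn² s)) (ℤP.*-identityʳ (sgn x)))))
  weight : ∀ x s → + (sq (x + s) ℕ.+ 3 ℕ.* sq s) ≡ + ∣ Q x (+ 2 * s) ∣
  weight x s = trans (cong₂ _+_ (+sq (x + s)) (trans (ℤP.pos-* 3 (sq s)) (cong (+ 3 *_) (+sq s))))
    (trans (identity x s) (sym (Q≥0 x (+ 2 * s))))
    where
    identity : ∀ x s → (x + s) * (x + s) + + 3 * (s * s) ≡ x * x + x * (+ 2 * s) + + 2 * s * (+ 2 * s)
    identity = solve-∀

-- Write a pair (u, v) of lattice points as u = (s + t)/2, v = (s - t)/2 with s ≡ t (mod 2);
-- then 2Q(u) + 2Q(v) = Q(s) + Q(t).
conic : dil 2 (a · a) ≈ dil 4 a · dil 4 a ⊕ κ (+ 3) · (H · H)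
conic = begin
  dil 2 (a · a) ≈⟨ dil-cong 2 (⟦⊗⟧ hexagonal hexagonal one one) ⟨
  dil 2 (⟦ hexagonal ⊗ hexagonal ⟧ one) ≈⟨ ⟦scale⟧ 2 (hexagonal ⊗ hexagonal) one ⟨
  ⟦ scale 2 (hexagonal ⊗ hexagonal) ⟧ one ≈⟨ ⟦⟧-bij congruent (scale 2 (hexagonal ⊗ hexagonal)) halfSums weight (λ _ → refl) ⟨
  ⟦ congruent ⟧ one ≈⟨ ≈-trans (⟦⊞⟧ (pairs hex₀₀) (pairs hex₀₁ ⊞ pairs hex₁₀ ⊞ pairs hex₁₁) one) (⊕-cong (square hex₀₀)
        (≈-trans (⟦⊞⟧ (pairs hex₀₁) (pairs hex₁₀ ⊞ pairs hex₁₁) one) (⊕-cong (square hex₀₁)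
        (≈-trans (⟦⊞⟧ (pairs hex₁₀) (pairs hex₁₁) one) (⊕-cong (square hex₁₀) (square hex₁₁)))))) ⟩
  ⟦ hex₀₀ ⟧ one · ⟦ hex₀₀ ⟧ one ⊕ (⟦ hex₀₁ ⟧ one · ⟦ hex₀₁ ⟧ one ⊕ (H · H ⊕ ⟦ hex₁₁ ⟧ one · ⟦ hex₁₁ ⟧ one))
        ≈⟨ ⊕-cong (·-cong hex₀₀≈ hex₀₀≈) (⊕-cong (·-cong hex₀₁≈H hex₀₁≈H) (⊕-cong ≈-refl (·-cong hex₁₁≈H hex₁₁≈H))) ⟩
  dil 4 a · dil 4 a ⊕ (H · H ⊕ (H · H ⊕ H · H)) ≈⟨ solve 2 (λ a h → a :* a :+ (h :* h :+ (h :* h :+ h :* h)) := a :* a :+ con (+ 3) :* (h :* h)) ≈-refl (dil 4 a) H ⟩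
  dil 4 a · dil 4 a ⊕ κ (+ 3) · (H · H) ∎
  where
  open ≈-Reasoning
  pairs : Weighted (ℤ × ℤ) → Weighted ((ℤ × ℤ) × (ℤ × ℤ))
  pairs w = w ⊗ w
  square : ∀ w → ⟦ pairs w ⟧ one ≈ ⟦ w ⟧ one · ⟦ w ⟧ one
  square w = ⟦⊗⟧ w w one one
  congruent = pairs hex₀₀ ⊞ pairs hex₀₁ ⊞ pairs hex₁₀ ⊞ pairs hex₁₁

  P : Set
  P = (ℤ × ℤ) × (ℤ × ℤ)

  -- One coordinate of the substitution: `inj₁` stands for s = 2i, t = 2k and `inj₂` for s = 2i + 1,
  -- t = 2k + 1; the result is ((s + t)/2, (s - t)/2). The two coordinates have independent
  -- parities, which gives the four classes of `congruent`.
  half-sum : (ℤ × ℤ) ⊎ (ℤ × ℤ) → ℤ × ℤ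
  half-sum (inj₁ (i , k)) = i + k , i - k
  half-sum (inj₂ (i , k)) = i + k + + 1 , i - k

  half-sum⁻¹ : ℤ × ℤ → (ℤ × ℤ) ⊎ (ℤ × ℤ)
  half-sum⁻¹ (u , v) = [ (λ i → inj₁ (i , u - i)) , (λ i → inj₂ (i , u - i - + 1)) ]′ (halve (u + v))

  left : ∀ p → half-sum⁻¹ (half-sum p) ≡ p
  left (inj₁ (i , k)) = trans
    (cong [ _ , _ ]′ (trans (cong halve (e₁ i k)) (halve-join (inj₁ i))))
    (cong (λ z → inj₁ (i , z)) (e₂ i k))
    where
    e₁ : ∀ i k → i + k + (i - k) ≡ + 2 * i
    e₁ = solve-∀
    e₂ : ∀ i k → i + k - i ≡ k
    e₂ = solve-∀
  left (inj₂ (i , k)) = trans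
    (cong [ _ , _ ]′ (trans (cong halve (e₁ i k)) (halve-join (inj₂ i))))
    (cong (λ z → inj₂ (i , z)) (e₂ i k))
    where
    e₁ : ∀ i k → i + k + + 1 + (i - k) ≡ + 2 * i + + 1
    e₁ = solve-∀
    e₂ : ∀ i k → i + k + + 1 - i - + 1 ≡ k
    e₂ = solve-∀

  right : ∀ p → half-sum (half-sum⁻¹ p) ≡ p
  right (u , v) with halve (u + v) | join-halve (u + v)
  ... | inj₁ i | eq = cong₂ _,_ (e₁ i u) (trans (e₂ i u) (trans (cong (_- u) eq) (e₃ u v)))
    where
    e₁ : ∀ i u → i + (u - i) ≡ u
    e₁ = solve-∀
    e₂ : ∀ i u → i - (u - i) ≡ + 2 * i - u
    e₂ = solve-∀
    e₃ : ∀ u v → u + v - u ≡ v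
    e₃ = solve-∀
  ... | inj₂ i | eq = cong₂ _,_ (e₁ i u) (trans (e₂ i u) (trans (cong (_- u) eq) (e₃ u v)))
    where
    e₁ : ∀ i u → i + (u - i - + 1) + + 1 ≡ u
    e₁ = solve-∀
    e₂ : ∀ i u → i - (u - i - + 1) ≡ + 2 * i + + 1 - u
    e₂ = solve-∀
    e₃ : ∀ u v → u + v - u ≡ v
    e₃ = solve-∀

  unpair : P → (ℤ × ℤ) × (ℤ × ℤ)
  unpair ((u₁ , u₂) , (v₁ , v₂)) = (u₁ , v₁) , (u₂ , v₂)

  classify : (ℤ × ℤ) ⊎ (ℤ × ℤ) → (ℤ × ℤ) ⊎ (ℤ × ℤ) → P ⊎ P ⊎ P ⊎ P
  classify (inj₁ p) (inj₁ q) = inj₁ (unpair (p , q))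
  classify (inj₁ p) (inj₂ q) = inj₂ (inj₁ (unpair (p , q)))
  classify (inj₂ p) (inj₁ q) = inj₂ (inj₂ (inj₁ (unpair (p , q))))
  classify (inj₂ p) (inj₂ q) = inj₂ (inj₂ (inj₂ (unpair (p , q))))

  declassify : P ⊎ P ⊎ P ⊎ P → ((ℤ × ℤ) ⊎ (ℤ × ℤ)) × ((ℤ × ℤ) ⊎ (ℤ × ℤ))
  declassify (inj₁ ((p₁ , q₁) , (p₂ , q₂)))               = inj₁ (p₁ , p₂) , inj₁ (q₁ , q₂)
  declassify (inj₂ (inj₁ ((p₁ , q₁) , (p₂ , q₂))))        = inj₁ (p₁ , p₂) , inj₂ (q₁ , q₂)
  declassify (inj₂ (inj₂ (inj₁ ((p₁ , q₁) , (p₂ , q₂))))) = inj₂ (p₁ , p₂) , inj₁ (q₁ , q₂)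
  declassify (inj₂ (inj₂ (inj₂ ((p₁ , q₁) , (p₂ , q₂))))) = inj₂ (p₁ , p₂) , inj₂ (q₁ , q₂)

  classify-declassify : ∀ c → classify (proj₁ (declassify c)) (proj₂ (declassify c)) ≡ c
  classify-declassify (inj₁ _)               = refl
  classify-declassify (inj₂ (inj₁ _))        = refl
  classify-declassify (inj₂ (inj₂ (inj₁ _))) = refl
  classify-declassify (inj₂ (inj₂ (inj₂ _))) = refl

  declassify-classify : ∀ p q → declassify (classify p q) ≡ (p , q)
  declassify-classify (inj₁ _) (inj₁ _) = refl
  declassify-classify (inj₁ _) (inj₂ _) = refl
  declassify-classify (inj₂ _) (inj₁ _) = refl
  declassify-classify (inj₂ _) (inj₂ _) = refl

  halfSums : P ⊎ P ⊎ P ⊎ P ≅ P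
  halfSums = record
    { to = λ c → unpair (half-sum (proj₁ (declassify c)) , half-sum (proj₂ (declassify c)))
    ; from = λ p → classify (half-sum⁻¹ (proj₁ (unpair p))) (half-sum⁻¹ (proj₂ (unpair p)))
    ; from-to = λ c → trans (cong₂ classify (left (proj₁ (declassify c))) (left (proj₂ (declassify c)))) (classify-declassify c)
    ; to-from = λ p → trans
        (cong (λ d → unpair (half-sum (proj₁ d) , half-sum (proj₂ d)))
          (declassify-classify (half-sum⁻¹ (proj₁ (unpair p))) (half-sum⁻¹ (proj₂ (unpair p)))))
        (cong₂ (λ x y → unpair (x , y)) (right (proj₁ (unpair p))) (right (proj₂ (unpair p)))) }

  parallelogram : ∀ u₁ u₂ v₁ v₂ {s₁ s₂ t₁ t₂} → s₁ ≡ u₁ + v₁ → t₁ ≡ u₁ - v₁ → s₂ ≡ u₂ + v₂ → t₂ ≡ u₂ - v₂ →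
    2 ℕ.* (∣ Q u₁ u₂ ∣ ℕ.+ ∣ Q v₁ v₂ ∣) ≡ ∣ Q s₁ s₂ ∣ ℕ.+ ∣ Q t₁ t₂ ∣
  parallelogram u₁ u₂ v₁ v₂ refl refl refl refl = ℤP.+-injective (trans (ℤP.pos-* 2 (∣ Q u₁ u₂ ∣ ℕ.+ ∣ Q v₁ v₂ ∣))
    (trans (cong (+ 2 *_) (cong₂ _+_ (Q≥0 u₁ u₂) (Q≥0 v₁ v₂)))
    (trans (lemma u₁ u₂ v₁ v₂) (sym (cong₂ _+_ (Q≥0 (u₁ + v₁) (u₂ + v₂)) (Q≥0 (u₁ - v₁) (u₂ - v₂)))))))
    where
    lemma : ∀ u₁ u₂ v₁ v₂ → + 2 * (u₁ * u₁ + u₁ * u₂ + u₂ * u₂ + (v₁ * v₁ + v₁ * v₂ + v₂ * v₂)) ≡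
      (u₁ + v₁) * (u₁ + v₁) + (u₁ + v₁) * (u₂ + v₂) + (u₂ + v₂) * (u₂ + v₂) +
      ((u₁ - v₁) * (u₁ - v₁) + (u₁ - v₁) * (u₂ - v₂) + (u₂ - v₂) * (u₂ - v₂))
    lemma = solve-∀

  s₀ : ∀ i k → + 2 * i ≡ i + k + (i - k)
  s₀ = solve-∀
  t₀ : ∀ i k → + 2 * k ≡ i + k - (i - k)
  t₀ = solve-∀
  s₁ : ∀ i k → + 2 * i + + 1 ≡ i + k + + 1 + (i - k)
  s₁ = solve-∀
  t₁ : ∀ i k → + 2 * k + + 1 ≡ i + k + + 1 - (i - k)
  t₁ = solve-∀

  weight : ∀ c → wt (scale 2 (hexagonal ⊗ hexagonal)) (_≅_.to halfSums c) ≡ wt congruent c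
  weight (inj₁ ((i₁ , i₂) , (k₁ , k₂)))               =
    parallelogram (i₁ + k₁) (i₂ + k₂) (i₁ - k₁) (i₂ - k₂) (s₀ i₁ k₁) (t₀ i₁ k₁) (s₀ i₂ k₂) (t₀ i₂ k₂)
  weight (inj₂ (inj₁ ((i₁ , i₂) , (k₁ , k₂))))        =
    parallelogram (i₁ + k₁) (i₂ + k₂ + + 1) (i₁ - k₁) (i₂ - k₂) (s₀ i₁ k₁) (t₀ i₁ k₁) (s₁ i₂ k₂) (t₁ i₂ k₂)
  weight (inj₂ (inj₂ (inj₁ ((i₁ , i₂) , (k₁ , k₂))))) =
    parallelogram (i₁ + k₁ + + 1) (i₂ + k₂) (i₁ - k₁) (i₂ - k₂) (s₁ i₁ k₁) (t₁ i₁ k₁) (s₀ i₂ k₂) (t₀ i₂ k₂)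
  weight (inj₂ (inj₂ (inj₂ ((i₁ , i₂) , (k₁ , k₂))))) =
    parallelogram (i₁ + k₁ + + 1) (i₂ + k₂ + + 1) (i₁ - k₁) (i₂ - k₂) (s₁ i₁ k₁) (t₁ i₁ k₁) (s₁ i₂ k₂) (t₁ i₂ k₂)

-- Lambert series

divisorPairs : Weighted (ℕ × ℕ)
divisorPairs = record
  { _≟_   = ×P.≡-dec ℕ._≟_ ℕ._≟_
  ; wt    = λ (d , e) → suc d ℕ.* suc e
  ; box   = λ n → cartesianProduct (upTo n) (upTo n)
  ; ∈-box = λ (d , e) le → ∈-cartesianProduct⁺
      (∈-upTo⁺ (ℕP.≤-trans (ℕP.m≤m*n (suc d) (suc e)) le)) (∈-upTo⁺ (ℕP.≤-trans (ℕP.m≤n*m (suc e) (suc d)) le)) }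

-- Σ_{d, e ≥ 1} f d e q^{de}
Λ : (ℕ → ℕ → ℤ) → Series
Λ f = ⟦ divisorPairs ⟧ (λ (d , e) → f (suc d) (suc e))

Λ-cong : ∀ f g → (∀ d e → f (suc d) (suc e) ≡ g (suc d) (suc e)) → Λ f ≈ Λ g
Λ-cong f g eq = ⟦⟧-cong divisorPairs (λ (d , e) → eq d e)

Λ-+ : ∀ f g → Λ (λ d e → f d e + g d e) ≈ Λ f ⊕ Λ g
Λ-+ f g = ⟦⟧-+ divisorPairs _ _

⟦⟧-* : {I : Set} (w : Weighted I) (c : ℤ) (f : I → ℤ) → ⟦ w ⟧ (λ i → c * f i) ≈ κ c · ⟦ w ⟧ f
⟦⟧-* w c f = ext λ n → trans (sumL-*ˡ c f (fibre w n)) (sym (κ-· c (⟦ w ⟧ f) n))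

Λ-* : ∀ c f → Λ (λ d e → c * f d e) ≈ κ c · Λ f
Λ-* c f = ⟦⟧-* divisorPairs c _

Λ-swap : ∀ f → Λ f ≈ Λ (λ d e → f e d)
Λ-swap f = ⟦⟧-bij divisorPairs divisorPairs
  (record { to = swap ; from = swap ; from-to = λ _ → refl ; to-from = λ _ → refl })
  (λ (d , e) → ℕP.*-comm (suc e) (suc d)) (λ _ → refl)

sumL-filter : {I : Set} {P : I → Set} (P? : ∀ i → Dec (P i)) (f : I → ℤ) → (∀ i → ¬ P i → f i ≡ + 0) →
  ∀ xs → sumL f (filter P? xs) ≡ sumL f xs
sumL-filter P? f zero-off []       = refl
sumL-filter P? f zero-off (x ∷ xs) with P? x
... | yes _  = +-congʳ (f x) (sumL-filter P? f zero-off xs)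
... | no ¬Px = trans (sumL-filter P? f zero-off xs) (sym (trans (cong (_+ sumL f xs) (zero-off x ¬Px)) (ℤP.+-identityˡ _)))

⟦⟧-restrict : {I J : Set} (w : Weighted I) (v : Weighted J) (g : J → I) → (∀ {j k} → g j ≡ g k → j ≡ k) →
  (∀ j → wt w (g j) ≡ wt v j) → (∀ i → Dec (Σ J λ j → g j ≡ i)) →
  (f : I → ℤ) → (∀ i → ¬ (Σ J λ j → g j ≡ i) → f i ≡ + 0) → ⟦ w ⟧ f ≈ ⟦ v ⟧ (f ∘ g)
⟦⟧-restrict w v g g-inj wt-eq image? f zero-off = ext λ n → begin
  sumL f (fibre w n) ≡⟨ sumL-filter image? f zero-off (fibre w n) ⟨
  sumL f (filter image? (fibre w n)) ≡⟨ sumL-set f (Uniq.filter⁺ image? (fibre-unique w n)) (Uniq.map⁺ g-inj (fibre-unique v n)) to from ⟩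
  sumL f (map g (fibre v n)) ≡⟨ sumL-map f g (fibre v n) ⟩
  sumL (f ∘ g) (fibre v n) ∎
  where
  open ≡-Reasoning
  to : ∀ {n i} → i ∈ filter image? (fibre w n) → i ∈ map g (fibre v n)
  to {n} p with ∈-filter⁻ image? {xs = fibre w n} p
  ... | i∈ , j , refl = ∈-map⁺ g (∈-fibre⁺ v j (trans (sym (wt-eq j)) (∈-fibre⁻ w i∈)))
  from : ∀ {n i} → i ∈ map g (fibre v n) → i ∈ filter image? (fibre w n)
  from {n} p with ∈-map⁻ g p
  ... | j , j∈ , refl = ∈-filter⁺ image? (∈-fibre⁺ w (g j) (trans (wt-eq j) (∈-fibre⁻ v j∈))) (j , refl)

Λ-multiples : ∀ k .{{_ : NonZero k}} (f : ℕ → ℕ → ℤ) → (∀ d e → ¬ (k ∣ d) → f d e ≡ + 0) →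
  Λ f ≈ dil k (Λ (λ d e → f (k ℕ.* d) e))
Λ-multiples (suc k) f zero-off = ≈-trans
  (⟦⟧-restrict divisorPairs (scale (suc k) divisorPairs) multiple multiple-injective
    (λ (d , e) → ℕP.*-assoc (suc k) (suc d) (suc e)) image? _ λ (d , e) ∄ → zero-off (suc d) (suc e) λ { (divides q eq) → ∄ (preimage e q eq) })
  (⟦scale⟧ (suc k) divisorPairs _)
  where
  multiple : ℕ × ℕ → ℕ × ℕ
  -- Entries are stored shifted by one: `suc (d + k * suc d)` is `suc k * suc d`.
  multiple (d , e) = d ℕ.+ k ℕ.* suc d , e
  preimage : ∀ {d} e q → suc d ≡ q ℕ.* suc k → Σ (ℕ × ℕ) λ j → multiple j ≡ (d , e)
  preimage e (suc q) eq = (q , e) , cong (_, e) (ℕP.suc-injective (trans (ℕP.*-comm (suc k) (suc q)) (sym eq)))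
  multiple-injective : ∀ {i j} → multiple i ≡ multiple j → i ≡ j
  multiple-injective {d , e} {d′ , e′} eq = cong₂ _,_
    (ℕP.suc-injective (ℕP.*-cancelˡ-≡ (suc d) (suc d′) (suc k) (cong suc (cong proj₁ eq)))) (cong proj₂ eq)
  image? : ∀ i → Dec (Σ (ℕ × ℕ) λ j → multiple j ≡ i)
  image? (d , e) with suc k ∣? suc d
  ... | yes (divides q eq) = yes (preimage e q eq)
  ... | no ∤               = no λ { ((q , e) , refl) → ∤ (divides (suc q) (ℕP.*-comm (suc k) (suc q))) }

-- Parities and functions of period three

ι : Bool → ℤ
ι true  = + 1
ι false = + 0

par : ℕ → Bool
par 0             = false
par 1             = true
par (suc (suc n)) = par n

odd even : ℕ → ℤ
odd n  = ι (par n)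
even n = ι (not (par n))

-- `F` is the indicator of the multiples of 3 and `χ` the nontrivial character modulo 3. The
-- recursion makes the period definitional, so identities between them are checked on residues.
F χ : ℕ → ℤ
F 0                   = + 1
F 1                   = + 0
F 2                   = + 0
F (suc (suc (suc n))) = F n
χ 0                   = + 0
χ 1                   = + 1
χ 2                   = - + 1
χ (suc (suc (suc n))) = χ n

par-suc : ∀ n → par (suc n) ≡ not (par n)
par-suc 0             = refl
par-suc 1             = refl
par-suc (suc (suc n)) = par-suc n

par-+ : ∀ m n → par (m ℕ.+ n) ≡ par m xor par n
par-+ 0             n = refl
par-+ 1             n = par-suc n
par-+ (suc (suc m)) n = par-+ m n

+3 : ∀ m n → m ℕ.+ (3 ℕ.+ n) ≡ 3 ℕ.+ (m ℕ.+ n)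
+3 m n = trans (sym (ℕP.+-assoc m 3 n)) (trans (cong (ℕ._+ n) (ℕP.+-comm m 3)) (ℕP.+-assoc 3 m n))

-- K m n = F ∣ m - n ∣
K : ℕ → ℕ → ℤ
K m n = χ m * χ n + F (m ℕ.+ n)

K-comm : ∀ m n → K m n ≡ K n m
K-comm m n = cong₂ _+_ (ℤP.*-comm (χ m) (χ n)) (cong F (ℕP.+-comm m n))

K-+3 : ∀ m n → K m (3 ℕ.+ n) ≡ K m n
K-+3 m n = +-congʳ (χ m * χ n) (cong F (+3 m n))

-- Both arguments matter only modulo 3, which leaves nine cases. The resulting F(a - b) = χ(a) χ(b)
-- + F(a + b) writes χ(a) χ(b) as a difference of values of one even function at a - b and a + b,
-- the shape that Liouville's method requires.
K-shift : ∀ m n → K (m ℕ.+ n) n ≡ F m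
K-shift (suc (suc (suc m))) n = K-shift m n
K-shift m (suc (suc (suc n))) = trans (K-+3 (m ℕ.+ (3 ℕ.+ n)) n) (trans (cong (λ k → K k n) (+3 m n)) (K-shift m n))
K-shift 0 0 = refl
K-shift 0 1 = refl
K-shift 0 2 = refl
K-shift 1 0 = refl
K-shift 1 1 = refl
K-shift 1 2 = refl
K-shift 2 0 = refl
K-shift 2 1 = refl
K-shift 2 2 = refl

-- Liouville's method

≅-injective : {I J : Set} (to : I → J) (from : J → I) → (∀ {i k} → to i ≡ to k → i ≡ k) → (∀ j → to (from j) ≡ j) → I ≅ J
≅-injective to from inj to-from = record { to = to ; from = from ; from-to = λ i → inj (to-from (to i)) ; to-from = to-from }

Quad : Set
Quad = (ℕ × ℕ) × (ℕ × ℕ)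

-- The positive integers in ((a , x) , (b , y)) are stored shifted by one; the weight is a x + b y.
quads : Weighted Quad
quads = divisorPairs ⊗ divisorPairs

-- The same with weight (a + b) x + b y.
sheared : Weighted Quad
sheared = pull (Weighted._≟_ quads) (λ ((a , x) , (b , y)) → (a ℕ.+ suc b , x) , (b , y)) (λ ((a , x) , (b , y)) → (a ℕ.∸ suc b , x) , (b , y))
  (λ ((a , x) , (b , y)) → cong (λ z → (z , x) , (b , y)) (ℕP.m+n∸n≡m a (suc b))) quads

-- (a , x , y) with weight a x + a y.
diagonal : Weighted (ℕ × ℕ × ℕ)
diagonal = pull (×P.≡-dec ℕ._≟_ (×P.≡-dec ℕ._≟_ ℕ._≟_)) (λ (a , x , y) → (a , x) , (a , y)) (λ ((a , x) , (b , y)) → a , x , y) (λ _ → refl) quads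

Fun⁴ : Set
Fun⁴ = ℕ → ℕ → ℕ → ℕ → ℤ

⟪_⟫ S[_] : Fun⁴ → Series
⟪ h ⟫  = ⟦ quads ⟧ (λ ((a , x) , (b , y)) → h (suc a) (suc b) (suc x) (suc y))
S[ h ] = ⟦ sheared ⟧ (λ ((a , x) , (b , y)) → h (suc a) (suc b) (suc x) (suc y))

D[_] : (ℕ → ℕ → ℕ → ℤ) → Series
D[ h ] = ⟦ diagonal ⟧ (λ (a , x , y) → h (suc a) (suc x) (suc y))

-- If a ≠ b, the smaller is subtracted from the larger. The two cases differ only by exchanging (a,
-- x) with (b, y), so both land on the same sheared class.
split-ab : ∀ (h : Fun⁴) → ⟪ h ⟫ ≈ D[ (λ a x y → h a a x y) ] ⊕ (S[ (λ a b x y → h (a ℕ.+ b) b x y) ] ⊕ S[ (λ a b x y → h b (a ℕ.+ b) y x) ])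
split-ab h = ≈-trans
  (≈-sym (⟦⟧-bij (diagonal ⊞ sheared ⊞ sheared) quads (≅-injective to from injective to-from) weight (λ _ → refl)))
  (≈-trans (⟦⊞⟧ diagonal (sheared ⊞ sheared) _) (⊕-cong ≈-refl (⟦⊞⟧ sheared sheared _)))
  where
  to : (ℕ × ℕ × ℕ) ⊎ Quad ⊎ Quad → Quad
  to (inj₁ (a , x , y))                 = (a , x) , (a , y)
  to (inj₂ (inj₁ ((a , x) , (b , y))))  = (a ℕ.+ suc b , x) , (b , y)
  to (inj₂ (inj₂ ((a , x) , (b , y))))  = (b , y) , (a ℕ.+ suc b , x)
  from : Quad → (ℕ × ℕ × ℕ) ⊎ Quad ⊎ Quad
  from ((a , x) , (b , y)) with ℕ.compare a b
  ... | ℕ.less    a k = inj₂ (inj₂ ((k , y) , (a , x)))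
  ... | ℕ.equal   a   = inj₁ (a , x , y)
  ... | ℕ.greater b k = inj₂ (inj₁ ((k , x) , (b , y)))
  suc-comm : ∀ b k → k ℕ.+ suc b ≡ suc (b ℕ.+ k)
  suc-comm b k = ℕP.+-comm k (suc b)
  to-from : ∀ q → to (from q) ≡ q
  to-from ((a , x) , (b , y)) with ℕ.compare a b
  ... | ℕ.less    a k = cong (λ z → (a , x) , (z , y)) (suc-comm a k)
  ... | ℕ.equal   a   = refl
  ... | ℕ.greater b k = cong (λ z → (z , x) , (b , y)) (suc-comm b k)
  absurd : ∀ {A : Set} k b → k ℕ.+ suc b ≡ b → A
  absurd k b eq = ⊥-elim (ℕP.m+1+n≢n k eq)
  cross : ∀ {A : Set} {a b a′ b′} → a ℕ.+ suc b ≡ b′ → b ≡ a′ ℕ.+ suc b′ → A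
  cross {a = a} {b} {a′} {b′} e₁ e₂ = ⊥-elim (ℕP.<-asym b<b′ b′<b)
    where
    b<b′ : b < b′
    b<b′ = subst (b <_) e₁ (ℕP.m≤n+m (suc b) a)
    b′<b : b′ < b
    b′<b = subst (b′ <_) (sym e₂) (ℕP.m≤n+m (suc b′) a′)
  injective : ∀ {i j} → to i ≡ to j → i ≡ j
  injective {inj₁ _} {inj₁ _} refl = refl
  injective {inj₁ (a , _)} {inj₂ (inj₁ ((a′ , _) , (b′ , _)))} eq =
    absurd a′ b′ (trans (sym (cong (proj₁ ∘ proj₁) eq)) (cong (proj₁ ∘ proj₂) eq))
  injective {inj₁ (a , _)} {inj₂ (inj₂ ((a′ , _) , (b′ , _)))} eq =
    absurd a′ b′ (trans (sym (cong (proj₁ ∘ proj₂) eq)) (cong (proj₁ ∘ proj₁) eq))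
  injective {inj₂ (inj₁ ((a′ , _) , (b′ , _)))} {inj₁ (a , _)} eq =
    absurd a′ b′ (trans (cong (proj₁ ∘ proj₁) eq) (sym (cong (proj₁ ∘ proj₂) eq)))
  injective {inj₂ (inj₂ ((a′ , _) , (b′ , _)))} {inj₁ (a , _)} eq =
    absurd a′ b′ (trans (cong (proj₁ ∘ proj₂) eq) (sym (cong (proj₁ ∘ proj₁) eq)))
  injective {inj₂ (inj₁ ((a , x) , (b , y)))} {inj₂ (inj₁ ((a′ , x′) , (b′ , y′)))} eq with cong proj₂ eq
  ... | refl with cong (proj₂ ∘ proj₁) eq
  ...   | refl = cong (λ z → inj₂ (inj₁ ((z , x) , (b , y)))) (ℕP.+-cancelʳ-≡ (suc b) a a′ (cong (proj₁ ∘ proj₁) eq))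
  injective {inj₂ (inj₂ ((a , x) , (b , y)))} {inj₂ (inj₂ ((a′ , x′) , (b′ , y′)))} eq with cong proj₁ eq
  ... | refl with cong (proj₂ ∘ proj₂) eq
  ...   | refl = cong (λ z → inj₂ (inj₂ ((z , x) , (b , y)))) (ℕP.+-cancelʳ-≡ (suc b) a a′ (cong (proj₁ ∘ proj₂) eq))
  injective {inj₂ (inj₁ ((a , x) , (b , y)))} {inj₂ (inj₂ ((a′ , x′) , (b′ , y′)))} eq =
    cross {a = a} {b} {a′} {b′} (cong (proj₁ ∘ proj₁) eq) (cong (proj₁ ∘ proj₂) eq)
  injective {inj₂ (inj₂ ((a , x) , (b , y)))} {inj₂ (inj₁ ((a′ , x′) , (b′ , y′)))} eq =
    cross {a = a} {b} {a′} {b′} (cong (proj₁ ∘ proj₂) eq) (cong (proj₁ ∘ proj₁) eq)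
  weight : ∀ i → wt quads (to i) ≡ wt (diagonal ⊞ sheared ⊞ sheared) i
  weight (inj₁ _)                              = refl
  weight (inj₂ (inj₁ _))                       = refl
  weight (inj₂ (inj₂ ((a , x) , (b , y))))     = ℕP.+-comm (suc b ℕ.* suc y) (suc (a ℕ.+ suc b) ℕ.* suc x)

-- The order of the two pairs is reversed as well. Exchanging only a with x and b with y would
-- preserve a x + b y, but not (a + b) x + b y; this involution preserves both.
transpose : Quad ≅ Quad
transpose = record { to = t ; from = t ; from-to = λ _ → refl ; to-from = λ _ → refl }
  where
  t : Quad → Quad
  t ((a , x) , (b , y)) = (y , b) , (x , a)

⟪⟫-transpose : ∀ h → ⟪ h ⟫ ≈ ⟪ (λ a b x y → h y x b a) ⟫
⟪⟫-transpose h = ⟦⟧-bij quads quads transpose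
  (λ ((a , x) , (b , y)) → trans (ℕP.+-comm (suc y ℕ.* suc b) _) (cong₂ ℕ._+_ (ℕP.*-comm (suc x) (suc a)) (ℕP.*-comm (suc y) (suc b)))) (λ _ → refl)

S-transpose : ∀ h → S[ h ] ≈ S[ (λ a b x y → h y x b a) ]
S-transpose h = ⟦⟧-bij sheared sheared transpose (λ ((a , x) , (b , y)) → lemma (suc a) (suc b) (suc x) (suc y)) (λ _ → refl)
  where
  lemma : ∀ a b x y → (y ℕ.+ x) ℕ.* b ℕ.+ x ℕ.* a ≡ (a ℕ.+ b) ℕ.* x ℕ.+ b ℕ.* y
  lemma = solveℕ-∀

D-swap : ∀ h → D[ h ] ≈ D[ (λ a x y → h a y x) ]
D-swap h = ⟦⟧-bij diagonal diagonal (record { to = s ; from = s ; from-to = λ _ → refl ; to-from = λ _ → refl })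
  (λ (a , x , y) → ℕP.+-comm (suc a ℕ.* suc y) (suc a ℕ.* suc x)) (λ _ → refl)
  where
  s : ℕ × ℕ × ℕ → ℕ × ℕ × ℕ
  s (a , x , y) = a , y , x

-- `transpose` turns the comparison of x with y into that of a with b and maps the sheared class to
-- itself.
split-xy : ∀ (h : Fun⁴) → ⟪ h ⟫ ≈ D[ (λ a x y → h x y a a) ] ⊕ (S[ (λ a b x y → h a b x (y ℕ.+ x)) ] ⊕ S[ (λ a b x y → h b a (y ℕ.+ x) x) ])
split-xy h = begin
  ⟪ h ⟫ ≈⟨ ⟪⟫-transpose h ⟩
  ⟪ (λ a b x y → h y x b a) ⟫ ≈⟨ split-ab (λ a b x y → h y x b a) ⟩
  D[ (λ a x y → h y x a a) ] ⊕ (S[ (λ a b x y → h y x b (a ℕ.+ b)) ] ⊕ S[ (λ a b x y → h x y (a ℕ.+ b) b) ])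
        ≈⟨ ⊕-cong (D-swap (λ a x y → h y x a a)) (⊕-cong (S-transpose (λ a b x y → h y x b (a ℕ.+ b))) (S-transpose (λ a b x y → h x y (a ℕ.+ b) b))) ⟩
  D[ (λ a x y → h x y a a) ] ⊕ (S[ (λ a b x y → h a b x (y ℕ.+ x)) ] ⊕ S[ (λ a b x y → h b a (y ℕ.+ x) x) ]) ∎
  where open ≈-Reasoning

S-cong : ∀ {h k : Fun⁴} → (∀ a b x y → h (suc a) (suc b) (suc x) (suc y) ≡ k (suc a) (suc b) (suc x) (suc y)) → S[ h ] ≈ S[ k ]
S-cong eq = ⟦⟧-cong sheared (λ ((a , x) , (b , y)) → eq a b x y)

D-cong : ∀ {h k : ℕ → ℕ → ℕ → ℤ} → (∀ a x y → h (suc a) (suc x) (suc y) ≡ k (suc a) (suc x) (suc y)) → D[ h ] ≈ D[ k ]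
D-cong eq = ⟦⟧-cong diagonal (λ (a , x , y) → eq a x y)

-- Splitting according to a ⋚ b or x ⋚ y maps the off-diagonal quadruples onto the same class `sheared`, so that
-- only diagonal terms survive in the difference. The functions g and G restrict the parities of (a, b, x, y).
module Liouville
  (g G : Bool → Bool → Bool → Bool → ℤ)
  (h₁ : ∀ a b x y → G (a xor b) b x y ≡ g a b x (y xor x) + g b a (y xor x) x)
  (h₂ : ∀ a b x y → G a b x (y xor x) ≡ g (a xor b) b x y + g b (a xor b) y x)
  (h₃ : ∀ a b x y → G b (a xor b) y x ≡ G b a (y xor x) x)
  where

  gᵖ Gᵖ : Fun⁴
  gᵖ a b x y = g (par a) (par b) (par x) (par y)
  Gᵖ a b x y = G (par a) (par b) (par x) (par y)

  h₁ᵖ : ∀ a b x y → gᵖ a b x (y ℕ.+ x) + gᵖ b a (y ℕ.+ x) x ≡ Gᵖ (a ℕ.+ b) b x y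
  h₁ᵖ a b x y rewrite par-+ a b | par-+ y x = sym (h₁ (par a) (par b) (par x) (par y))

  h₂ᵖ : ∀ a b x y → gᵖ (a ℕ.+ b) b x y + gᵖ b (a ℕ.+ b) y x ≡ Gᵖ a b x (y ℕ.+ x)
  h₂ᵖ a b x y rewrite par-+ a b | par-+ y x = sym (h₂ (par a) (par b) (par x) (par y))

  h₃ᵖ : ∀ a b x y → Gᵖ b (a ℕ.+ b) y x ≡ Gᵖ b a (y ℕ.+ x) x
  h₃ᵖ a b x y rewrite par-+ a b | par-+ y x = h₃ (par a) (par b) (par x) (par y)

  merge : ∀ (h k l : Fun⁴) → (∀ a b x y → h (suc a) (suc b) (suc x) (suc y) + k (suc a) (suc b) (suc x) (suc y) ≡ l (suc a) (suc b) (suc x) (suc y)) →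
    S[ h ] ⊕ S[ k ] ≈ S[ l ]
  merge h k l eq = ≈-trans (≈-sym (⟦⟧-+ sheared _ _)) (⟦⟧-cong sheared (λ ((a , x) , (b , y)) → eq a b x y))

  -- X + B carries the kernel F(a - b) and is split by a ⋚ b, leaving `w₄`; B carries F(a + b) and
  -- is split by x ⋚ y, leaving `w₃`. Hypotheses `h₂` and `h₁` express these remainders through the
  -- single function G. They are not equal termwise, and their difference comes from the sum of G ·
  -- F(a).
  liouville : ⟪ (λ a b x y → gᵖ a b x y * (χ a * χ b)) ⟫ ≈
    D[ (λ a x y → gᵖ a a x y) ] ⊕ ⊖ D[ (λ a x y → gᵖ x y a a * F (x ℕ.+ y)) ]
    ⊕ D[ (λ a x y → Gᵖ a a x y * F a) ] ⊕ ⊖ D[ (λ a x y → Gᵖ x y a a * F x) ]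
  liouville = begin
    X ≈⟨ solve 2 (λ X B → X := (X :+ B) :+ :- B) ≈-refl X B ⟩
    (X ⊕ B) ⊕ ⊖ B ≈⟨ ⊕-cong step₁ (⊖-cong step₂) ⟩
    (D₁ ⊕ w₄) ⊕ ⊖ (D₂ ⊕ w₃) ≈⟨ solve 6 (λ D₁ D₂ D₄ w₃ w₄ w₅ → (D₁ :+ w₄) :+ :- (D₂ :+ w₃) :=
        (D₁ :+ :- D₂ :+ :- D₄) :+ (D₄ :+ (w₄ :+ w₅)) :+ :- (w₃ :+ w₅)) ≈-refl D₁ D₂ D₄ w₃ w₄ w₅ ⟩
    (D₁ ⊕ ⊖ D₂ ⊕ ⊖ D₄) ⊕ (D₄ ⊕ (w₄ ⊕ w₅)) ⊕ ⊖ (w₃ ⊕ w₅) ≈⟨ ⊕-cong (⊕-cong ≈-refl (≈-trans (≈-sym step₄) step₃)) ≈-refl ⟩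
    (D₁ ⊕ ⊖ D₂ ⊕ ⊖ D₄) ⊕ (D₃ ⊕ (w₃ ⊕ w₅)) ⊕ ⊖ (w₃ ⊕ w₅) ≈⟨ solve 6 (λ D₁ D₂ D₃ D₄ w₃ w₅ → (D₁ :+ :- D₂ :+ :- D₄) :+ (D₃ :+ (w₃ :+ w₅)) :+ :- (w₃ :+ w₅) :=
        D₁ :+ :- D₂ :+ D₃ :+ :- D₄) ≈-refl D₁ D₂ D₃ D₄ w₃ w₅ ⟩
    D₁ ⊕ ⊖ D₂ ⊕ D₃ ⊕ ⊖ D₄ ∎
    where
    open ≈-Reasoning
    X = ⟪ (λ a b x y → gᵖ a b x y * (χ a * χ b)) ⟫
    B = ⟪ (λ a b x y → gᵖ a b x y * F (a ℕ.+ b)) ⟫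
    D₁ = D[ (λ a x y → gᵖ a a x y) ]
    D₂ = D[ (λ a x y → gᵖ x y a a * F (x ℕ.+ y)) ]
    D₃ = D[ (λ a x y → Gᵖ a a x y * F a) ]
    D₄ = D[ (λ a x y → Gᵖ x y a a * F x) ]
    w₃ = S[ (λ a b x y → Gᵖ (a ℕ.+ b) b x y * F (a ℕ.+ b)) ]
    w₄ = S[ (λ a b x y → Gᵖ a b x (y ℕ.+ x) * F a) ]
    w₅ = S[ (λ a b x y → Gᵖ b (a ℕ.+ b) y x * F b) ]
    step₁ : X ⊕ B ≈ D₁ ⊕ w₄
    step₁ = begin
      X ⊕ B ≈⟨ ⟦⟧-+ quads _ _ ⟨
      ⟪ (λ a b x y → gᵖ a b x y * (χ a * χ b) + gᵖ a b x y * F (a ℕ.+ b)) ⟫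
        ≈⟨ ⟦⟧-cong quads (λ ((a , x) , (b , y)) → sym (ℤP.*-distribˡ-+ (gᵖ (suc a) (suc b) (suc x) (suc y)) _ _)) ⟩
      ⟪ (λ a b x y → gᵖ a b x y * K a b) ⟫ ≈⟨ split-ab (λ a b x y → gᵖ a b x y * K a b) ⟩
      D[ (λ a x y → gᵖ a a x y * K a a) ] ⊕ (S[ (λ a b x y → gᵖ (a ℕ.+ b) b x y * K (a ℕ.+ b) b) ] ⊕ S[ (λ a b x y → gᵖ b (a ℕ.+ b) y x * K b (a ℕ.+ b)) ])
        ≈⟨ ⊕-cong (D-cong {λ a x y → gᵖ a a x y * K a a} {λ a x y → gᵖ a a x y} (λ a x y → trans (cong (gᵖ (suc a) (suc a) (suc x) (suc y) *_) (K-shift 0 (suc a))) (ℤP.*-identityʳ _)))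
                  (merge (λ a b x y → gᵖ (a ℕ.+ b) b x y * K (a ℕ.+ b) b) (λ a b x y → gᵖ b (a ℕ.+ b) y x * K b (a ℕ.+ b)) (λ a b x y → Gᵖ a b x (y ℕ.+ x) * F a) (λ a b x y → lemma (suc a) (suc b) (suc x) (suc y))) ⟩
      D₁ ⊕ w₄ ∎
      where
      lemma : ∀ a b x y → gᵖ (a ℕ.+ b) b x y * K (a ℕ.+ b) b + gᵖ b (a ℕ.+ b) y x * K b (a ℕ.+ b) ≡ Gᵖ a b x (y ℕ.+ x) * F a
      lemma a b x y rewrite K-comm b (a ℕ.+ b) | K-shift a b =
        trans (sym (ℤP.*-distribʳ-+ (F a) (gᵖ (a ℕ.+ b) b x y) _)) (cong (_* F a) (h₂ᵖ a b x y))
    step₂ : B ≈ D₂ ⊕ w₃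
    step₂ = ≈-trans (split-xy (λ a b x y → gᵖ a b x y * F (a ℕ.+ b)))
      (⊕-cong ≈-refl (merge (λ a b x y → gᵖ a b x (y ℕ.+ x) * F (a ℕ.+ b)) (λ a b x y → gᵖ b a (y ℕ.+ x) x * F (b ℕ.+ a)) (λ a b x y → Gᵖ (a ℕ.+ b) b x y * F (a ℕ.+ b)) (λ a b x y → lemma (suc a) (suc b) (suc x) (suc y))))
      where
      lemma : ∀ a b x y → gᵖ a b x (y ℕ.+ x) * F (a ℕ.+ b) + gᵖ b a (y ℕ.+ x) x * F (b ℕ.+ a) ≡ Gᵖ (a ℕ.+ b) b x y * F (a ℕ.+ b)
      lemma a b x y rewrite ℕP.+-comm b a =
        trans (sym (ℤP.*-distribʳ-+ (F (a ℕ.+ b)) (gᵖ a b x (y ℕ.+ x)) _)) (cong (_* F (a ℕ.+ b)) (h₁ᵖ a b x y))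
    -- The auxiliary sum is split both ways. Its remainder `w₅` is common to the two splittings by
    -- `h₃`, whence `w₄` - `w₃` = `D₃` - `D₄`.
    step₃ : ⟪ (λ a b x y → Gᵖ a b x y * F a) ⟫ ≈ D₃ ⊕ (w₃ ⊕ w₅)
    step₃ = split-ab (λ a b x y → Gᵖ a b x y * F a)
    step₄ : ⟪ (λ a b x y → Gᵖ a b x y * F a) ⟫ ≈ D₄ ⊕ (w₄ ⊕ w₅)
    step₄ = ≈-trans (split-xy (λ a b x y → Gᵖ a b x y * F a))
      (⊕-cong ≈-refl (⊕-cong ≈-refl (S-cong {λ a b x y → Gᵖ b a (y ℕ.+ x) x * F b} {λ a b x y → Gᵖ b (a ℕ.+ b) y x * F b}
        (λ a b x y → cong (_* F (suc b)) (sym (h₃ᵖ (suc a) (suc b) (suc x) (suc y)))))))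

-- Diagonal sums as Lambert series

Σ₁ : ℕ → (ℕ → ℤ) → ℤ
Σ₁ zero    f = + 0
Σ₁ (suc m) f = Σ₁ m f + f (suc m)

Σ₁≡sumL : ∀ m f → Σ₁ m f ≡ sumL (f ∘ suc) (upTo m)
Σ₁≡sumL zero    f = refl
Σ₁≡sumL (suc m) f = trans (cong (_+ f (suc m)) (Σ₁≡sumL m f)) (sym (sumL-upTo m (f ∘ suc)))

-- The weight a x + a y equals d e with d = a and e = x + y; for fixed (d, e) the free variable is l
-- = x with 1 ≤ l ≤ e - 1.
D≈Λ : ∀ (k : ℕ → ℕ → ℕ → ℤ) → D[ (λ a x y → k a x (x ℕ.+ y)) ] ≈ Λ (λ d e → Σ₁ (ℕ.pred e) (λ l → k d l e))
D≈Λ k = ext λ n → begin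
  ⟦ diagonal ⟧ h n ≡⟨ ⟦⟧-list diagonal h n (unique n) (sound n) (complete n) ⟩
  sumL h (concatMap cut (fibre divisorPairs n)) ≡⟨ sumL-concatMap h cut (fibre divisorPairs n) ⟩
  sumL (λ p → sumL h (cut p)) (fibre divisorPairs n) ≡⟨ sumL-cong (fibre divisorPairs n) (λ {p} _ → value p) ⟩
  Λ (λ d e → Σ₁ (ℕ.pred e) (λ l → k d l e)) n ∎
  where
  open ≡-Reasoning
  h : ℕ × ℕ × ℕ → ℤ
  h (a , x , y) = k (suc a) (suc x) (suc x ℕ.+ suc y)
  cut₁ : ℕ × ℕ → ℕ → ℕ × ℕ × ℕ
  cut₁ (d , e) l = d , l , e ℕ.∸ suc l
  cut : ℕ × ℕ → List (ℕ × ℕ × ℕ)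
  cut (d , e) = map (cut₁ (d , e)) (upTo e)
  glue : ℕ × ℕ × ℕ → ℕ × ℕ
  glue (a , x , y) = a , x ℕ.+ suc y
  sum-cut : ∀ {e l} → l ∈ upTo e → l ℕ.+ suc (e ℕ.∸ suc l) ≡ e
  sum-cut {e} {l} p = trans (ℕP.+-suc l _) (ℕP.m+[n∸m]≡n (∈-upTo⁻ p))
  value : ∀ p → sumL h (cut p) ≡ Σ₁ (proj₂ p) (λ l → k (suc (proj₁ p)) l (suc (proj₂ p)))
  value (d , e) = trans (sumL-map h (cut₁ (d , e)) (upTo e)) (trans
    (sumL-cong (upTo e) (λ {l} p → cong (λ z → k (suc d) (suc l) (suc z)) (sum-cut p)))
    (sym (Σ₁≡sumL e _)))
  unique : ∀ n → Unique (concatMap cut (fibre divisorPairs n))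
  unique n = unique-concatMap glue cut glue-cut
    (λ (d , e) → Uniq.map⁺ (cong (proj₁ ∘ proj₂)) (Uniq.upTo⁺ e)) (fibre-unique divisorPairs n)
    where
    glue-cut : ∀ {p j} → j ∈ cut p → glue j ≡ p
    glue-cut {d , e} q with ∈-map⁻ (cut₁ (d , e)) q
    ... | l , l∈ , refl = cong (d ,_) (sum-cut l∈)
  weight : ∀ a x y → wt diagonal (a , x , y) ≡ wt divisorPairs (glue (a , x , y))
  weight a x y = sym (ℕP.*-distribˡ-+ (suc a) (suc x) (suc y))
  sound : ∀ n {j} → j ∈ concatMap cut (fibre divisorPairs n) → wt diagonal j ≡ n
  sound n {j} q with find (∈-concatMap⁻ cut {fibre divisorPairs n} q)
  ... | (d , e) , p∈ , j∈ with ∈-map⁻ (cut₁ (d , e)) j∈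
  ...   | l , l∈ , refl = trans (weight d l (e ℕ.∸ suc l)) (trans (cong (λ z → suc d ℕ.* suc z) (sum-cut l∈)) (∈-fibre⁻ divisorPairs p∈))
  complete : ∀ n j → wt diagonal j ≡ n → j ∈ concatMap cut (fibre divisorPairs n)
  complete n (a , x , y) eq = ∈-concatMap⁺ cut (lose
    (∈-fibre⁺ divisorPairs (a , x ℕ.+ suc y) (trans (sym (weight a x y)) eq))
    (subst (λ z → (a , x , z) ∈ cut (a , x ℕ.+ suc y)) y≡ (∈-map⁺ (cut₁ (a , x ℕ.+ suc y)) (∈-upTo⁺ x<))))
    where
    x< : x < x ℕ.+ suc y
    x< = ℕP.m<m+n x (s≤s z≤n)
    y≡ : x ℕ.+ suc y ℕ.∸ suc x ≡ y
    y≡ = trans (cong (ℕ._∸ suc x) (ℕP.+-suc x y)) (ℕP.m+n∸m≡n x y)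

Combination : Set
Combination = List (ℤ × (ℕ → ℕ → ℤ))

pointwise : Combination → ℕ → ℕ → ℤ
pointwise []            d e = + 0
pointwise ((c , f) ∷ l) d e = c * f d e + pointwise l d e

termwise : Combination → Series
termwise []            = zeroS
termwise ((c , f) ∷ l) = κ c · Λ f ⊕ termwise l

Λ-pointwise : ∀ l → Λ (pointwise l) ≈ termwise l
Λ-pointwise []            = ext λ n → zeros (fibre divisorPairs n)
  where
  zeros : {I : Set} (xs : List I) → sumL (λ _ → + 0) xs ≡ + 0
  zeros []       = refl
  zeros (_ ∷ xs) = trans (ℤP.+-identityˡ _) (zeros xs)
Λ-pointwise ((c , f) ∷ l) = ≈-trans (Λ-+ (λ d e → c * f d e) (pointwise l)) (⊕-cong (Λ-* c f) (Λ-pointwise l))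

Λ-combination : ∀ l f → (∀ d e → f (suc d) (suc e) ≡ pointwise l (suc d) (suc e)) → Λ f ≈ termwise l
Λ-combination l f eq = ≈-trans (Λ-cong f (pointwise l) eq) (Λ-pointwise l)

Λ-⊛ : ∀ (f g : ℕ → ℕ → ℤ) → Λ f · Λ g ≈ ⟪ (λ a b x y → f a x * g b y) ⟫
Λ-⊛ f g = ≈-sym (⟦⊗⟧ divisorPairs divisorPairs _ _)

F-zero : ∀ n → ¬ (3 ∣ n) → F n ≡ + 0
F-zero 0                   3∤n = ⊥-elim (3∤n (3 ∣0))
F-zero 1                   3∤n = refl
F-zero 2                   3∤n = refl
F-zero (suc (suc (suc n))) 3∤n = F-zero n (λ 3∣n → 3∤n (∣m∣n⇒∣m+n ∣-refl 3∣n))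

even-zero : ∀ n → ¬ (2 ∣ n) → even n ≡ + 0
even-zero 0             2∤n = ⊥-elim (2∤n (2 ∣0))
even-zero 1             2∤n = refl
even-zero (suc (suc n)) 2∤n = even-zero n (λ 2∣n → 2∤n (∣m∣n⇒∣m+n ∣-refl 2∣n))

F-3* : ∀ n → F (3 ℕ.* n) ≡ + 1
F-3* n = trans (cong F (ℕP.*-comm 3 n)) (go n)
  where
  go : ∀ n → F (n ℕ.* 3) ≡ + 1
  go zero    = refl
  go (suc n) = go n

par-2* : ∀ n → par (2 ℕ.* n) ≡ false
par-2* n = trans (cong par (ℕP.*-comm 2 n)) (go n)
  where
  go : ∀ n → par (n ℕ.* 2) ≡ false
  go zero    = refl
  go (suc n) = go n

par-3* : ∀ n → par (3 ℕ.* n) ≡ par n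
par-3* n = trans (cong par (ℕP.*-comm 3 n)) (go n)
  where
  go : ∀ n → par (n ℕ.* 3) ≡ par n
  go 0             = refl
  go 1             = refl
  go (suc (suc n)) = go n

F-2* : ∀ n → F (2 ℕ.* n) ≡ F n
F-2* n = trans (cong F (ℕP.*-comm 2 n)) (go n)
  where
  go : ∀ n → F (n ℕ.* 2) ≡ F n
  go 0                   = refl
  go 1                   = refl
  go 2                   = refl
  go (suc (suc (suc n))) = go n

χ-2* : ∀ n → χ (2 ℕ.* n) ≡ - χ n
χ-2* n = trans (cong χ (ℕP.*-comm 2 n)) (go n)
  where
  go : ∀ n → χ (n ℕ.* 2) ≡ - χ n
  go 0                   = refl
  go 1                   = refl
  go 2                   = refl
  go (suc (suc (suc n))) = go n

odd+even : ∀ n → odd n + even n ≡ + 1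
odd+even n with par n
... | true  = refl
... | false = refl

Λ-F : ∀ (f : ℕ → ℕ → ℤ) → Λ (λ d e → F d * f d e) ≈ dil 3 (Λ (λ d e → f (3 ℕ.* d) e))
Λ-F f = ≈-trans (Λ-multiples 3 (λ d e → F d * f d e) (λ d e 3∤d → trans (cong (_* f d e) (F-zero d 3∤d)) (ℤP.*-zeroˡ (f d e))))
  (dil-cong 3 (Λ-cong (λ d e → F (3 ℕ.* d) * f (3 ℕ.* d) e) (λ d e → f (3 ℕ.* d) e) (λ d e → trans (cong (_* f (3 ℕ.* suc d) (suc e)) (F-3* (suc d))) (ℤP.*-identityˡ _))))

Λ-even : ∀ (f : ℕ → ℕ → ℤ) → Λ (λ d e → even d * f d e) ≈ dil 2 (Λ (λ d e → f (2 ℕ.* d) e))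
Λ-even f = ≈-trans (Λ-multiples 2 (λ d e → even d * f d e) (λ d e 2∤d → trans (cong (_* f d e) (even-zero d 2∤d)) (ℤP.*-zeroˡ (f d e))))
  (dil-cong 2 (Λ-cong (λ d e → even (2 ℕ.* d) * f (2 ℕ.* d) e) (λ d e → f (2 ℕ.* d) e) (λ d e → trans (cong (λ p → ι (not p) * f (2 ℕ.* suc d) (suc e)) (par-2* (suc d))) (ℤP.*-identityˡ _))))

complement : ∀ (f : ℕ → ℕ → ℤ) → Λ f ≈ Λ (λ d e → odd d * f d e) ⊕ Λ (λ d e → even d * f d e)
complement f = ≈-trans
  (Λ-cong f (λ d e → odd d * f d e + even d * f d e) (λ d e → sym (trans (sym (ℤP.*-distribʳ-+ (f (suc d) (suc e)) (odd (suc d)) (even (suc d))))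
    (trans (cong (_* f (suc d) (suc e)) (odd+even (suc d))) (ℤP.*-identityˡ _)))))
  (Λ-+ (λ d e → odd d * f d e) (λ d e → even d * f d e))

Λ-odd : ∀ (f : ℕ → ℕ → ℤ) → Λ (λ d e → odd d * f d e) ≈ Λ f ⊕ ⊖ dil 2 (Λ (λ d e → f (2 ℕ.* d) e))
Λ-odd f = begin
  o ≈⟨ solve 2 (λ o v → o := o :+ v :+ :- v) ≈-refl o v ⟩
  o ⊕ v ⊕ ⊖ v ≈⟨ ⊕-cong (≈-sym (complement f)) (⊖-cong (Λ-even f)) ⟩
  Λ f ⊕ ⊖ dil 2 (Λ (λ d e → f (2 ℕ.* d) e)) ∎
  where
  open ≈-Reasoning
  o = Λ (λ d e → odd d * f d e)
  v = Λ (λ d e → even d * f d e)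

-- The removed pairs have the form (d, 2e); since f ignores the second entry, they contribute the
-- same series at q².
Λ-odd′ : ∀ (f : ℕ → ℤ) → Λ (λ d e → odd e * f d) ≈ Λ (λ d e → f d) ⊕ ⊖ dil 2 (Λ (λ d e → f d))
Λ-odd′ f = ≈-trans (Λ-swap (λ d e → odd e * f d)) (≈-trans (Λ-odd (λ d e → f e))
  (⊕-cong (Λ-swap (λ d e → f e)) (⊖-cong (dil-cong 2 (Λ-swap (λ d e → f e))))))

Σ₁-* : ∀ m c f → Σ₁ m (λ l → c * f l) ≡ c * Σ₁ m f
Σ₁-* zero    c f = sym (ℤP.*-zeroʳ c)
Σ₁-* (suc m) c f = trans (cong (_+ c * f (suc m)) (Σ₁-* m c f)) (sym (ℤP.*-distribˡ-+ c (Σ₁ m f) (f (suc m))))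

Σ₁-const : ∀ m c → Σ₁ m (λ _ → c) ≡ + m * c
Σ₁-const zero    c = sym (ℤP.*-zeroˡ c)
Σ₁-const (suc m) c = trans (cong (_+ c) (Σ₁-const m c)) (lemma (+ m) c)
  where
  lemma : ∀ m c → m * c + c ≡ (+ 1 + m) * c
  lemma = solve-∀

telescope : ∀ c (f t : ℕ → ℤ) → t 0 ≡ + 0 → (∀ m → t m + c * f (suc m) ≡ t (suc m)) → ∀ m → c * Σ₁ m f ≡ t m
telescope c f t t₀ step zero    = trans (ℤP.*-zeroʳ c) (sym t₀)
telescope c f t t₀ step (suc m) = trans (ℤP.*-distribˡ-+ c (Σ₁ m f) (f (suc m)))
  (trans (cong (_+ c * f (suc m)) (telescope c f t t₀ step m)) (step m))

Σ-odd : ∀ m → + 2 * Σ₁ m odd ≡ + m + odd m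
Σ-odd = telescope (+ 2) odd (λ m → + m + odd m) refl
  (λ m → trans (cong (λ p → + m + odd m + + 2 * ι p) (par-suc m))
    (trans (lemma m (par m)) (cong (λ p → + suc m + ι p) (sym (par-suc m)))))
  where
  even-step : ∀ m → m + + 0 + + 2 * + 1 ≡ + 1 + m + + 1
  even-step = solve-∀
  odd-step : ∀ m → m + + 1 + + 2 * + 0 ≡ + 1 + m + + 0
  odd-step = solve-∀
  lemma : ∀ m p → + m + ι p + + 2 * ι (not p) ≡ + suc m + ι (not p)
  lemma m false = even-step (+ m)
  lemma m true  = odd-step (+ m)

-- Six times the integer part of m/3: the linear function 2 (m + 1) - 3 is corrected by a function
-- of period 3, written through `χ` and `F` because the Lambert series of these can be handled.
Σ-F : ∀ m → + 6 * Σ₁ m F ≡ + 2 * + suc m - + 3 + χ (suc m) - + 3 * F (suc m)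
Σ-F = telescope (+ 6) F (λ m → + 2 * + suc m - + 3 + χ (suc m) - + 3 * F (suc m)) refl
  (λ m → trans (arrange (+ suc m) (χ (suc m)) (F (suc m)))
    (trans (+-congʳ (+ 2 * + suc m - + 3) (periodic (suc m))) (rearrange (+ suc m) (χ (suc (suc m))) (F (suc (suc m))))))
  where
  arrange : ∀ m c f → + 2 * m - + 3 + c - + 3 * f + + 6 * f ≡ + 2 * m - + 3 + (c + + 3 * f)
  arrange = solve-∀
  rearrange : ∀ m c f → + 2 * m - + 3 + (+ 2 + c - + 3 * f) ≡ + 2 * (+ 1 + m) - + 3 + c - + 3 * f
  rearrange = solve-∀
  periodic : ∀ s → χ s + + 3 * F s ≡ + 2 + χ (suc s) - + 3 * F (suc s)
  periodic 0                   = refl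
  periodic 1                   = refl
  periodic 2                   = refl
  periodic (suc (suc (suc s))) = periodic s

-- 6 times the number of l ≡ 3 (mod 6) with 1 ≤ l ≤ m is m + 1 + ε (m + 1).
ε : ℕ → ℤ
ε 0 = + 0
ε 1 = - + 1
ε 2 = - + 2
ε 3 = - + 3
ε 4 = + 2
ε 5 = + 1
ε (suc (suc (suc (suc (suc (suc n)))))) = ε n

Σ-oddF : ∀ m → + 6 * Σ₁ m (λ l → odd l * F l) ≡ + suc m + ε (suc m)
Σ-oddF = telescope (+ 6) (λ l → odd l * F l) (λ m → + suc m + ε (suc m)) refl
  (λ m → trans (ℤP.+-assoc (+ suc m) (ε (suc m)) _) (trans (+-congʳ (+ suc m) (periodic (suc m))) (arrange (+ suc m) (ε (suc (suc m))))))
  where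
  arrange : ∀ m e → m + (+ 1 + e) ≡ + 1 + m + e
  arrange = solve-∀
  periodic : ∀ s → ε s + + 6 * (odd s * F s) ≡ + 1 + ε (suc s)
  periodic 0 = refl
  periodic 1 = refl
  periodic 2 = refl
  periodic 3 = refl
  periodic 4 = refl
  periodic 5 = refl
  periodic (suc (suc (suc (suc (suc (suc s)))))) = periodic s

-- `ε` has period 6, but it is only evaluated at odd n, where it reduces to functions of period 3
-- with manageable Lambert series.
odd-ε : ∀ n → odd n * ε n ≡ odd n * - (χ n + + 3 * F n)
odd-ε 0 = refl
odd-ε 1 = refl
odd-ε 2 = refl
odd-ε 3 = refl
odd-ε 4 = refl
odd-ε 5 = refl
odd-ε (suc (suc (suc (suc (suc (suc n)))))) = odd-ε n

-- The Lambert series of χ and its square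

-- `Yᴸ`, the part of `L` with n = de odd, is the candidate for `Y`, just as `A` below, the
-- weight-one Eisenstein series of χ, is the candidate for `a`.
σS L Yᴸ : Series
σS = Λ (λ d e → + d)
L  = Λ (λ d e → χ d)
Yᴸ = Λ (λ d e → odd e * (odd d * χ d))

A : Series
A = oneS ⊕ κ (+ 6) · L

Λ-scaled : ∀ c (f g : ℕ → ℕ → ℤ) → (∀ d e → f (suc d) (suc e) ≡ c * g (suc d) (suc e)) → Λ f ≈ κ c · Λ g
Λ-scaled c f g eq = ≈-trans (Λ-cong f (λ d e → c * g d e) eq) (Λ-* c g)

dil-χ : dil 2 (Λ (λ d e → χ (2 ℕ.* d))) ≈ ⊖ dil 2 L
dil-χ = begin
  dil 2 (Λ (λ d e → χ (2 ℕ.* d))) ≈⟨ dil-cong 2 (Λ-scaled (- + 1) (λ d e → χ (2 ℕ.* d)) (λ d e → χ d) (λ d e → trans (χ-2* (suc d)) (sym (ℤP.-1*i≡-i (χ (suc d)))))) ⟩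
  dil 2 (κ (- + 1) · L) ≈⟨ dil-κ· 2 (- + 1) L ⟩
  κ (- + 1) · dil 2 L ≈⟨ solve 1 (λ x → con (- + 1) :* x := :- x) ≈-refl (dil 2 L) ⟩
  ⊖ dil 2 L ∎
  where open ≈-Reasoning

-- Since χ(2) = -1, keeping odd d turns L(q) into L(q) + L(q²); keeping odd e then subtracts the
-- same at q², and the terms L(q²) cancel.
L≈L₄+Y : L ≈ dil 4 L ⊕ Yᴸ
L≈L₄+Y = begin
  L ≈⟨ solve 3 (λ L M N → L := N :+ (L :+ M :+ :- (M :+ N))) ≈-refl L (dil 2 L) (dil 4 L) ⟩
  dil 4 L ⊕ (L ⊕ dil 2 L ⊕ ⊖ (dil 2 L ⊕ dil 4 L)) ≈⟨ ⊕-cong ≈-refl (⊕-cong ≈-refl (⊖-cong (⊕-cong ≈-refl (dil-dil 2 2 L)))) ⟨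
  dil 4 L ⊕ (L ⊕ dil 2 L ⊕ ⊖ (dil 2 L ⊕ dil 2 (dil 2 L))) ≈⟨ ⊕-cong ≈-refl (⊕-cong ≈-refl (⊖-cong (dil-⊕ 2 L (dil 2 L)))) ⟨
  dil 4 L ⊕ (L ⊕ dil 2 L ⊕ ⊖ dil 2 (L ⊕ dil 2 L)) ≈⟨ ⊕-cong ≈-refl (⊕-cong odd-d (⊖-cong (dil-cong 2 odd-d))) ⟨
  dil 4 L ⊕ (Λ (λ d e → odd d * χ d) ⊕ ⊖ dil 2 (Λ (λ d e → odd d * χ d))) ≈⟨ ⊕-cong ≈-refl (Λ-odd′ (λ d → odd d * χ d)) ⟨
  dil 4 L ⊕ Yᴸ ∎
  where
  open ≈-Reasoning
  odd-d : Λ (λ d e → odd d * χ d) ≈ L ⊕ dil 2 L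
  odd-d = ≈-trans (Λ-odd (λ d e → χ d)) (≈-trans (⊕-cong ≈-refl (⊖-cong dil-χ))
    (solve 2 (λ x y → x :+ :- (:- y) := x :+ y) ≈-refl L (dil 2 L)))

⊕-zeroʳ : ∀ f → f ⊕ zeroS ≈ f
⊕-zeroʳ f = ≈-trans (⊕-comm f zeroS) (⊕-identityˡ f)

Λe≈σ : Λ (λ d e → + e) ≈ σS
Λe≈σ = Λ-swap (λ d e → + e)

ΛFd·d : Λ (λ d e → F d * + d) ≈ κ (+ 3) · dil 3 σS
ΛFd·d = begin
  Λ (λ d e → F d * + d) ≈⟨ Λ-F (λ d e → + d) ⟩
  dil 3 (Λ (λ d e → + (3 ℕ.* d))) ≈⟨ dil-cong 3 (Λ-scaled (+ 3) (λ d e → + (3 ℕ.* d)) (λ d e → + d) (λ d e → ℤP.pos-* 3 (suc d))) ⟩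
  dil 3 (κ (+ 3) · σS) ≈⟨ dil-κ· 3 (+ 3) σS ⟩
  κ (+ 3) · dil 3 σS ∎
  where open ≈-Reasoning

ΛFd·e : Λ (λ d e → F d * + e) ≈ dil 3 σS
ΛFd·e = ≈-trans (Λ-F (λ d e → + e)) (dil-cong 3 Λe≈σ)

-- σ₃ = Σ_{3 ∤ d} d q^{de}
σ₃ : Series
σ₃ = σS ⊕ ⊖ (κ (+ 3) · dil 3 σS)

-- Without a parity restriction G is a sum of two values of g, hence 2.
module Unrestricted = Liouville (λ _ _ _ _ → + 1) (λ _ _ _ _ → + 2) (λ _ _ _ _ → refl) (λ _ _ _ _ → refl) (λ _ _ _ _ → refl)

4-terms : ∀ u₁ u₂ u₃ u₄ → Λ u₁ ⊕ ⊖ Λ u₂ ⊕ Λ u₃ ⊕ ⊖ Λ u₄ ≈ Λ (λ d e → u₁ d e - u₂ d e + u₃ d e - u₄ d e)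
4-terms u₁ u₂ u₃ u₄ = ≈-sym (≈-trans
  (Λ-combination ((+ 1 , u₁) ∷ (- + 1 , u₂) ∷ (+ 1 , u₃) ∷ (- + 1 , u₄) ∷ []) (λ d e → u₁ d e - u₂ d e + u₃ d e - u₄ d e)
    (λ d e → lemma (u₁ (suc d) (suc e)) (u₂ (suc d) (suc e)) (u₃ (suc d) (suc e)) (u₄ (suc d) (suc e))))
  (≈-trans (⊕-cong ≈-refl (⊕-cong ≈-refl (⊕-cong ≈-refl (⊕-zeroʳ _))))
    (solve 4 (λ a b c d → con (+ 1) :* a :+ (con (- + 1) :* b :+ (con (+ 1) :* c :+ con (- + 1) :* d)) := a :+ :- b :+ c :+ :- d) ≈-refl (Λ u₁) (Λ u₂) (Λ u₃) (Λ u₄))))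
  where
  lemma : ∀ a b c d → a - b + c - d ≡ + 1 * a + (- + 1 * b + (+ 1 * c + (- + 1 * d + + 0)))
  lemma = solve-∀

-- The factor 3 makes the inner sum over `F` appear as 6 Σ F, which `Σ-F` evaluates. Its χ(e)
-- produces -L; the terms 6 F(e) and -6 F(d) cancel when d and e are exchanged; the terms -3 F(e) e
-- and 6 F(d) e give -9 + 6 = -3 times σ(q³).
3L²+L≈σ₃ : κ (+ 3) · (L · L) ⊕ L ≈ σ₃
3L²+L≈σ₃ = begin
  κ (+ 3) · (L · L) ⊕ L ≈⟨ ⊕-cong (·-cong ≈-refl L²) ≈-refl ⟩
  κ (+ 3) · Λ u ⊕ L ≈⟨ ⊕-cong (Λ-* (+ 3) u) ≈-refl ⟨
  Λ (λ d e → + 3 * u d e) ⊕ L ≈⟨ ⊕-cong (Λ-combination combination (λ d e → + 3 * u d e) evaluate) ≈-refl ⟩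
  termwise combination ⊕ L ≈⟨ ⊕-cong (⊕-cong (·-cong ≈-refl Λe≈σ) (⊕-cong (·-cong ≈-refl (≈-trans (Λ-swap (λ d e → F e * + e)) ΛFd·d))
        (⊕-cong (·-cong ≈-refl (Λ-swap (λ d e → F e))) (⊕-cong (·-cong ≈-refl ΛFd·e)
        (⊕-cong ≈-refl (⊕-cong (·-cong ≈-refl (Λ-swap (λ d e → χ e))) ≈-refl)))))) ≈-refl ⟩
  κ (+ 1) · σS ⊕ (κ (- + 3) · (κ (+ 3) · dil 3 σS) ⊕ (κ (+ 6) · f ⊕ (κ (+ 6) · dil 3 σS ⊕ (κ (- + 6) · f ⊕ (κ (- + 1) · L ⊕ zeroS))))) ⊕ L
        ≈⟨ ⊕-cong (⊕-cong ≈-refl (⊕-cong ≈-refl (⊕-cong ≈-refl (⊕-cong ≈-refl (⊕-cong ≈-refl (⊕-zeroʳ _)))))) ≈-refl ⟩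
  κ (+ 1) · σS ⊕ (κ (- + 3) · (κ (+ 3) · dil 3 σS) ⊕ (κ (+ 6) · f ⊕ (κ (+ 6) · dil 3 σS ⊕ (κ (- + 6) · f ⊕ κ (- + 1) · L)))) ⊕ L
        ≈⟨ solve 4 (λ x y f l → con (+ 1) :* x :+ (con (- + 3) :* (con (+ 3) :* y) :+ (con (+ 6) :* f :+ (con (+ 6) :* y :+ (con (- + 6) :* f :+ con (- + 1) :* l)))) :+ l
        := x :+ :- (con (+ 3) :* y)) ≈-refl σS (dil 3 σS) f L ⟩
  σ₃ ∎
  where
  open ≈-Reasoning
  f = Λ (λ d e → F d)
  u₁ u₂ u₃ u₄ u : ℕ → ℕ → ℤ
  u₁ d e = Σ₁ (ℕ.pred e) (λ l → + 1)
  u₂ d e = Σ₁ (ℕ.pred e) (λ l → + 1 * F e)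
  u₃ d e = Σ₁ (ℕ.pred e) (λ l → + 2 * F d)
  u₄ d e = Σ₁ (ℕ.pred e) (λ l → + 2 * F l)
  u d e = u₁ d e - u₂ d e + u₃ d e - u₄ d e
  L² : L · L ≈ Λ u
  L² = begin
    L · L ≈⟨ Λ-⊛ (λ d e → χ d) (λ d e → χ d) ⟩
    ⟪ (λ a b x y → χ a * χ b) ⟫ ≈⟨ ⟦⟧-cong quads (λ _ → sym (ℤP.*-identityˡ _)) ⟩
    ⟪ (λ a b x y → + 1 * (χ a * χ b)) ⟫ ≈⟨ Unrestricted.liouville ⟩
    _ ≈⟨ ⊕-cong (⊕-cong (⊕-cong (D≈Λ (λ d l e → + 1)) (⊖-cong (D≈Λ (λ d l e → + 1 * F e))))
        (D≈Λ (λ d l e → + 2 * F d))) (⊖-cong (D≈Λ (λ d l e → + 2 * F l))) ⟩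
    Λ u₁ ⊕ ⊖ Λ u₂ ⊕ Λ u₃ ⊕ ⊖ Λ u₄ ≈⟨ 4-terms u₁ u₂ u₃ u₄ ⟩
    Λ u ∎
  combination : Combination
  combination = (+ 1 , λ d e → + e) ∷ (- + 3 , λ d e → F e * + e) ∷ (+ 6 , λ d e → F e) ∷ (+ 6 , λ d e → F d * + e) ∷ (- + 6 , λ d e → F d) ∷ (- + 1 , λ d e → χ e) ∷ []
  expand : ∀ m fe fd M → + 3 * (m * + 1 - m * (+ 1 * fe) + m * (+ 2 * fd) - + 2 * M) ≡ + 3 * m - + 3 * m * fe + + 6 * m * fd - + 6 * M
  expand = solve-∀
  collect : ∀ m fe fd c → + 3 * m - + 3 * m * fe + + 6 * m * fd - (+ 2 * (+ 1 + m) - + 3 + c - + 3 * fe) ≡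
    + 1 * (+ 1 + m) + (- + 3 * (fe * (+ 1 + m)) + (+ 6 * fe + (+ 6 * (fd * (+ 1 + m)) + (- + 6 * fd + (- + 1 * c + + 0)))))
  collect = solve-∀
  evaluate : ∀ d m → + 3 * u (suc d) (suc m) ≡ pointwise combination (suc d) (suc m)
  evaluate d m rewrite Σ₁-const m (+ 1) | Σ₁-const m (+ 1 * F (suc m)) | Σ₁-const m (+ 2 * F (suc d)) | Σ₁-* m (+ 2) F =
    trans (expand (+ m) (F (suc m)) (F (suc d)) (Σ₁ m F)) (trans
      (cong (λ z → + 3 * + m - + 3 * + m * F (suc m) + + 6 * + m * F (suc d) - z) (Σ-F m))
      (collect (+ m) (F (suc m)) (F (suc d)) (χ (suc m))))

A² : A · A ≈ oneS ⊕ κ (+ 12) · σ₃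
A² = begin
  A · A ≈⟨ solve 2 (λ i l → (i :+ con (+ 6) :* l) :* (i :+ con (+ 6) :* l) := i :* i :+ con (+ 12) :* (con (+ 3) :* (l :* l) :+ i :* l)) ≈-refl oneS L ⟩
  oneS · oneS ⊕ κ (+ 12) · (κ (+ 3) · (L · L) ⊕ oneS · L) ≈⟨ ⊕-cong (·-identityˡ oneS) (·-cong ≈-refl (⊕-cong ≈-refl (·-identityˡ L))) ⟩
  oneS ⊕ κ (+ 12) · (κ (+ 3) · (L · L) ⊕ L) ≈⟨ ⊕-cong ≈-refl (·-cong ≈-refl 3L²+L≈σ₃) ⟩
  oneS ⊕ κ (+ 12) · σ₃ ∎
  where open ≈-Reasoning

∀ᵇ? : {P : Bool → Set} → (∀ b → Dec (P b)) → Dec (∀ b → P b)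
∀ᵇ? P? with P? true | P? false
... | yes p | yes q = yes λ { true → p ; false → q }
... | no ¬p | _     = no λ f → ¬p (f true)
... | _     | no ¬q = no λ f → ¬q (f false)

D-Λ : ∀ (h k : ℕ → ℕ → ℕ → ℤ) → (∀ a x y → h a x y ≡ k a x (x ℕ.+ y)) → D[ h ] ≈ Λ (λ d e → Σ₁ (ℕ.pred e) (λ l → k d l e))
D-Λ h k eq = ≈-trans (D-cong {h} {λ a x y → k a x (x ℕ.+ y)} (λ a x y → eq (suc a) (suc x) (suc y))) (D≈Λ k)

Σ₁-zero : ∀ m → Σ₁ m (λ _ → + 0) ≡ + 0
Σ₁-zero m = trans (Σ₁-const m (+ 0)) (ℤP.*-zeroʳ (+ m))

-- G is forced by g: substituting in `h₁`, both values of g ask for the same parities, so G is twice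
-- the indicator of a even, b odd, x odd, y even. This is incompatible with a = b and with x = y, so
-- the diagonal terms of G vanish.
module AllOdd where
  g G : Bool → Bool → Bool → Bool → ℤ
  g a b x y = ι a * ι b * ι x * ι y
  G a b x y = + 2 * (ι (not a) * ι b * ι x * ι (not y))

  open Liouville g G
    (from-yes (∀ᵇ? λ a → ∀ᵇ? λ b → ∀ᵇ? λ x → ∀ᵇ? λ y → G (a xor b) b x y ℤP.≟ g a b x (y xor x) + g b a (y xor x) x))
    (from-yes (∀ᵇ? λ a → ∀ᵇ? λ b → ∀ᵇ? λ x → ∀ᵇ? λ y → G a b x (y xor x) ℤP.≟ g (a xor b) b x y + g b (a xor b) y x))
    (from-yes (∀ᵇ? λ a → ∀ᵇ? λ b → ∀ᵇ? λ x → ∀ᵇ? λ y → G b (a xor b) y x ℤP.≟ G b a (y xor x) x))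
    public using (liouville; gᵖ; Gᵖ)

  u₁ u₂ u₃ u : ℕ → ℕ → ℤ
  u₁ d e = Σ₁ (ℕ.pred e) (λ l → odd d * even e * odd l)
  u₂ d e = Σ₁ (ℕ.pred e) (λ l → odd d * even e * F e * odd l)
  u₃ d e = Σ₁ (ℕ.pred e) (λ l → + 0)
  u d e = u₁ d e - u₂ d e + u₃ d e - u₃ d e

  Y²≈Λu : Yᴸ · Yᴸ ≈ Λ u
  Y²≈Λu = begin
    Yᴸ · Yᴸ ≈⟨ Λ-⊛ (λ d e → odd e * (odd d * χ d)) (λ d e → odd e * (odd d * χ d)) ⟩
    ⟪ (λ a b x y → odd x * (odd a * χ a) * (odd y * (odd b * χ b))) ⟫ ≈⟨ ⟦⟧-cong quads (λ ((a , x) , (b , y)) →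
        arrange (odd (suc a)) (odd (suc b)) (odd (suc x)) (odd (suc y)) (χ (suc a)) (χ (suc b))) ⟩
    ⟪ (λ a b x y → gᵖ a b x y * (χ a * χ b)) ⟫ ≈⟨ liouville ⟩
    _ ≈⟨ ⊕-cong (⊕-cong (⊕-cong
        (D-Λ (λ a x y → gᵖ a a x y) (λ d l e → odd d * even e * odd l) e₁)
        (⊖-cong (D-Λ (λ a x y → gᵖ x y a a * F (x ℕ.+ y)) (λ d l e → odd d * even e * F e * odd l) e₂)))
        (D-Λ (λ a x y → Gᵖ a a x y * F a) (λ d l e → + 0) e₃))
        (⊖-cong (D-Λ (λ a x y → Gᵖ x y a a * F x) (λ d l e → + 0) e₄)) ⟩
    Λ u₁ ⊕ ⊖ Λ u₂ ⊕ Λ u₃ ⊕ ⊖ Λ u₃ ≈⟨ 4-terms u₁ u₂ u₃ u₃ ⟩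
    Λ u ∎
    where
    open ≈-Reasoning
    arrange : ∀ a b x y c d → x * (a * c) * (y * (b * d)) ≡ a * b * x * y * (c * d)
    arrange = solve-∀
    reorder : ∀ a b c d → a * b * c * d ≡ a * b * d * c
    reorder = solve-∀
    e₁ : ∀ a x y → gᵖ a a x y ≡ odd a * even (x ℕ.+ y) * odd x
    e₁ a x y rewrite par-+ x y = from-yes (∀ᵇ? λ a → ∀ᵇ? λ x → ∀ᵇ? λ y → g a a x y ℤP.≟ ι a * ι (not (x xor y)) * ι x) (par a) (par x) (par y)
    e₂ : ∀ a x y → gᵖ x y a a * F (x ℕ.+ y) ≡ odd a * even (x ℕ.+ y) * F (x ℕ.+ y) * odd x
    e₂ a x y rewrite par-+ x y = trans
      (cong (_* F (x ℕ.+ y)) (from-yes (∀ᵇ? λ a → ∀ᵇ? λ x → ∀ᵇ? λ y → g x y a a ℤP.≟ ι a * ι (not (x xor y)) * ι x) (par a) (par x) (par y)))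
      (reorder (odd a) (ι (not (par x xor par y))) (odd x) (F (x ℕ.+ y)))
    e₃ : ∀ a x y → Gᵖ a a x y * F a ≡ + 0
    e₃ a x y = cong (_* F a) (from-yes (∀ᵇ? λ a → ∀ᵇ? λ x → ∀ᵇ? λ y → G a a x y ℤP.≟ + 0) (par a) (par x) (par y))
    e₄ : ∀ a x y → Gᵖ x y a a * F x ≡ + 0
    e₄ a x y = cong (_* F x) (from-yes (∀ᵇ? λ a → ∀ᵇ? λ x → ∀ᵇ? λ y → G x y a a ℤP.≟ + 0) (par a) (par x) (par y))

Λ[1-F]d≈σ₃ : Λ (λ d e → (+ 1 - F d) * + d) ≈ σ₃
Λ[1-F]d≈σ₃ = begin
  Λ (λ d e → (+ 1 - F d) * + d) ≈⟨ Λ-combination ((+ 1 , λ d e → + d) ∷ (- + 1 , λ d e → F d * + d) ∷ []) (λ d e → (+ 1 - F d) * + d)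
        (λ d e → lemma (F (suc d)) (+ suc d)) ⟩
  κ (+ 1) · σS ⊕ (κ (- + 1) · Λ (λ d e → F d * + d) ⊕ zeroS) ≈⟨ ⊕-cong ≈-refl (≈-trans (⊕-zeroʳ _) (·-cong ≈-refl ΛFd·d)) ⟩
  κ (+ 1) · σS ⊕ κ (- + 1) · (κ (+ 3) · dil 3 σS) ≈⟨ solve 2 (λ x y → con (+ 1) :* x :+ con (- + 1) :* (con (+ 3) :* y) := x :+ :- (con (+ 3) :* y)) ≈-refl σS (dil 3 σS) ⟩
  σ₃ ∎
  where
  open ≈-Reasoning
  lemma : ∀ f d → (+ 1 - f) * d ≡ + 1 * d + (- + 1 * (f * d) + + 0)
  lemma = solve-∀

-- For odd d and even e there are e/2 odd values l < e. So the square is half the sum over odd d and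
-- even e of (1 - F(e)) e; exchanging d and e and taking the even entry out as q² gives the
-- right-hand side.
Y² : Yᴸ · Yᴸ ≈ dil 2 (σ₃ ⊕ ⊖ dil 2 σ₃)
Y² = κ-cancel (+ 2) (begin
  κ (+ 2) · (Yᴸ · Yᴸ) ≈⟨ ·-cong ≈-refl Y²≈Λu ⟩
  κ (+ 2) · Λ u ≈⟨ Λ-* (+ 2) u ⟨
  Λ (λ d e → + 2 * u d e) ≈⟨ Λ-cong (λ d e → + 2 * u d e) (λ d e → even e * (odd d * ((+ 1 - F e) * + e))) evaluate ⟩
  Λ (λ d e → even e * (odd d * ((+ 1 - F e) * + e))) ≈⟨ Λ-swap (λ d e → even e * (odd d * ((+ 1 - F e) * + e))) ⟩
  Λ (λ d e → even d * (odd e * ((+ 1 - F d) * + d))) ≈⟨ Λ-even (λ d e → odd e * ((+ 1 - F d) * + d)) ⟩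
  dil 2 (Λ (λ d e → odd e * ((+ 1 - F (2 ℕ.* d)) * + (2 ℕ.* d))))
        ≈⟨ dil-cong 2 (Λ-scaled (+ 2) (λ d e → odd e * ((+ 1 - F (2 ℕ.* d)) * + (2 ℕ.* d))) (λ d e → odd e * ((+ 1 - F d) * + d))
        (λ d e → trans (cong₂ (λ f z → odd (suc e) * ((+ 1 - f) * z)) (F-2* (suc d)) (ℤP.pos-* 2 (suc d)))
        (double (odd (suc e)) (F (suc d)) (+ suc d)))) ⟩
  dil 2 (κ (+ 2) · Λ (λ d e → odd e * ((+ 1 - F d) * + d))) ≈⟨ dil-κ· 2 (+ 2) _ ⟩
  κ (+ 2) · dil 2 (Λ (λ d e → odd e * ((+ 1 - F d) * + d))) ≈⟨ ·-cong ≈-refl (dil-cong 2 (≈-trans (Λ-odd′ (λ d → (+ 1 - F d) * + d))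
        (⊕-cong Λ[1-F]d≈σ₃ (⊖-cong (dil-cong 2 Λ[1-F]d≈σ₃))))) ⟩
  κ (+ 2) · dil 2 (σ₃ ⊕ ⊖ dil 2 σ₃) ∎)
  where
  open ≈-Reasoning
  open AllOdd using (u; Y²≈Λu)
  double : ∀ o f d → o * ((+ 1 - f) * (+ 2 * d)) ≡ + 2 * (o * ((+ 1 - f) * d))
  double = solve-∀
  expand : ∀ o v f M → + 2 * (o * v * M - o * v * f * M + + 0 - + 0) ≡ o * (+ 1 - f) * (v * (+ 2 * M))
  expand = solve-∀
  collect : ∀ o v f m → o * (+ 1 - f) * (v * (+ 1 + m)) ≡ v * (o * ((+ 1 - f) * (+ 1 + m)))
  collect = solve-∀
  absorb : ∀ m p → ι (not (not p)) * (m + ι p) ≡ ι (not (not p)) * (+ 1 + m)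
  absorb m true  = cong (+ 1 *_) (ℤP.+-comm m (+ 1))
  absorb m false = refl
  -- If m + 1 is even then m is odd, so the correction in `Σ-odd` completes m to m + 1.
  even-absorb : ∀ m → even (suc m) * (+ m + odd m) ≡ even (suc m) * (+ suc m)
  even-absorb m rewrite par-suc m = absorb (+ m) (par m)
  evaluate : ∀ d m → + 2 * u (suc d) (suc m) ≡ even (suc m) * (odd (suc d) * ((+ 1 - F (suc m)) * + suc m))
  evaluate d m rewrite Σ₁-* m (odd (suc d) * even (suc m)) odd | Σ₁-* m (odd (suc d) * even (suc m) * F (suc m)) odd | Σ₁-zero m =
    trans (expand (odd (suc d)) (even (suc m)) (F (suc m)) (Σ₁ m odd)) (trans
      (cong (λ z → odd (suc d) * (+ 1 - F (suc m)) * z) (trans (cong (even (suc m) *_) (Σ-odd m)) (even-absorb m)))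
      (collect (odd (suc d)) (even (suc m)) (F (suc m)) (+ m)))

-- The second factor of G is the parity of the weight a x + b y, which the changes of variables
-- leave unchanged: for one odd and one even coefficient the weight is odd exactly when the partner
-- of the odd one is. This combines the two values of g into one indicator.
module OddEven where
  g G : Bool → Bool → Bool → Bool → ℤ
  g a b x y = ι a * ι (not b) * ι x
  G a b x y = ι a * ι ((a ∧ x) xor (b ∧ y))

  open Liouville g G
    (from-yes (∀ᵇ? λ a → ∀ᵇ? λ b → ∀ᵇ? λ x → ∀ᵇ? λ y → G (a xor b) b x y ℤP.≟ g a b x (y xor x) + g b a (y xor x) x))
    (from-yes (∀ᵇ? λ a → ∀ᵇ? λ b → ∀ᵇ? λ x → ∀ᵇ? λ y → G a b x (y xor x) ℤP.≟ g (a xor b) b x y + g b (a xor b) y x))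
    (from-yes (∀ᵇ? λ a → ∀ᵇ? λ b → ∀ᵇ? λ x → ∀ᵇ? λ y → G b (a xor b) y x ℤP.≟ G b a (y xor x) x))
    public using (liouville; gᵖ; Gᵖ)

  u₁ u₂ u₃ u₄ u : ℕ → ℕ → ℤ
  u₁ d e = Σ₁ (ℕ.pred e) (λ l → + 0)
  u₂ d e = Σ₁ (ℕ.pred e) (λ l → odd d * odd e * F e * odd l)
  u₃ d e = Σ₁ (ℕ.pred e) (λ l → odd d * odd e * F d)
  u₄ d e = Σ₁ (ℕ.pred e) (λ l → odd d * odd e * (odd l * F l))
  u d e = u₁ d e - u₂ d e + u₃ d e - u₄ d e

  YΛ≈Λu : Yᴸ · Λ (λ d e → even d * χ d) ≈ Λ u
  YΛ≈Λu = begin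
    Yᴸ · Λ (λ d e → even d * χ d) ≈⟨ Λ-⊛ (λ d e → odd e * (odd d * χ d)) (λ d e → even d * χ d) ⟩
    ⟪ (λ a b x y → odd x * (odd a * χ a) * (even b * χ b)) ⟫ ≈⟨ ⟦⟧-cong quads (λ ((a , x) , (b , y)) →
        arrange (odd (suc a)) (even (suc b)) (odd (suc x)) (χ (suc a)) (χ (suc b))) ⟩
    ⟪ (λ a b x y → gᵖ a b x y * (χ a * χ b)) ⟫ ≈⟨ liouville ⟩
    _ ≈⟨ ⊕-cong (⊕-cong (⊕-cong
        (D-Λ (λ a x y → gᵖ a a x y) (λ d l e → + 0) e₁)
        (⊖-cong (D-Λ (λ a x y → gᵖ x y a a * F (x ℕ.+ y)) (λ d l e → odd d * odd e * F e * odd l) e₂)))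
        (D-Λ (λ a x y → Gᵖ a a x y * F a) (λ d l e → odd d * odd e * F d) e₃))
        (⊖-cong (D-Λ (λ a x y → Gᵖ x y a a * F x) (λ d l e → odd d * odd e * (odd l * F l)) e₄)) ⟩
    Λ u₁ ⊕ ⊖ Λ u₂ ⊕ Λ u₃ ⊕ ⊖ Λ u₄ ≈⟨ 4-terms u₁ u₂ u₃ u₄ ⟩
    Λ u ∎
    where
    open ≈-Reasoning
    arrange : ∀ a b x c d → x * (a * c) * (b * d) ≡ a * b * x * (c * d)
    arrange = solve-∀
    reorder : ∀ a b c d → a * b * c * d ≡ a * b * d * c
    reorder = solve-∀
    e₁ : ∀ a x y → gᵖ a a x y ≡ + 0
    e₁ a x y = from-yes (∀ᵇ? λ a → ∀ᵇ? λ x → ∀ᵇ? λ y → g a a x y ℤP.≟ + 0) (par a) (par x) (par y)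
    e₂ : ∀ a x y → gᵖ x y a a * F (x ℕ.+ y) ≡ odd a * odd (x ℕ.+ y) * F (x ℕ.+ y) * odd x
    e₂ a x y rewrite par-+ x y = trans
      (cong (_* F (x ℕ.+ y)) (from-yes (∀ᵇ? λ a → ∀ᵇ? λ x → ∀ᵇ? λ y → g x y a a ℤP.≟ ι a * ι (x xor y) * ι x) (par a) (par x) (par y)))
      (reorder (odd a) (ι (par x xor par y)) (odd x) (F (x ℕ.+ y)))
    e₃ : ∀ a x y → Gᵖ a a x y * F a ≡ odd a * odd (x ℕ.+ y) * F a
    e₃ a x y rewrite par-+ x y =
      cong (_* F a) (from-yes (∀ᵇ? λ a → ∀ᵇ? λ x → ∀ᵇ? λ y → G a a x y ℤP.≟ ι a * ι (x xor y)) (par a) (par x) (par y))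
    e₄ : ∀ a x y → Gᵖ x y a a * F x ≡ odd a * odd (x ℕ.+ y) * (odd x * F x)
    e₄ a x y rewrite par-+ x y = trans
      (cong (_* F x) (from-yes (∀ᵇ? λ a → ∀ᵇ? λ x → ∀ᵇ? λ y → G x y a a ℤP.≟ ι a * ι (x xor y) * ι x) (par a) (par x) (par y)))
      (ℤP.*-assoc (odd a * ι (par x xor par y)) (odd x) (F x))

-- The terms of σS with n odd.
σᵒ : Series
σᵒ = Λ (λ d e → odd e * (odd d * + d))

-- With V the substitution of q² for q, odd d amounts to 1 - 2V and odd e to 1 - V; the product is 1
-- - 3V + 2V².
σᵒ≈ : σᵒ ≈ σS ⊕ ⊖ (κ (+ 3) · dil 2 σS) ⊕ κ (+ 2) · dil 4 σS
σᵒ≈ = begin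
  σᵒ ≈⟨ Λ-odd′ (λ d → odd d * + d) ⟩
  B ⊕ ⊖ dil 2 B ≈⟨ ⊕-cong B≈ (⊖-cong (≈-trans (dil-cong 2 B≈) (dil-⊕ 2 σS _))) ⟩
  σS ⊕ κ (- + 2) · dil 2 σS ⊕ ⊖ (dil 2 σS ⊕ dil 2 (κ (- + 2) · dil 2 σS))
        ≈⟨ ⊕-cong ≈-refl (⊖-cong (⊕-cong ≈-refl (≈-trans (dil-κ· 2 (- + 2) (dil 2 σS)) (·-cong ≈-refl (dil-dil 2 2 σS))))) ⟩
  σS ⊕ κ (- + 2) · dil 2 σS ⊕ ⊖ (dil 2 σS ⊕ κ (- + 2) · dil 4 σS)
        ≈⟨ solve 3 (λ x y z → x :+ con (- + 2) :* y :+ :- (y :+ con (- + 2) :* z) := x :+ :- (con (+ 3) :* y) :+ con (+ 2) :* z) ≈-refl σS (dil 2 σS) (dil 4 σS) ⟩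
  σS ⊕ ⊖ (κ (+ 3) · dil 2 σS) ⊕ κ (+ 2) · dil 4 σS ∎
  where
  open ≈-Reasoning
  B = Λ (λ d e → odd d * + d)
  B≈ : B ≈ σS ⊕ κ (- + 2) · dil 2 σS
  B≈ = begin
    B ≈⟨ Λ-odd (λ d e → + d) ⟩
    σS ⊕ ⊖ dil 2 (Λ (λ d e → + (2 ℕ.* d))) ≈⟨ ⊕-cong ≈-refl (⊖-cong (≈-trans (dil-cong 2 (Λ-scaled (+ 2) (λ d e → + (2 ℕ.* d)) (λ d e → + d) (λ d e → ℤP.pos-* 2 (suc d)))) (dil-κ· 2 (+ 2) σS))) ⟩
    σS ⊕ ⊖ (κ (+ 2) · dil 2 σS) ≈⟨ solve 2 (λ x y → x :+ :- (con (+ 2) :* y) := x :+ con (- + 2) :* y) ≈-refl σS (dil 2 σS) ⟩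
    σS ⊕ κ (- + 2) · dil 2 σS ∎

Λ-even-χ : Λ (λ d e → even d * χ d) ≈ ⊖ dil 2 L
Λ-even-χ = ≈-trans (Λ-even (λ d e → χ d)) dil-χ

-- Since χ(2) = -1, the series L(q²) is minus the part of `L` with even d, so `OddEven` evaluates
-- the product with `Yᴸ`. The term `Yᴸ` due to the constant 1 of `A` cancels against the χ(e) in the
-- evaluated inner sum.
YA₂ : Yᴸ · dil 2 A ≈ σᵒ ⊕ κ (+ 3) · dil 3 σᵒ
YA₂ = begin
  Yᴸ · dil 2 A ≈⟨ ·-cong ≈-refl dil-A ⟩
  Yᴸ · (oneS ⊕ κ (+ 6) · dil 2 L) ≈⟨ solve 3 (λ y i l → y :* (i :+ con (+ 6) :* l) := i :* y :+ :- (con (+ 6) :* (y :* :- l))) ≈-refl Yᴸ oneS (dil 2 L) ⟩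
  oneS · Yᴸ ⊕ ⊖ (κ (+ 6) · (Yᴸ · ⊖ dil 2 L)) ≈⟨ ⊕-cong (·-identityˡ Yᴸ) (⊖-cong (·-cong ≈-refl (≈-trans (·-cong ≈-refl (≈-sym Λ-even-χ)) YΛ≈Λu))) ⟩
  Yᴸ ⊕ ⊖ (κ (+ 6) · Λ u) ≈⟨ ⊕-cong ≈-refl (⊖-cong (≈-trans (≈-sym (Λ-* (+ 6) u)) (Λ-combination combination (λ d e → + 6 * u d e) evaluate))) ⟩
  Yᴸ ⊕ ⊖ termwise combination ≈⟨ ⊕-cong ≈-refl (⊖-cong (⊕-cong (·-cong ≈-refl t₁) (⊕-cong (·-cong ≈-refl t₂) (⊕-cong ≈-refl
        (⊕-cong (·-cong ≈-refl t₄) (⊕-cong (·-cong ≈-refl t₅) (≈-trans (⊕-zeroʳ _) (·-cong ≈-refl t₆)))))))) ⟩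
  Yᴸ ⊕ ⊖ (κ (- + 3) · (κ (+ 3) · dil 3 σᵒ) ⊕ (κ (+ 6) · dil 3 σᵒ ⊕ (κ (- + 6) · f ⊕ (κ (- + 1) · σᵒ ⊕ (κ (+ 1) · Yᴸ ⊕ κ (+ 6) · f)))))
        ≈⟨ solve 4 (λ y z f x → y :+ :- (con (- + 3) :* (con (+ 3) :* z) :+ (con (+ 6) :* z :+ (con (- + 6) :* f :+ (con (- + 1) :* x :+ (con (+ 1) :* y :+ con (+ 6) :* f)))))
        := x :+ con (+ 3) :* z) ≈-refl Yᴸ (dil 3 σᵒ) f σᵒ ⟩
  σᵒ ⊕ κ (+ 3) · dil 3 σᵒ ∎
  where
  open ≈-Reasoning
  open OddEven using (u; YΛ≈Λu)
  dil-A : dil 2 A ≈ oneS ⊕ κ (+ 6) · dil 2 L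
  dil-A = ≈-trans (dil-⊕ 2 oneS (κ (+ 6) · L)) (⊕-cong (≈-trans (dil-cong 2 (≈-sym κ-1)) (≈-trans (dil-κ 2 (+ 1)) κ-1)) (dil-κ· 2 (+ 6) L))
  f = Λ (λ d e → F d * (odd d * odd e))
  combination : Combination
  combination = (- + 3 , λ d e → F e * (odd d * (odd e * + e))) ∷ (+ 6 , λ d e → F d * (odd d * (odd e * + e))) ∷ (- + 6 , λ d e → F d * (odd d * odd e))
    ∷ (- + 1 , λ d e → odd d * (odd e * + e)) ∷ (+ 1 , λ d e → odd d * (odd e * χ e)) ∷ (+ 6 , λ d e → F e * (odd d * odd e)) ∷ []
  t₁ : Λ (λ d e → F e * (odd d * (odd e * + e))) ≈ κ (+ 3) · dil 3 σᵒ
  t₁ = begin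
    Λ (λ d e → F e * (odd d * (odd e * + e))) ≈⟨ Λ-swap (λ d e → F e * (odd d * (odd e * + e))) ⟩
    Λ (λ d e → F d * (odd e * (odd d * + d))) ≈⟨ Λ-F (λ d e → odd e * (odd d * + d)) ⟩
    dil 3 (Λ (λ d e → odd e * (odd (3 ℕ.* d) * + (3 ℕ.* d)))) ≈⟨ dil-cong 3 (Λ-scaled (+ 3) (λ d e → odd e * (odd (3 ℕ.* d) * + (3 ℕ.* d))) (λ d e → odd e * (odd d * + d))
        (λ d e → trans (cong₂ (λ p z → odd (suc e) * (ι p * z)) (par-3* (suc d)) (ℤP.pos-* 3 (suc d))) (triple (odd (suc e)) (odd (suc d)) (+ suc d)))) ⟩
    dil 3 (κ (+ 3) · σᵒ) ≈⟨ dil-κ· 3 (+ 3) σᵒ ⟩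
    κ (+ 3) · dil 3 σᵒ ∎
    where
    triple : ∀ o p d → o * (p * (+ 3 * d)) ≡ + 3 * (o * (p * d))
    triple = solve-∀
  t₂ : Λ (λ d e → F d * (odd d * (odd e * + e))) ≈ dil 3 σᵒ
  t₂ = ≈-trans (Λ-F (λ d e → odd d * (odd e * + e))) (dil-cong 3 (≈-trans
    (Λ-cong (λ d e → odd (3 ℕ.* d) * (odd e * + e)) (λ d e → odd d * (odd e * + e)) (λ d e → cong (λ p → ι p * (odd (suc e) * + suc e)) (par-3* (suc d))))
    (Λ-swap (λ d e → odd d * (odd e * + e)))))
  t₄ : Λ (λ d e → odd d * (odd e * + e)) ≈ σᵒ
  t₄ = Λ-swap (λ d e → odd d * (odd e * + e))
  t₅ : Λ (λ d e → odd d * (odd e * χ e)) ≈ Yᴸ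
  t₅ = Λ-swap (λ d e → odd d * (odd e * χ e))
  t₆ : Λ (λ d e → F e * (odd d * odd e)) ≈ f
  t₆ = ≈-trans (Λ-swap (λ d e → F e * (odd d * odd e)))
    (Λ-cong (λ d e → F d * (odd e * odd d)) (λ d e → F d * (odd d * odd e)) (λ d e → cong (F (suc d) *_) (ℤP.*-comm (odd (suc e)) (odd (suc d)))))
  expand : ∀ o p fe fd m O M → + 6 * (+ 0 - o * p * fe * O + m * (o * p * fd) - o * p * M) ≡
    - + 3 * fe * o * (p * (+ 2 * O)) + + 6 * m * (o * p * fd) - o * (p * (+ 6 * M))
  expand = solve-∀
  collect : ∀ o p fe fd m c → - + 3 * fe * o * (p * m) + + 6 * m * (o * p * fd) - o * (p * (+ 1 + m) + p * - (c + + 3 * fe)) ≡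
    - + 3 * (fe * (o * (p * (+ 1 + m)))) + (+ 6 * (fd * (o * (p * (+ 1 + m)))) + (- + 6 * (fd * (o * p))
      + (- + 1 * (o * (p * (+ 1 + m))) + (+ 1 * (o * (p * c)) + (+ 6 * (fe * (o * p)) + + 0)))))
  collect = solve-∀
  vanish : ∀ m p → ι (not p) * (m + ι p) ≡ ι (not p) * m
  vanish m true  = refl
  vanish m false = cong (+ 1 *_) (ℤP.+-identityʳ m)
  -- If m + 1 is odd then m is even and the correction in `Σ-odd` disappears.
  odd-vanish : ∀ m → odd (suc m) * (+ m + odd m) ≡ odd (suc m) * + m
  odd-vanish m rewrite par-suc m = vanish (+ m) (par m)
  evaluate : ∀ d m → + 6 * u (suc d) (suc m) ≡ pointwise combination (suc d) (suc m)
  evaluate d m rewrite Σ₁-zero m | Σ₁-* m (odd (suc d) * odd (suc m) * F (suc m)) odd | Σ₁-const m (odd (suc d) * odd (suc m) * F (suc d))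
        | Σ₁-* m (odd (suc d) * odd (suc m)) (λ l → odd l * F l) =
    trans (expand (odd (suc d)) (odd (suc m)) (F (suc m)) (F (suc d)) (+ m) (Σ₁ m odd) (Σ₁ m (λ l → odd l * F l)))
    (trans (cong₂ (λ y z → - + 3 * F (suc m) * odd (suc d) * y + + 6 * + m * (odd (suc d) * odd (suc m) * F (suc d)) - odd (suc d) * z)
      (trans (cong (odd (suc m) *_) (Σ-odd m)) (odd-vanish m))
      (trans (cong (odd (suc m) *_) (Σ-oddF m)) (trans (ℤP.*-distribˡ-+ (odd (suc m)) (+ suc m) (ε (suc m))) (+-congʳ (odd (suc m) * + suc m) (odd-ε (suc m))))))
    (collect (odd (suc d)) (odd (suc m)) (F (suc m)) (F (suc d)) (+ m) (χ (suc m))))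

-- The two relations for the Lambert series

dil-oneS : ∀ k .{{_ : NonZero k}} → dil k oneS ≈ oneS
dil-oneS k = ≈-trans (dil-cong k (≈-sym κ-1)) (≈-trans (dil-κ k (+ 1)) κ-1)

dil-κ·-cong : ∀ k .{{_ : NonZero k}} c {f g} → dil k f ≈ g → dil k (κ c · f) ≈ κ c · g
dil-κ·-cong k c {f} p = ≈-trans (dil-κ· k c f) (·-cong ≈-refl p)

dil-⊖ : ∀ k .{{_ : NonZero k}} f → dil k (⊖ f) ≈ ⊖ dil k f
dil-⊖ k f = begin
  dil k (⊖ f) ≈⟨ dil-cong k (solve 1 (λ f → :- f := con (- + 1) :* f) ≈-refl f) ⟩
  dil k (κ (- + 1) · f) ≈⟨ dil-κ· k (- + 1) f ⟩
  κ (- + 1) · dil k f ≈⟨ solve 1 (λ f → con (- + 1) :* f := :- f) ≈-refl (dil k f) ⟩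
  ⊖ dil k f ∎
  where open ≈-Reasoning

dil-⊕-cong : ∀ k .{{_ : NonZero k}} {f f′ g g′} → dil k f ≈ f′ → dil k g ≈ g′ → dil k (f ⊕ g) ≈ f′ ⊕ g′
dil-⊕-cong k {f} {g = g} p q = ≈-trans (dil-⊕ k f g) (⊕-cong p q)

dil-⊖-cong : ∀ k .{{_ : NonZero k}} {f g} → dil k f ≈ g → dil k (⊖ f) ≈ ⊖ g
dil-⊖-cong k {f} p = ≈-trans (dil-⊖ k f) (⊖-cong p)

A≈A₄+6Y : A ≈ dil 4 A ⊕ κ (+ 6) · Yᴸ
A≈A₄+6Y = begin
  oneS ⊕ κ (+ 6) · L ≈⟨ ⊕-cong ≈-refl (·-cong ≈-refl L≈L₄+Y) ⟩
  oneS ⊕ κ (+ 6) · (dil 4 L ⊕ Yᴸ) ≈⟨ solve 3 (λ i l y → i :+ con (+ 6) :* (l :+ y) := i :+ con (+ 6) :* l :+ con (+ 6) :* y) ≈-refl oneS (dil 4 L) Yᴸ ⟩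
  oneS ⊕ κ (+ 6) · dil 4 L ⊕ κ (+ 6) · Yᴸ ≈⟨ ⊕-cong (⊕-cong (dil-oneS 4) (dil-κ· 4 (+ 6) L)) ≈-refl ⟨
  dil 4 oneS ⊕ dil 4 (κ (+ 6) · L) ⊕ κ (+ 6) · Yᴸ ≈⟨ ⊕-cong (dil-⊕ 4 oneS (κ (+ 6) · L)) ≈-refl ⟨
  dil 4 A ⊕ κ (+ 6) · Yᴸ ∎
  where open ≈-Reasoning

-- By `A²`, the squares at q² and q⁴ differ by 12 (σ₃(q²) - σ₃(q⁴)), and `Y²` recognises this as 12
-- times a square.
conicᴬ : dil 2 (A · A) ≈ dil 4 A · dil 4 A ⊕ κ (+ 12) · (Yᴸ · Yᴸ)
conicᴬ = begin
  dil 2 (A · A) ≈⟨ expand 2 ⟩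
  oneS ⊕ κ (+ 12) · dil 2 σ₃ ≈⟨ solve 3 (λ i x y → i :+ con (+ 12) :* x := i :+ con (+ 12) :* y :+ con (+ 12) :* (x :+ :- y)) ≈-refl oneS (dil 2 σ₃) (dil 4 σ₃) ⟩
  oneS ⊕ κ (+ 12) · dil 4 σ₃ ⊕ κ (+ 12) · (dil 2 σ₃ ⊕ ⊖ dil 4 σ₃) ≈⟨ ⊕-cong (≈-trans (≈-sym (dil-· 4 A A)) (expand 4)) (·-cong ≈-refl Y²′) ⟨
  dil 4 A · dil 4 A ⊕ κ (+ 12) · (Yᴸ · Yᴸ) ∎
  where
  open ≈-Reasoning
  expand : ∀ k .{{_ : NonZero k}} → dil k (A · A) ≈ oneS ⊕ κ (+ 12) · dil k σ₃
  expand k = ≈-trans (dil-cong k A²) (≈-trans (dil-⊕ k oneS (κ (+ 12) · σ₃)) (⊕-cong (dil-oneS k) (dil-κ· k (+ 12) σ₃)))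
  Y²′ : Yᴸ · Yᴸ ≈ dil 2 σ₃ ⊕ ⊖ dil 4 σ₃
  Y²′ = ≈-trans Y² (≈-trans (dil-⊕ 2 σ₃ (⊖ dil 2 σ₃)) (⊕-cong ≈-refl (≈-trans (dil-⊖ 2 (dil 2 σ₃)) (⊖-cong (dil-dil 2 2 σ₃)))))

-- Uniqueness of the theta series

VanishesBelow : ℕ → Series → Set
VanishesBelow k f = ∀ i → i < k → f i ≡ + 0

sumTo-zero : ∀ n {h : ℕ → ℤ} → (∀ i → i ≤ n → h i ≡ + 0) → sumTo n h ≡ + 0
sumTo-zero zero    eq = eq 0 z≤n
sumTo-zero (suc n) eq = cong₂ _+_ (sumTo-zero n (λ i i≤n → eq i (ℕP.m≤n⇒m≤1+n i≤n))) (eq (suc n) ℕP.≤-refl)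

·-vanishes : ∀ {k f} g → VanishesBelow k f → VanishesBelow k (f · g)
·-vanishes g f≡0 n n<k = trans (at ·≈⊛ n)
  (sumTo-zero n λ i i≤n → trans (cong (_* g (n ℕ.∸ i)) (f≡0 i (ℕP.≤-<-trans i≤n n<k))) (ℤP.*-zeroˡ (g (n ℕ.∸ i))))

dil-vanishes : ∀ c .{{_ : NonZero c}} {k f} → VanishesBelow k f → VanishesBelow (c ℕ.* k) (dil c f)
dil-vanishes c {k} {f} f≡0 = dil-elim c (λ n → n < c ℕ.* k → dil c f n ≡ + 0)
  (λ m lt → trans (dil-multiple c f m) (f≡0 m (ℕP.*-cancelˡ-< c m k lt)))
  (λ n c∤n _ → dil-nonmultiple c f n c∤n)

·-leading : ∀ {k f g} → VanishesBelow k f → g 0 ≡ + 0 → (f · g) (suc k) ≡ f k * g 1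
·-leading {k} {f} {g} f≡0 g₀ = trans (at ·≈⊛ (suc k)) (trans (cong₂ _+_ (below k f≡0) last) (ℤP.+-identityʳ _))
  where
  last : f (suc k) * g (k ℕ.∸ k) ≡ + 0
  last = trans (cong (λ i → f (suc k) * g i) (ℕP.n∸n≡0 k)) (trans (cong (f (suc k) *_) g₀) (ℤP.*-zeroʳ (f (suc k))))
  below : ∀ k → VanishesBelow k f → sumTo k (λ i → f i * g (suc k ℕ.∸ i)) ≡ f k * g 1
  below zero    _   = refl
  below (suc j) f≡0 = trans (cong₂ _+_
    (sumTo-zero j (λ i i≤j → trans (cong (_* g (suc (suc j) ℕ.∸ i)) (f≡0 i (s≤s i≤j))) (ℤP.*-zeroˡ (g (suc (suc j) ℕ.∸ i)))))
    (cong (λ i → f (suc j) * g i) (trans (ℕP.+-∸-assoc 1 (ℕP.≤-refl {j})) (cong suc (ℕP.n∸n≡0 j)))))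
    (ℤP.+-identityˡ _)

vanishes⇒≈ : ∀ {f g} → (∀ k → VanishesBelow k (f ⊕ ⊖ g) → (f ⊕ ⊖ g) k ≡ + 0) → f ≈ g
vanishes⇒≈ {f} {g} step = ext λ n → ℤP.i-j≡0⇒i≡j (f n) (g n)
  (trans (sym (trans (⊕-at n) (+-congʳ (f n) (⊖-at n)))) (all (suc n) n ℕP.≤-refl))
  where
  all : ∀ k → VanishesBelow k (f ⊕ ⊖ g)
  all (suc k) i i<1+k with i ℕ.≟ k
  ... | yes refl = step k (all k)
  ... | no  i≢k  = all k i (ℕP.≤∧≢⇒< (ℕ.s≤s⁻¹ i<1+k) i≢k)

-- Both f(0) and f(1) are prescribed because the induction only starts at order 2; `dissect` then
-- gives y(0) = 0 and y(1) = 1, so y is nonzero of order exactly 1.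
record HexagonalLike (f y : Series) : Set where
  field
    f₀        : f 0 ≡ + 1
    f₁        : f 1 ≡ + 6
    dissect   : f ≈ dil 4 f ⊕ κ (+ 6) · y
    quadratic : dil 2 (f · f) ≈ dil 4 f · dil 4 f ⊕ κ (+ 12) · (y · y)

  at-dissect : ∀ n → f n ≡ dil 4 f n + + 6 * y n
  at-dissect n = trans (at dissect n) (trans (⊕-at n) (+-congʳ (dil 4 f n) (κ-· (+ 6) y n)))

  y₀ : y 0 ≡ + 0
  y₀ = ℤP.*-cancelˡ-≡ (+ 6) (y 0) (+ 0) (begin
    + 6 * y 0 ≡⟨ cancel (f 0) (+ 6 * y 0) ⟩
    f 0 + + 6 * y 0 - f 0 ≡⟨ cong (λ z → z + + 6 * y 0 - f 0) (dil-multiple 4 f 0) ⟨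
    dil 4 f 0 + + 6 * y 0 - f 0 ≡⟨ cong (_- f 0) (at-dissect 0) ⟨
    f 0 - f 0 ≡⟨ ℤP.+-inverseʳ (f 0) ⟩
    + 0 ∎)
    where
    open ≡-Reasoning
    cancel : ∀ a b → b ≡ a + b - a
    cancel = solve-∀

  y₁ : y 1 ≡ + 1
  y₁ = ℤP.*-cancelˡ-≡ (+ 6) (y 1) (+ 1) (begin
    + 6 * y 1 ≡⟨ ℤP.+-identityˡ _ ⟨
    + 0 + + 6 * y 1 ≡⟨ cong (_+ + 6 * y 1) (dil-at 4 f 1) ⟨
    dil 4 f 1 + + 6 * y 1 ≡⟨ at-dissect 1 ⟨
    f 1 ≡⟨ f₁ ⟩
    + 6 ∎)
    where open ≡-Reasoning

-- If D and E are the differences of two solutions and D has order k ≥ 2, then the coefficient of q^{k+1} in the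
-- difference of the quadratic relations is 12 · 2 · E_k, while D_k = 6 E_k.
hexagonalLike-unique : ∀ {f y f′ y′} → HexagonalLike f y → HexagonalLike f′ y′ → f ≈ f′
hexagonalLike-unique {f} {y} {f′} {y′} s₁ s₂ = vanishes⇒≈ step
  where
  open ≈-Reasoning
  module S₁ = HexagonalLike s₁
  module S₂ = HexagonalLike s₂
  D E : Series
  D = f ⊕ ⊖ f′
  E = y ⊕ ⊖ y′
  minus : ∀ g h n → (g ⊕ ⊖ h) n ≡ g n - h n
  minus g h n = trans (⊕-at n) (+-congʳ (g n) (⊖-at n))
  linear : D ≈ dil 4 D ⊕ κ (+ 6) · E
  linear = begin
    f ⊕ ⊖ f′ ≈⟨ ⊕-cong S₁.dissect (⊖-cong S₂.dissect) ⟩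
    dil 4 f ⊕ κ (+ 6) · y ⊕ ⊖ (dil 4 f′ ⊕ κ (+ 6) · y′) ≈⟨ solve 4 (λ f y f′ y′ → f :+ con (+ 6) :* y :+ :- (f′ :+ con (+ 6) :* y′) := f :+ :- f′ :+ con (+ 6) :* (y :+ :- y′)) ≈-refl (dil 4 f) y (dil 4 f′) y′ ⟩
    dil 4 f ⊕ ⊖ dil 4 f′ ⊕ κ (+ 6) · E ≈⟨ ⊕-cong (≈-trans (dil-⊕ 4 f (⊖ f′)) (⊕-cong ≈-refl (dil-⊖ 4 f′))) ≈-refl ⟨
    dil 4 D ⊕ κ (+ 6) · E ∎
  difference : dil 2 (D · (f ⊕ f′)) ≈ dil 4 D · (dil 4 f ⊕ dil 4 f′) ⊕ κ (+ 12) · (E · (y ⊕ y′))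
  difference = begin
    dil 2 (D · (f ⊕ f′)) ≈⟨ dil-cong 2 (solve 2 (λ f g → (f :+ :- g) :* (f :+ g) := f :* f :+ :- (g :* g)) ≈-refl f f′) ⟩
    dil 2 (f · f ⊕ ⊖ (f′ · f′)) ≈⟨ ≈-trans (dil-⊕ 2 (f · f) (⊖ (f′ · f′))) (⊕-cong ≈-refl (dil-⊖ 2 (f′ · f′))) ⟩
    dil 2 (f · f) ⊕ ⊖ dil 2 (f′ · f′) ≈⟨ ⊕-cong S₁.quadratic (⊖-cong S₂.quadratic) ⟩
    dil 4 f · dil 4 f ⊕ κ (+ 12) · (y · y) ⊕ ⊖ (dil 4 f′ · dil 4 f′ ⊕ κ (+ 12) · (y′ · y′))
        ≈⟨ solve 4 (λ f y f′ y′ → f :* f :+ con (+ 12) :* (y :* y) :+ :- (f′ :* f′ :+ con (+ 12) :* (y′ :* y′)) :=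
        (f :+ :- f′) :* (f :+ f′) :+ con (+ 12) :* ((y :+ :- y′) :* (y :+ y′))) ≈-refl (dil 4 f) y (dil 4 f′) y′ ⟩
    (dil 4 f ⊕ ⊖ dil 4 f′) · (dil 4 f ⊕ dil 4 f′) ⊕ κ (+ 12) · (E · (y ⊕ y′))
        ≈⟨ ⊕-cong (·-cong (≈-trans (dil-⊕ 4 f (⊖ f′)) (⊕-cong ≈-refl (dil-⊖ 4 f′))) ≈-refl) ≈-refl ⟨
    dil 4 D · (dil 4 f ⊕ dil 4 f′) ⊕ κ (+ 12) · (E · (y ⊕ y′)) ∎
  at-linear : ∀ n → D n ≡ dil 4 D n + + 6 * E n
  at-linear n = trans (at linear n) (trans (⊕-at n) (+-congʳ (dil 4 D n) (κ-· (+ 6) E n)))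
  k<4*k : ∀ k → suc k < 4 ℕ.* suc k
  k<4*k k = ℕP.m<m*n (suc k) 4 (s≤s (s≤s z≤n)) ⟨≡⟩ ℕP.*-comm (suc k) 4
    where
    _⟨≡⟩_ : ∀ {a b c : ℕ} → a < b → b ≡ c → a < c
    p ⟨≡⟩ refl = p
  dil-D≡0 : ∀ {k} → VanishesBelow k D → ∀ i → i ≤ k → 0 < k → dil 4 D i ≡ + 0
  dil-D≡0 {suc k} D≡0 i i≤k _ = dil-vanishes 4 {suc k} {D} D≡0 i (ℕP.≤-<-trans i≤k (k<4*k k))
  E-vanishes : ∀ {k} → 0 < k → VanishesBelow k D → VanishesBelow k E
  E-vanishes 0<k D≡0 i i<k = ℤP.*-cancelˡ-≡ (+ 6) (E i) (+ 0)
    (trans (sym (ℤP.+-identityˡ _)) (trans (cong (_+ + 6 * E i) (sym (dil-D≡0 D≡0 i (ℕP.<⇒≤ i<k) 0<k))) (trans (sym (at-linear i)) (D≡0 i i<k))))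
  z₀ : (y ⊕ y′) 0 ≡ + 0
  z₀ = trans (⊕-at 0) (cong₂ _+_ S₁.y₀ S₂.y₀)
  z₁ : (y ⊕ y′) 1 ≡ + 2
  z₁ = trans (⊕-at 1) (cong₂ _+_ S₁.y₁ S₂.y₁)
  E-leading : ∀ k → VanishesBelow (suc (suc k)) D → E (suc (suc k)) ≡ + 0
  E-leading k D≡0 = ℤP.*-cancelʳ-≡ (E n) (+ 0) (+ 2) (ℤP.*-cancelˡ-≡ (+ 12) (E n * + 2) (+ 0) (≡.begin
    + 12 * (E n * + 2) ≡.≡⟨ cong (λ z → + 12 * (E n * z)) z₁ ⟨
    + 12 * (E n * (y ⊕ y′) 1) ≡.≡⟨ cong (+ 12 *_) (·-leading (E-vanishes (s≤s z≤n) D≡0) z₀) ⟨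
    + 12 * (E · (y ⊕ y′)) (suc n) ≡.≡⟨ ℤP.+-identityˡ _ ⟨
    + 0 + + 12 * (E · (y ⊕ y′)) (suc n) ≡.≡⟨ cong₂ _+_ (·-vanishes (dil 4 f ⊕ dil 4 f′) (dil-vanishes 4 {n} {D} D≡0) (suc n) n<4n) (κ-· (+ 12) (E · (y ⊕ y′)) (suc n)) ⟨
    (dil 4 D · (dil 4 f ⊕ dil 4 f′)) (suc n) + (κ (+ 12) · (E · (y ⊕ y′))) (suc n) ≡.≡⟨ trans (at difference (suc n)) (⊕-at (suc n)) ⟨
    dil 2 (D · (f ⊕ f′)) (suc n) ≡.≡⟨ dil-vanishes 2 (·-vanishes (f ⊕ f′) D≡0) (suc n) n<2n ⟩
    + 0 ≡.∎))
    where
    module ≡ = ≡-Reasoning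
    n = suc (suc k)
    -- Here n ≥ 2 is essential: for n = 1 the coefficient n + 1 would already meet the leading term
    -- of the left-hand side at q².
    n<2n : suc n < 2 ℕ.* n
    n<2n = s≤s (s≤s (subst (suc k <_) (sym (ℕP.+-suc k (suc (k ℕ.+ 0)))) (s≤s (subst (k <_) (sym (ℕP.+-suc k (k ℕ.+ 0))) (s≤s (ℕP.m≤m+n k _))))))
    n<4n : suc n < 4 ℕ.* n
    n<4n = ℕP.<-≤-trans n<2n (ℕP.*-monoˡ-≤ n {2} {4} (s≤s (s≤s z≤n)))
  step : ∀ k → VanishesBelow k D → D k ≡ + 0
  step 0 _ = trans (minus f f′ 0) (cong₂ _-_ S₁.f₀ S₂.f₀)
  step 1 _ = trans (minus f f′ 1) (cong₂ _-_ S₁.f₁ S₂.f₁)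
  step (suc (suc k)) D≡0 = trans (at-linear n) (cong₂ (λ u v → u + + 6 * v) (dil-D≡0 D≡0 n ℕP.≤-refl (s≤s z≤n)) (E-leading k D≡0))
    where n = suc (suc k)

a≈A : a ≈ A
a≈A = hexagonalLike-unique {y = Y} {y′ = Yᴸ}
  (record
    -- The numbers 1 and 6 of lattice points of norm 0 and 1 are obtained by evaluating the finite
    -- fibres.
    { f₀ = refl ; f₁ = refl
    ; dissect = ≈-trans a≈a₄+3H (⊕-cong ≈-refl (≈-trans (·-cong ≈-refl H≈2Y) (solve 1 (λ y → con (+ 3) :* (con (+ 2) :* y) := con (+ 6) :* y) ≈-refl Y)))
    ; quadratic = ≈-trans conic (⊕-cong ≈-refl (≈-trans (·-cong ≈-refl (·-cong H≈2Y H≈2Y))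
        (solve 1 (λ y → con (+ 3) :* ((con (+ 2) :* y) :* (con (+ 2) :* y)) := con (+ 12) :* (y :* y)) ≈-refl Y))) })
  (record
    { f₀ = trans (⊕-at 0) (+-congʳ (+ 1) (κ-· (+ 6) L 0)) ; f₁ = trans (⊕-at 1) (+-congʳ (+ 0) (κ-· (+ 6) L 1))
    ; dissect = A≈A₄+6Y ; quadratic = conicᴬ })

-- Monomials, geometric series and truncated identities

opaque
  unfolding mono

  mono-+ : ∀ k l → mono (k ℕ.+ l) ≈ mono k · mono l
  mono-+ k l = ≈-trans
    (⟦⟧-bij (point (k ℕ.+ l)) (point k ⊗ point l)
      (record { to = λ _ → tt , tt ; from = λ _ → tt ; from-to = λ _ → refl ; to-from = λ _ → refl }) (λ _ → refl) (λ _ → refl))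
    (⟦⊗⟧ (point k) (point l) one one)

  mono-refl : ∀ k → mono k k ≡ + 1
  mono-refl k = ⟦⟧-list (point k) one k {tt ∷ []} ([] ∷ []) (λ _ → refl) (λ _ _ → here refl)

  mono-≢ : ∀ {k n} → ¬ (k ≡ n) → mono k n ≡ + 0
  mono-≢ {k} {n} k≢n = ⟦⟧-list (point k) one n {[]} [] (λ ()) (λ _ eq → ⊥-elim (k≢n eq))

  mono-0 : mono 0 ≈ κ (+ 1)
  mono-0 = ≈-sym (κ≈⟦⟧ (+ 1))

mono-vanishes : ∀ k → VanishesBelow k (mono k)
mono-vanishes k i i<k = mono-≢ (λ { refl → ℕP.<-irrefl refl i<k })

mono-1-suc : ∀ f n → (mono 1 · f) (suc n) ≡ f n
mono-1-suc f n = begin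
  (mono 1 · f) (suc n) ≡⟨ at (·-cong ≈-refl (≈-sym (⟦nat⟧ f))) (suc n) ⟩
  (mono 1 · ⟦ nat ⟧ f) (suc n) ≡⟨ at (≈-trans (⟦⊗⟧ (point 1) nat one f) (·-cong (⟦point⟧ 1) ≈-refl)) (suc n) ⟨
  ⟦ point 1 ⊗ nat ⟧ (λ p → + 1 * f (proj₂ p)) (suc n) ≡⟨ ⟦⟧-list (point 1 ⊗ nat) _ (suc n) {(tt , n) ∷ []} ([] ∷ [])
        (λ { (here refl) → refl }) (λ { (tt , m) refl → here refl }) ⟩
  + 1 * f n + + 0 ≡⟨ trans (ℤP.+-identityʳ _) (ℤP.*-identityˡ (f n)) ⟩
  f n ∎
  where open ≡-Reasoning

dil-mono : ∀ c .{{_ : NonZero c}} k → dil c (mono k) ≈ mono (c ℕ.* k)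
dil-mono c k = ≈-trans (dil-cong c (≈-sym (⟦point⟧ k))) (≈-trans (≈-sym (⟦scale⟧ c (point k) one))
  (≈-trans (⟦⟧-reweigh (scale c (point k)) (point (c ℕ.* k)) (λ _ → refl) (λ _ → refl)) (⟦point⟧ (c ℕ.* k))))

1-q^ 1+q^ : ℕ → Series
1-q^ k = κ (+ 1) ⊕ ⊖ mono k
1+q^ k = κ (+ 1) ⊕ mono k

oneMinus≈ : ∀ k → oneMinus (suc k) ≈ 1-q^ (suc k)
oneMinus≈ k = ext λ n → sym (trans (⊕-at n) (trans (+-congʳ (κ (+ 1) n) (⊖-at n)) (lemma n)))
  where
  lemma : ∀ n → κ (+ 1) n - mono (suc k) n ≡ oneMinus (suc k) n
  lemma zero = cong₂ _-_ (κ-zero (+ 1)) (mono-≢ {suc k} {0} (λ ()))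
  lemma (suc n) with n ℕ.≟ k
  ... | yes refl = trans (cong₂ _-_ (κ-suc (+ 1) n) (mono-refl (suc n)))
    (cong (λ b → if b then - + 1 else + 0) (sym (dec-true (suc n ℕ.≟ suc n) refl)))
  ... | no  n≢k  = trans (cong₂ _-_ (κ-suc (+ 1) n) (mono-≢ (λ eq → n≢k (sym (ℕP.suc-injective eq)))))
    (cong (λ b → if b then - + 1 else + 0) (sym (dec-false (suc n ℕ.≟ suc k) (λ eq → n≢k (ℕP.suc-injective eq)))))

-- 1/(1 - q^k), with the junk value 0 for k = 0.
1/1-q^ : ℕ → Series
1/1-q^ zero    = zeroS
1/1-q^ (suc k) = geomS (suc k)

-- The case of exponent 1 is the telescoping of the constant sequence; the general case is its image
-- under q ↦ q^(k + 1).
1-q^-inverse : ∀ k → 1-q^ (suc k) · geomS (suc k) ≈ κ (+ 1)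
1-q^-inverse k = begin
  1-q^ (suc k) · geomS (suc k) ≈⟨ ·-cong dil-1-q (ext λ n → sym (dil-at (suc k) ones n)) ⟩
  dil (suc k) (1-q^ 1) · dil (suc k) ones ≈⟨ dil-· (suc k) (1-q^ 1) ones ⟨
  dil (suc k) (1-q^ 1 · ones) ≈⟨ dil-cong (suc k) base ⟩
  dil (suc k) (κ (+ 1)) ≈⟨ dil-κ (suc k) (+ 1) ⟩
  κ (+ 1) ∎
  where
  open ≈-Reasoning
  ones : Series
  ones _ = + 1
  dil-1-q : 1-q^ (suc k) ≈ dil (suc k) (1-q^ 1)
  dil-1-q = ≈-sym (≈-trans (dil-⊕ (suc k) (κ (+ 1)) (⊖ mono 1)) (⊕-cong (dil-κ (suc k) (+ 1))
    (≈-trans (dil-⊖ (suc k) (mono 1)) (⊖-cong (subst (λ j → dil (suc k) (mono 1) ≈ mono j) (ℕP.*-identityʳ (suc k)) (dil-mono (suc k) 1))))))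
  base : 1-q^ 1 · ones ≈ κ (+ 1)
  base = begin
    1-q^ 1 · ones ≈⟨ solve 2 (λ x f → (con (+ 1) :+ :- x) :* f := f :+ :- (x :* f)) ≈-refl (mono 1) ones ⟩
    ones ⊕ ⊖ (mono 1 · ones) ≈⟨ ext coefficient ⟩
    κ (+ 1) ∎
    where
    coefficient : ∀ n → (ones ⊕ ⊖ (mono 1 · ones)) n ≡ κ (+ 1) n
    coefficient n = trans (⊕-at n) (trans (+-congʳ (+ 1) (⊖-at n)) (lemma n))
      where
      lemma : ∀ n → + 1 - (mono 1 · ones) n ≡ κ (+ 1) n
      lemma zero    = trans (cong (λ z → + 1 - z) (·-vanishes ones (mono-vanishes 1) 0 (s≤s z≤n))) (sym (κ-zero (+ 1)))
      lemma (suc n) = trans (cong (λ z → + 1 - z) (mono-1-suc ones n)) (sym (κ-suc (+ 1) n))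

-- Written as (1 - q^k)/(1 - q^(2k)), so that geometric series are the only inverses needed. At k =
-- 0 the value is 0.
1/1+q^ : ℕ → Series
1/1+q^ k = 1-q^ k · 1/1-q^ (k ℕ.+ k)

1+q^-inverse : ∀ k → 1+q^ (suc k) · 1/1+q^ (suc k) ≈ κ (+ 1)
1+q^-inverse k = begin
  1+q^ (suc k) · (1-q^ (suc k) · g) ≈⟨ solve 2 (λ x g → (con (+ 1) :+ x) :* ((con (+ 1) :+ :- x) :* g) := (con (+ 1) :+ :- (x :* x)) :* g) ≈-refl (mono (suc k)) g ⟩
  (κ (+ 1) ⊕ ⊖ (mono (suc k) · mono (suc k))) · g ≈⟨ ·-cong (⊕-cong ≈-refl (⊖-cong (mono-+ (suc k) (suc k)))) ≈-refl ⟨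
  1-q^ (suc k ℕ.+ suc k) · g ≈⟨ 1-q^-inverse (k ℕ.+ suc k) ⟩
  κ (+ 1) ∎
  where
  open ≈-Reasoning
  g = geomS (suc k ℕ.+ suc k)

sumS : ℕ → (ℕ → Series) → Series
sumS zero    f = zeroS
sumS (suc n) f = sumS n f ⊕ f n

sumS-at : ∀ n f i → sumS n f i ≡ sumL (λ s → f s i) (upTo n)
sumS-at zero    f i = refl
sumS-at (suc n) f i = trans (⊕-at i) (trans (cong (_+ f n i) (sumS-at n f i)) (sym (sumL-upTo n (λ s → f s i))))

sumS-vanishes : ∀ {k} n {f} → (∀ s → VanishesBelow k (f s)) → VanishesBelow k (sumS n f)
sumS-vanishes zero    f≡0 i i<k = refl
sumS-vanishes (suc n) f≡0 i i<k = trans (⊕-at i) (cong₂ _+_ (sumS-vanishes n f≡0 i i<k) (f≡0 n i i<k))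

sumS-cong : ∀ n {f g} → (∀ s → f s ≈ g s) → sumS n f ≈ sumS n g
sumS-cong zero    eq = ≈-refl
sumS-cong (suc n) eq = ⊕-cong (sumS-cong n eq) (eq n)

-- `v` is a certificate in the style of Wilf and Zeilberger: if the summands change by a difference
-- of `v`, the sums change by the boundary value.
telescopeS : ∀ m (f g v : ℕ → Series) → v 0 ≈ zeroS → (∀ s → f s ⊕ ⊖ g s ≈ v (suc s) ⊕ ⊖ v s) → sumS m f ≈ sumS m g ⊕ v m
telescopeS zero    f g v v₀ step = ≈-sym (≈-trans (⊕-identityˡ (v 0)) v₀)
telescopeS (suc m) f g v v₀ step = begin
  sumS m f ⊕ f m ≈⟨ ⊕-cong (telescopeS m f g v v₀ step) (solve 2 (λ f g → f := g :+ (f :+ :- g)) ≈-refl (f m) (g m)) ⟩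
  sumS m g ⊕ v m ⊕ (g m ⊕ (f m ⊕ ⊖ g m)) ≈⟨ ⊕-cong ≈-refl (⊕-cong ≈-refl (step m)) ⟩
  sumS m g ⊕ v m ⊕ (g m ⊕ (v (suc m) ⊕ ⊖ v m)) ≈⟨ solve 4 (λ a v g w → a :+ v :+ (g :+ (w :+ :- v)) := a :+ g :+ w) ≈-refl (sumS m g) (v m) (g m) (v (suc m)) ⟩
  sumS m g ⊕ g m ⊕ v (suc m) ∎
  where open ≈-Reasoning

infix 4 _≈[_]_
_≈[_]_ : Series → ℕ → Series → Set
f ≈[ k ] g = ∀ i → i < k → f i ≡ g i

-- An index s has weight at least s, so coefficients below q^k involve only indices s < k.
thin : ∀ (w : Weighted ℕ) f k → (∀ s → s ≤ wt w s) → ⟦ w ⟧ f ≈[ k ] sumS k (λ s → κ (f s) · mono (wt w s))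
thin w f k s≤w i i<k = begin
  ⟦ w ⟧ f i ≡⟨ ⟦⟧-list w f i {filter hit? (upTo k)} (Uniq.filter⁺ hit? (Uniq.upTo⁺ k))
        (λ p → proj₂ (∈-filter⁻ hit? {xs = upTo k} p))
        (λ s eq → ∈-filter⁺ hit? (∈-upTo⁺ (ℕP.≤-<-trans (subst (s ≤_) eq (s≤w s)) i<k)) eq) ⟩
  sumL f (filter hit? (upTo k)) ≡⟨ sumL-cong (filter hit? (upTo k)) (λ {s} p → on s (proj₂ (∈-filter⁻ hit? {xs = upTo k} p))) ⟩
  sumL h (filter hit? (upTo k)) ≡⟨ sumL-filter hit? h off (upTo k) ⟩
  sumL h (upTo k) ≡⟨ sumS-at k _ i ⟨
  sumS k (λ s → κ (f s) · mono (wt w s)) i ∎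
  where
  open ≡-Reasoning
  hit? : ∀ s → Dec (wt w s ≡ i)
  hit? s = wt w s ℕ.≟ i
  h : ℕ → ℤ
  h s = (κ (f s) · mono (wt w s)) i
  on : ∀ s → wt w s ≡ i → f s ≡ h s
  on s refl = sym (trans (κ-· (f s) (mono (wt w s)) i) (trans (cong (f s *_) (mono-refl (wt w s))) (ℤP.*-identityʳ (f s))))
  off : ∀ s → ¬ (wt w s ≡ i) → h s ≡ + 0
  off s ≢ = trans (κ-· (f s) (mono (wt w s)) i) (trans (cong (f s *_) (mono-≢ ≢)) (ℤP.*-zeroʳ (f s)))

[]-trans : ∀ {k f g h} → f ≈[ k ] g → g ≈[ k ] h → f ≈[ k ] h
[]-trans p q i i<k = trans (p i i<k) (q i i<k)

[]-sym : ∀ {k f g} → f ≈[ k ] g → g ≈[ k ] f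
[]-sym p i i<k = sym (p i i<k)

≈⇒[] : ∀ {k f g} → f ≈ g → f ≈[ k ] g
≈⇒[] p i _ = at p i

[]-weaken : ∀ {k l f g} → k ≤ l → f ≈[ l ] g → f ≈[ k ] g
[]-weaken k≤l p i i<k = p i (ℕP.<-≤-trans i<k k≤l)

·-cong-[] : ∀ {k f f′ g g′} → f ≈[ k ] f′ → g ≈[ k ] g′ → f · g ≈[ k ] f′ · g′
·-cong-[] p q n n<k = trans (at ·≈⊛ n) (trans
  (sumTo-cong n (λ i i≤n → cong₂ _*_ (p i (ℕP.≤-<-trans i≤n n<k)) (q (n ℕ.∸ i) (ℕP.≤-<-trans (ℕP.m∸n≤m n i) n<k)))) (sym (at ·≈⊛ n)))

⊕-cong-[] : ∀ {k f f′ g g′} → f ≈[ k ] f′ → g ≈[ k ] g′ → f ⊕ g ≈[ k ] f′ ⊕ g′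
⊕-cong-[] p q n n<k = trans (⊕-at n) (trans (cong₂ _+_ (p n n<k) (q n n<k)) (sym (⊕-at n)))

⊕-vanishes-[] : ∀ {k g} f → VanishesBelow k g → f ⊕ g ≈[ k ] f
⊕-vanishes-[] f g≡0 i i<k = trans (⊕-at i) (trans (+-congʳ (f i) (g≡0 i i<k)) (ℤP.+-identityʳ (f i)))

·-κ1ʳ : ∀ {f g} → g ≈ κ (+ 1) → f · g ≈ f
·-κ1ʳ {f} {g} p = ≈-trans (·-cong ≈-refl p) (solve 1 (λ f → f :* con (+ 1) := f) ≈-refl f)

-- Gauss: Σ q^{s(s+1)/2} = ∏ (1 - q^{2k})/(1 - q^{2k-1}), through Shanks' finite form
--   Σ_{s < 2n} q^{s(s+1)/2} = Σ_{s < n} (P_n / P_s) q^{s(2n+1)}.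

dbl : ℕ → ℕ
dbl zero    = zero
dbl (suc n) = suc (suc (dbl n))

dbl≡ : ∀ n → dbl n ≡ n ℕ.+ n
dbl≡ zero    = refl
dbl≡ (suc n) = cong suc (trans (cong suc (dbl≡ n)) (sym (ℕP.+-suc n n)))

tri : ℕ → ℕ
tri zero    = zero
tri (suc n) = suc n ℕ.+ tri n

module Triangular where
  open ≈-Reasoning

  P P⁻¹ : ℕ → Series
  P zero      = κ (+ 1)
  P (suc n)   = P n · (1-q^ (suc (suc (dbl n))) · 1/1-q^ (suc (dbl n)))
  P⁻¹ zero    = κ (+ 1)
  P⁻¹ (suc n) = P⁻¹ n · (1-q^ (suc (dbl n)) · 1/1-q^ (suc (suc (dbl n))))

  P-inverse : ∀ n → P n · P⁻¹ n ≈ κ (+ 1)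
  P-inverse zero    = solve 0 (con (+ 1) :* con (+ 1) := con (+ 1)) ≈-refl
  P-inverse (suc n) = begin
    P n · (e · g) · (P⁻¹ n · (e′ · g′)) ≈⟨ solve 6 (λ p e g p′ e′ g′ → p :* (e :* g) :* (p′ :* (e′ :* g′)) := p :* p′ :* (e :* g′) :* (e′ :* g)) ≈-refl (P n) e g (P⁻¹ n) e′ g′ ⟩
    P n · P⁻¹ n · (e · g′) · (e′ · g) ≈⟨ ≈-trans (·-κ1ʳ (1-q^-inverse (dbl n))) (·-κ1ʳ (1-q^-inverse (suc (dbl n)))) ⟩
    P n · P⁻¹ n ≈⟨ P-inverse n ⟩
    κ (+ 1) ∎
    where
    e  = 1-q^ (suc (suc (dbl n)))
    g  = 1/1-q^ (suc (dbl n))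
    e′ = 1-q^ (suc (dbl n))
    g′ = 1/1-q^ (suc (suc (dbl n)))

  -- `term` is the summand of the finite form and `v` its certificate: raising n by one changes
  -- `term n m` by `v n (m + 1)` - `v n m`. The factor 1 - q^(2m) removes the boundary value at m =
  -- 0 and cancels the last denominator factor of `P⁻¹ m`, as `v-suc` records.
  term v : ℕ → ℕ → Series
  term n s = P n · P⁻¹ s · mono (s ℕ.* suc (dbl n))
  v n m    = P n · P⁻¹ m · mono (m ℕ.* suc (dbl n)) · (1-q^ (dbl m) · 1/1-q^ (suc (dbl n)))

  mono-dbl : ∀ m → mono (dbl m) ≈ mono m · mono m
  mono-dbl m = subst (λ k → mono k ≈ mono m · mono m) (sym (dbl≡ m)) (mono-+ m m)

  mono-suc : ∀ k → mono (suc k) ≈ mono k · mono 1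
  mono-suc k = subst (λ j → mono j ≈ mono k · mono 1) (ℕP.+-comm k 1) (mono-+ k 1)

  v-suc : ∀ n m → v n (suc m) ≈ P n · P⁻¹ m · (mono (m ℕ.* suc (dbl n)) · mono (suc (dbl n))) · (1-q^ (suc (dbl m)) · 1/1-q^ (suc (dbl n)))
  v-suc n m = begin
    P n · (P⁻¹ m · (e · g′)) · mono (suc m ℕ.* suc (dbl n)) · (e′ · g)
      ≈⟨ ·-cong (·-cong ≈-refl (≈-trans (mono-+ (suc (dbl n)) (m ℕ.* suc (dbl n))) (·-comm _ _))) ≈-refl ⟩
    P n · (P⁻¹ m · (e · g′)) · z · (e′ · g)
      ≈⟨ solve 7 (λ p i e g′ z e′ g → p :* (i :* (e :* g′)) :* z :* (e′ :* g) := p :* i :* z :* (e :* g) :* (e′ :* g′)) ≈-refl (P n) (P⁻¹ m) e g′ z e′ g ⟩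
    P n · P⁻¹ m · z · (e · g) · (e′ · g′)
      ≈⟨ ·-κ1ʳ (1-q^-inverse (suc (dbl m))) ⟩
    P n · P⁻¹ m · z · (e · g) ∎
    where
    e  = 1-q^ (suc (dbl m))
    g′ = 1/1-q^ (suc (suc (dbl m)))
    e′ = 1-q^ (suc (suc (dbl m)))
    g  = 1/1-q^ (suc (dbl n))
    z  = mono (m ℕ.* suc (dbl n)) · mono (suc (dbl n))

  step : ∀ n m → term (suc n) m ⊕ ⊖ term n m ≈ v n (suc m) ⊕ ⊖ v n m
  step n m = begin
    term (suc n) m ⊕ ⊖ term n m
      ≈⟨ ⊕-cong (·-cong (·-cong (·-cong ≈-refl (·-cong (⊕-cong ≈-refl (⊖-cong (mono-suc (suc (dbl n))))) ≈-refl)) ≈-refl) shift)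
                (⊖-cong (≈-sym (·-κ1ʳ (1-q^-inverse (dbl n))))) ⟩
    P n · ((κ (+ 1) ⊕ ⊖ (y · w)) · g) · i · (z · (u · u)) ⊕ ⊖ (P n · i · z · ((κ (+ 1) ⊕ ⊖ y) · g))
      ≈⟨ solve 7 (λ p g i z u y w →
           p :* ((con (+ 1) :+ :- (y :* w)) :* g) :* i :* (z :* (u :* u)) :+ :- (p :* i :* z :* ((con (+ 1) :+ :- y) :* g)) :=
           p :* i :* (z :* y) :* ((con (+ 1) :+ :- (u :* u :* w)) :* g) :+ :- (p :* i :* z :* ((con (+ 1) :+ :- (u :* u)) :* g))) ≈-refl (P n) g i z u y w ⟩
    P n · i · (z · y) · ((κ (+ 1) ⊕ ⊖ (u · u · w)) · g) ⊕ ⊖ (P n · i · z · ((κ (+ 1) ⊕ ⊖ (u · u)) · g))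
      ≈⟨ ⊕-cong (≈-trans (v-suc n m) (·-cong ≈-refl (·-cong (⊕-cong ≈-refl (⊖-cong (≈-trans (mono-suc (dbl m)) (·-cong (mono-dbl m) ≈-refl)))) ≈-refl)))
                (⊖-cong (·-cong ≈-refl (·-cong (⊕-cong ≈-refl (⊖-cong (mono-dbl m))) ≈-refl))) ⟨
    v n (suc m) ⊕ ⊖ v n m ∎
    where
    g = 1/1-q^ (suc (dbl n))
    i = P⁻¹ m
    z = mono (m ℕ.* suc (dbl n))
    u = mono m
    y = mono (suc (dbl n))
    w = mono 1
    exponent : ∀ m k → m ℕ.* (2 ℕ.+ k) ≡ m ℕ.* k ℕ.+ (m ℕ.+ m)
    exponent = solveℕ-∀
    shift : mono (m ℕ.* suc (dbl (suc n))) ≈ z · (u · u)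
    shift = subst (λ k → mono k ≈ z · (u · u)) (sym (exponent m (suc (dbl n))))
      (≈-trans (mono-+ (m ℕ.* suc (dbl n)) (m ℕ.+ m)) (·-cong ≈-refl (mono-+ m m)))

  finite : ∀ n → sumS n (term n) ≈ sumS (dbl n) (λ s → mono (tri s))
  finite zero    = ≈-refl
  finite (suc n) = begin
    -- The old sum has n summands, so the extra summand `term n n` = q^(n(2n + 1)) and the boundary
    -- value `v n (n + 1)` are exactly the next two triangular powers, with indices 2n and 2n + 1.
    sumS (suc n) (term (suc n)) ≈⟨ telescopeS (suc n) (term (suc n)) (term n) (v n) v₀ (step n) ⟩
    sumS n (term n) ⊕ term n n ⊕ v n (suc n) ≈⟨ ⊕-cong (⊕-cong (finite n) last) next ⟩
    sumS (dbl (suc n)) (λ s → mono (tri s)) ∎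
    where
    v₀ : v n 0 ≈ zeroS
    v₀ = ≈-trans (·-cong ≈-refl (·-cong (⊕-cong ≈-refl (⊖-cong mono-0)) ≈-refl))
      (≈-trans (solve 2 (λ x g → x :* ((con (+ 1) :+ :- con (+ 1)) :* g) := con (+ 0)) ≈-refl _ _) κ-0)
    tri-dbl : ∀ n → n ℕ.* suc (dbl n) ≡ tri (dbl n)
    tri-dbl zero    = refl
    tri-dbl (suc n) = trans (arith n (dbl n) (dbl≡ n)) (cong (λ t → suc (suc (dbl n)) ℕ.+ (suc (dbl n) ℕ.+ t)) (tri-dbl n))
      where
      arith₁ : ∀ n d → suc n ℕ.* (3 ℕ.+ d) ≡ 3 ℕ.+ d ℕ.+ (n ℕ.+ n) ℕ.+ n ℕ.* suc d
      arith₁ = solveℕ-∀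
      arith₂ : ∀ d t → 3 ℕ.+ d ℕ.+ d ℕ.+ t ≡ 2 ℕ.+ d ℕ.+ (1 ℕ.+ d ℕ.+ t)
      arith₂ = solveℕ-∀
      arith : ∀ n d → d ≡ n ℕ.+ n → suc n ℕ.* (3 ℕ.+ d) ≡ 2 ℕ.+ d ℕ.+ (1 ℕ.+ d ℕ.+ n ℕ.* suc d)
      arith n d eq = trans (arith₁ n d) (trans (cong (λ k → 3 ℕ.+ d ℕ.+ k ℕ.+ n ℕ.* suc d) (sym eq)) (arith₂ d (n ℕ.* suc d)))
    last : term n n ≈ mono (tri (dbl n))
    last = ≈-trans (·-cong (P-inverse n) (subst (λ k → mono (n ℕ.* suc (dbl n)) ≈ mono k) (tri-dbl n) ≈-refl))
      (solve 1 (λ f → con (+ 1) :* f := f) ≈-refl _)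
    next : v n (suc n) ≈ mono (tri (suc (dbl n)))
    next = ≈-trans (v-suc n n) (≈-trans (·-κ1ʳ (1-q^-inverse (dbl n))) (≈-trans (·-cong (P-inverse n) (≈-sym (≈-trans
      (subst (λ k → mono (suc (dbl n) ℕ.+ k) ≈ mono (suc (dbl n)) · mono (n ℕ.* suc (dbl n))) (tri-dbl n) (mono-+ (suc (dbl n)) (n ℕ.* suc (dbl n))))
      (·-comm _ _)))) (solve 1 (λ f → con (+ 1) :* f := f) ≈-refl _)))

-- Gauss: Σ (-1)^s q^{s²} = ∏ (1 - q^k)/(1 + q^k), through the finite form
--   Σ_{|s| ≤ n} (-1)^s q^{s²} = Σ_{s ≤ n} (P_n / P_s) c_s q^{s(n+1)},  c_0 = 1,  c_s = 2 (-1)^s / (1 + q^s).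

±_ : ℕ → ℤ
± zero  = + 1
± suc s = - (± s)

module Square where
  open ≈-Reasoning

  P P⁻¹ c : ℕ → Series
  P zero      = κ (+ 1)
  P (suc n)   = P n · (1-q^ (suc n) · 1/1+q^ (suc n))
  P⁻¹ zero    = κ (+ 1)
  P⁻¹ (suc n) = P⁻¹ n · (1+q^ (suc n) · 1/1-q^ (suc n))
  c zero      = κ (+ 1)
  c (suc s)   = κ (+ 2 * ± suc s) · 1/1+q^ (suc s)

  P-inverse : ∀ n → P n · P⁻¹ n ≈ κ (+ 1)
  P-inverse zero    = solve 0 (con (+ 1) :* con (+ 1) := con (+ 1)) ≈-refl
  P-inverse (suc n) = begin
    P n · (e · i) · (P⁻¹ n · (p · g)) ≈⟨ solve 6 (λ P e i P′ p g → P :* (e :* i) :* (P′ :* (p :* g)) := P :* P′ :* (e :* g) :* (p :* i)) ≈-refl (P n) e i (P⁻¹ n) p g ⟩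
    P n · P⁻¹ n · (e · g) · (p · i) ≈⟨ ≈-trans (·-κ1ʳ (1+q^-inverse n)) (·-κ1ʳ (1-q^-inverse n)) ⟩
    P n · P⁻¹ n ≈⟨ P-inverse n ⟩
    κ (+ 1) ∎
    where
    e = 1-q^ (suc n)
    i = 1/1+q^ (suc n)
    p = 1+q^ (suc n)
    g = 1/1-q^ (suc n)

  -- The exceptional value c_0 = 1 fits as well, because 1 + q⁰ = 2; thus `step` treats all m
  -- uniformly.
  c-1+q^ : ∀ s → c s · 1+q^ s ≈ κ (+ 2 * ± s)
  c-1+q^ zero    = ≈-trans (·-cong ≈-refl (⊕-cong ≈-refl mono-0)) (solve 0 (con (+ 1) :* (con (+ 1) :+ con (+ 1)) := con (+ 2)) ≈-refl)
  c-1+q^ (suc s) = ≈-trans (solve 3 (λ k i p → k :* i :* p := k :* (p :* i)) ≈-refl (κ (+ 2 * ± suc s)) (1/1+q^ (suc s)) (1+q^ (suc s))) (·-κ1ʳ (1+q^-inverse s))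

  -- The certificate has the same shape as for triangular numbers: its factor 1 - q^m vanishes at m
  -- = 0 and cancels a denominator after the shift m ↦ m + 1.
  term v : ℕ → ℕ → Series
  term n s = P n · P⁻¹ s · c s · mono (s ℕ.* suc n)
  v n m    = P n · P⁻¹ m · c m · mono (m ℕ.* suc n) · (1-q^ m · 1/1+q^ (suc n))

  v-suc : ∀ n m → v n (suc m) ≈ P n · P⁻¹ m · κ (+ 2 * ± suc m) · mono (suc m ℕ.* suc n) · 1/1+q^ (suc n)
  v-suc n m = begin
    P n · (P⁻¹ m · (p · g)) · (k · i) · z · (e · j) ≈⟨ solve 9 (λ P P′ p g k i z e j → P :* (P′ :* (p :* g)) :* (k :* i) :* z :* (e :* j) := P :* P′ :* k :* z :* j :* (e :* g) :* (p :* i)) ≈-refl (P n) (P⁻¹ m) p g k i z e j ⟩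
    P n · P⁻¹ m · k · z · j · (e · g) · (p · i) ≈⟨ ≈-trans (·-κ1ʳ (1+q^-inverse m)) (·-κ1ʳ (1-q^-inverse m)) ⟩
    P n · P⁻¹ m · k · z · j ∎
    where
    e = 1-q^ (suc m)
    i = 1/1+q^ (suc m)
    p = 1+q^ (suc m)
    g = 1/1-q^ (suc m)
    k = κ (+ 2 * ± suc m)
    z = mono (suc m ℕ.* suc n)
    j = 1/1+q^ (suc n)

  step : ∀ n m → term (suc n) m ⊕ ⊖ term n m ≈ v n (suc m) ⊕ ⊖ v n m
  step n m = begin
    term (suc n) m ⊕ ⊖ term n m
      ≈⟨ ⊕-cong (·-cong ≈-refl shift) (⊖-cong (≈-sym (·-κ1ʳ (1+q^-inverse n)))) ⟩
    P n · ((κ (+ 1) ⊕ ⊖ y) · j) · i · c m · (z · u) ⊕ ⊖ (P n · i · c m · z · ((κ (+ 1) ⊕ y) · j))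
      ≈⟨ solve 7 (λ p j i c z u y →
           p :* ((con (+ 1) :+ :- y) :* j) :* i :* c :* (z :* u) :+ :- (p :* i :* c :* z :* ((con (+ 1) :+ y) :* j)) :=
           p :* i :* (:- (c :* (con (+ 1) :+ u))) :* (y :* z) :* j :+ :- (p :* i :* c :* z :* ((con (+ 1) :+ :- u) :* j))) ≈-refl (P n) j i (c m) z u y ⟩
    P n · i · ⊖ (c m · 1+q^ m) · (y · z) · j ⊕ ⊖ v n m
      ≈⟨ ⊕-cong (≈-trans (v-suc n m) (·-cong (·-cong (·-cong ≈-refl sign) (mono-+ (suc n) (m ℕ.* suc n))) ≈-refl)) ≈-refl ⟨
    v n (suc m) ⊕ ⊖ v n m ∎
    where
    j = 1/1+q^ (suc n)
    i = P⁻¹ m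
    z = mono (m ℕ.* suc n)
    u = mono m
    y = mono (suc n)
    exponent : ∀ m k → m ℕ.* (1 ℕ.+ k) ≡ m ℕ.* k ℕ.+ m
    exponent = solveℕ-∀
    shift : mono (m ℕ.* suc (suc n)) ≈ z · u
    shift = subst (λ k → mono k ≈ z · u) (sym (exponent m (suc n))) (mono-+ (m ℕ.* suc n) m)
    sign : κ (+ 2 * ± suc m) ≈ ⊖ (c m · 1+q^ m)
    sign = ≈-trans (subst (λ k → κ k ≈ ⊖ κ (+ 2 * ± m)) (ℤP.neg-distribʳ-* (+ 2) (± m)) (κ-neg (+ 2 * ± m))) (⊖-cong (≈-sym (c-1+q^ m)))

  finite : ∀ n → sumS (suc n) (term n) ≈ κ (+ 1) ⊕ sumS n (λ s → κ (+ 2 * ± suc s) · mono (suc s ℕ.* suc s))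
  finite zero    = begin
    zeroS ⊕ κ (+ 1) · κ (+ 1) · κ (+ 1) · mono 0 ≈⟨ ⊕-cong ≈-refl (·-cong ≈-refl mono-0) ⟩
    zeroS ⊕ κ (+ 1) · κ (+ 1) · κ (+ 1) · κ (+ 1) ≈⟨ ⊕-comm _ _ ⟩
    κ (+ 1) · κ (+ 1) · κ (+ 1) · κ (+ 1) ⊕ zeroS ≈⟨ ⊕-cong (solve 0 (con (+ 1) :* con (+ 1) :* con (+ 1) :* con (+ 1) := con (+ 1)) ≈-refl) ≈-refl ⟩
    κ (+ 1) ⊕ zeroS ∎
  finite (suc n) = begin
    sumS (suc n) (term (suc n)) ⊕ term (suc n) (suc n) ≈⟨ ⊕-cong (telescopeS (suc n) (term (suc n)) (term n) (v n) v₀ (step n)) ≈-refl ⟩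
    sumS (suc n) (term n) ⊕ v n (suc n) ⊕ term (suc n) (suc n) ≈⟨ ⊕-cong (⊕-cong (finite n) ≈-refl) ≈-refl ⟩
    κ (+ 1) ⊕ S ⊕ v n (suc n) ⊕ term (suc n) (suc n) ≈⟨ solve 4 (λ a b c d → a :+ b :+ c :+ d := a :+ (b :+ (c :+ d))) ≈-refl (κ (+ 1)) S (v n (suc n)) (term (suc n) (suc n)) ⟩
    κ (+ 1) ⊕ (S ⊕ (v n (suc n) ⊕ term (suc n) (suc n))) ≈⟨ ⊕-cong ≈-refl (⊕-cong ≈-refl new) ⟩
    κ (+ 1) ⊕ (S ⊕ k · z) ∎
    where
    S = sumS n (λ s → κ (+ 2 * ± suc s) · mono (suc s ℕ.* suc s))
    k = κ (+ 2 * ± suc n)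
    z = mono (suc n ℕ.* suc n)
    j = 1/1+q^ (suc n)
    v₀ : v n 0 ≈ zeroS
    v₀ = ≈-trans (·-cong ≈-refl (·-cong (⊕-cong ≈-refl (⊖-cong mono-0)) ≈-refl))
      (≈-trans (solve 2 (λ x g → x :* ((con (+ 1) :+ :- con (+ 1)) :* g) := con (+ 0)) ≈-refl _ _) κ-0)
    exponent : ∀ n → suc n ℕ.* suc (suc n) ≡ suc n ℕ.* suc n ℕ.+ suc n
    exponent = solveℕ-∀
    -- The boundary value and the new last summand have the ratio 1 : q^(n + 1), so together they
    -- supply the factor 1 + q^(n + 1) that cancels the denominator of both.
    new : v n (suc n) ⊕ term (suc n) (suc n) ≈ k · z
    new = begin
      v n (suc n) ⊕ term (suc n) (suc n)
        ≈⟨ ⊕-cong (≈-trans (v-suc n n) (·-cong (·-cong (·-cong (P-inverse n) ≈-refl) ≈-refl) ≈-refl))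
                  (·-cong (·-cong (P-inverse (suc n)) ≈-refl) (subst (λ l → mono l ≈ z · mono (suc n)) (sym (exponent n)) (mono-+ (suc n ℕ.* suc n) (suc n)))) ⟩
      κ (+ 1) · k · z · j ⊕ κ (+ 1) · (k · j) · (z · mono (suc n))
        ≈⟨ solve 4 (λ k z j y → con (+ 1) :* k :* z :* j :+ con (+ 1) :* (k :* j) :* (z :* y) := k :* z :* ((con (+ 1) :+ y) :* j)) ≈-refl k z j (mono (suc n)) ⟩
      k · z · (1+q^ (suc n) · j)
        ≈⟨ ·-κ1ʳ (1+q^-inverse n) ⟩
      k · z ∎

-- Passage to the limit in Gauss' formulas

sumS-head : ∀ n f → sumS (suc n) f ≈ f 0 ⊕ sumS n (f ∘ suc)
sumS-head zero    f = ⊕-comm zeroS (f 0)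
sumS-head (suc n) f = ≈-trans (⊕-cong (sumS-head n f) ≈-refl) (⊕-assoc _ _ _)

mono-·-vanishes : ∀ {k l} f → k ≤ l → VanishesBelow k (f · mono l)
mono-·-vanishes {k} {l} f k≤l i i<k = trans (at (·-comm f (mono l)) i) (·-vanishes f (mono-vanishes l) i (ℕP.<-≤-trans i<k k≤l))

k≤tri : ∀ k → k ≤ tri k
k≤tri zero    = z≤n
k≤tri (suc k) = ℕP.m≤m+n (suc k) (tri k)

triangulars : Weighted ℕ
triangulars = record
  { _≟_ = ℕ._≟_ ; wt = tri ; box = upTo ∘ suc ; ∈-box = λ k le → ∈-upTo⁺ (s≤s (ℕP.≤-trans (k≤tri k) le)) }

ψ : Series
ψ = ⟦ triangulars ⟧ one

ψ²≈dilψ : ψ² ≈ dil 2 ψ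
ψ²≈dilψ = ≈-trans (⟦⟧-reweigh pronicsℕ (scale 2 triangulars) 2*tri (λ _ → refl)) (⟦scale⟧ 2 triangulars one)
  where
  arith : ∀ k t → 2 ℕ.* (suc k ℕ.+ t) ≡ suc k ℕ.+ suc k ℕ.+ 2 ℕ.* t
  arith = solveℕ-∀
  arith′ : ∀ k → suc k ℕ.+ suc k ℕ.+ k ℕ.* suc k ≡ suc k ℕ.* suc (suc k)
  arith′ = solveℕ-∀
  2*tri : ∀ k → 2 ℕ.* tri k ≡ k ℕ.* suc k
  2*tri zero    = refl
  2*tri (suc k) = trans (arith k (tri k)) (trans (cong (suc k ℕ.+ suc k ℕ.+_) (2*tri k)) (arith′ k))

-- In the finite form the summand s = 0 is P_k itself, and every other one is divisible by q^(2k +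
-- 1).
ψ≈P : ∀ k → ψ ≈[ k ] Triangular.P k
ψ≈P zero    = λ _ ()
ψ≈P (suc n) = []-trans
  ([]-weaken (s≤s (ℕP.≤-trans (ℕP.m≤m+n n n) (ℕP.≤-trans (ℕP.≤-reflexive (sym (dbl≡ n))) (ℕP.n≤1+n _)))) (thin triangulars one (dbl k) (λ s → k≤tri s)))
  ([]-trans (≈⇒[] (≈-trans (sumS-cong (dbl k) (λ s → solve 1 (λ f → con (+ 1) :* f := f) ≈-refl (mono (tri s)))) (≈-trans (≈-sym (finite k)) (sumS-head n (term k)))))
  ([]-trans (⊕-vanishes-[] (term k 0) (sumS-vanishes n (λ s → mono-·-vanishes _ (ℕP.≤-trans (s≤s (ℕP.≤-trans (ℕP.m≤m+n n n) (ℕP.≤-trans (ℕP.≤-reflexive (sym (dbl≡ n))) (ℕP.m≤n+m _ 2)))) (ℕP.m≤m+n (suc (dbl k)) (s ℕ.* suc (dbl k)))))))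
  (≈⇒[] (≈-trans (·-cong ≈-refl mono-0) (solve 1 (λ p → p :* con (+ 1) :* con (+ 1) := p) ≈-refl (P k))))))
  where
  open Triangular
  k = suc n

squares⁺ : Weighted ℕ
squares⁺ = record
  { _≟_ = ℕ._≟_ ; wt = λ s → suc s ℕ.* suc s ; box = upTo ∘ suc
  ; ∈-box = λ s le → ∈-upTo⁺ (s≤s (ℕP.≤-trans (ℕP.n≤1+n s) (ℕP.≤-trans (n≤n*n (suc s)) le))) }

sgn-+ℕ : ∀ n → sgn (+ n) ≡ ± n
sgn-+ℕ zero    = refl
sgn-+ℕ (suc n) = trans (sgn-+ (+ 1) (+ n)) (trans (cong (- + 1 *_) (sgn-+ℕ n)) (ℤP.-1*i≡-i (± n)))

sgn-neg : ∀ n → sgn -[1+ n ] ≡ ± suc n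
sgn-neg n = trans (begin
  s ≡⟨ ℤP.*-identityʳ s ⟨
  s * + 1 ≡⟨ cong (s *_) (sgn² (+ suc n)) ⟨
  s * (t * t) ≡⟨ ℤP.*-assoc s t t ⟨
  s * t * t ≡⟨ cong (_* t) (sgn-+ -[1+ n ] (+ suc n)) ⟨
  sgn (-[1+ n ] + + suc n) * t ≡⟨ cong (λ z → sgn z * t) (ℤP.+-inverseˡ (+ suc n)) ⟩
  + 1 * t ≡⟨ ℤP.*-identityˡ t ⟩
  t ∎) (sgn-+ℕ (suc n))
  where
  open ≡-Reasoning
  s = sgn -[1+ n ]
  t = sgn (+ suc n)

φ⁻≈ : φ⁻ ≈ κ (+ 1) ⊕ ⟦ squares⁺ ⟧ (λ s → + 2 * ± suc s)
φ⁻≈ = begin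
  φ⁻ ≈⟨ ⟦⟧-bij (point 0 ⊞ squares⁺ ⊞ squares⁺) squares signs weight (λ _ → refl) ⟨
  ⟦ point 0 ⊞ squares⁺ ⊞ squares⁺ ⟧ (sgn ∘ _≅_.to signs) ≈⟨ ≈-trans (⟦⊞⟧ (point 0) (squares⁺ ⊞ squares⁺) _) (⊕-cong ≈-refl (⟦⊞⟧ squares⁺ squares⁺ _)) ⟩
  ⟦ point 0 ⟧ (λ _ → + 1) ⊕ (⟦ squares⁺ ⟧ (λ s → sgn (+ suc s)) ⊕ ⟦ squares⁺ ⟧ (λ s → sgn -[1+ s ]))
        ≈⟨ ⊕-cong (≈-sym (κ≈⟦⟧ (+ 1))) (≈-sym (⟦⟧-+ squares⁺ (λ s → sgn (+ suc s)) (λ s → sgn -[1+ s ]))) ⟩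
  κ (+ 1) ⊕ ⟦ squares⁺ ⟧ (λ s → sgn (+ suc s) + sgn -[1+ s ]) ≈⟨ ⊕-cong ≈-refl (⟦⟧-cong squares⁺ (λ s → trans (cong₂ _+_ (sgn-+ℕ (suc s)) (sgn-neg s)) (double (± suc s)))) ⟩
  κ (+ 1) ⊕ ⟦ squares⁺ ⟧ (λ s → + 2 * ± suc s) ∎
  where
  open ≈-Reasoning
  double : ∀ x → x + x ≡ + 2 * x
  double = solve-∀
  signs : ⊤ ⊎ ℕ ⊎ ℕ ≅ ℤ
  signs = record
    { to = λ { (inj₁ _) → + 0 ; (inj₂ (inj₁ s)) → + suc s ; (inj₂ (inj₂ s)) → -[1+ s ] }
    ; from = λ { (+ zero) → inj₁ tt ; (+ suc s) → inj₂ (inj₁ s) ; -[1+ s ] → inj₂ (inj₂ s) }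
    ; from-to = λ { (inj₁ _) → refl ; (inj₂ (inj₁ _)) → refl ; (inj₂ (inj₂ _)) → refl }
    ; to-from = λ { (+ zero) → refl ; (+ suc _) → refl ; -[1+ _ ] → refl } }
  weight : ∀ i → wt squares (_≅_.to signs i) ≡ wt (point 0 ⊞ squares⁺ ⊞ squares⁺) i
  weight (inj₁ _)        = refl
  weight (inj₂ (inj₁ _)) = refl
  weight (inj₂ (inj₂ _)) = refl

-- Again the summand s = 0 is P_k, and the others are divisible by q^(k + 1).
φ⁻≈P : ∀ k → φ⁻ ≈[ k ] Square.P k
φ⁻≈P k = []-trans (≈⇒[] φ⁻≈)
  ([]-trans (⊕-cong-[] {k} {κ (+ 1)} (λ _ _ → refl) (thin squares⁺ (λ s → + 2 * ± suc s) k (λ s → ℕP.≤-trans (ℕP.n≤1+n s) (n≤n*n (suc s)))))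
  ([]-trans (≈⇒[] (≈-trans (≈-sym (finite k)) (sumS-head k (term k))))
  ([]-trans (⊕-vanishes-[] (term k 0) (sumS-vanishes k (λ s → mono-·-vanishes _ (ℕP.≤-trans (ℕP.n≤1+n k) (ℕP.m≤m+n (suc k) (s ℕ.* suc k))))))
  (≈⇒[] (≈-trans (·-cong ≈-refl mono-0) (solve 1 (λ p → p :* con (+ 1) :* con (+ 1) :* con (+ 1) := p) ≈-refl (P k)))))))
  where open Square

-- Euler products

∏ : ℕ → ℕ → Series
∏ k zero    = κ (+ 1)
∏ k (suc M) = ∏ k M · 1-q^ (k ℕ.* suc M)

-- ∏_{m ≥ 1} (1 - q^{km}) for k ≥ 1
∏∞ : ℕ → Series
∏∞ k n = ∏ k n n

1-q^-double : ∀ n → 1-q^ (2 ℕ.* n) ≈ 1-q^ n · 1+q^ n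
1-q^-double n = begin
  1-q^ (2 ℕ.* n) ≈⟨ ⊕-cong ≈-refl (⊖-cong (subst (λ k → mono k ≈ mono n · mono n) (cong (n ℕ.+_) (sym (ℕP.+-identityʳ n))) (mono-+ n n))) ⟩
  κ (+ 1) ⊕ ⊖ (mono n · mono n) ≈⟨ solve 1 (λ x → con (+ 1) :+ :- (x :* x) := (con (+ 1) :+ :- x) :* (con (+ 1) :+ x)) ≈-refl (mono n) ⟩
  1-q^ n · 1+q^ n ∎
  where open ≈-Reasoning

1-q^-≡ : ∀ {j k} → j ≡ k → 1-q^ j ≈ 1-q^ k
1-q^-≡ refl = ≈-refl

-- The product of all 1 - q^j with j ≤ 2n contains the odd factors, which cancel the denominator of
-- P_n, and the even ones, which double its numerator.
P-triangular : ∀ n → Triangular.P n · ∏ 1 (dbl n) ≈ ∏ 2 n · ∏ 2 n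
P-triangular zero    = ≈-refl
P-triangular (suc n) = begin
  P n · (e′ · g) · (∏ 1 (dbl n) · 1-q^ (1 ℕ.* suc (dbl n)) · 1-q^ (1 ℕ.* suc (suc (dbl n))))
    ≈⟨ ·-cong ≈-refl (·-cong (·-cong ≈-refl (1-q^-≡ (ℕP.*-identityˡ _))) (1-q^-≡ (ℕP.*-identityˡ _))) ⟩
  P n · (e′ · g) · (∏ 1 (dbl n) · e · e′)
    ≈⟨ solve 5 (λ p e′ g w e → p :* (e′ :* g) :* (w :* e :* e′) := p :* w :* (e′ :* e′) :* (e :* g)) ≈-refl (P n) e′ g (∏ 1 (dbl n)) e ⟩
  P n · ∏ 1 (dbl n) · (e′ · e′) · (e · g)
    ≈⟨ ≈-trans (·-κ1ʳ (1-q^-inverse (dbl n))) (·-cong (P-triangular n) (·-cong e′≈ e′≈)) ⟩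
  ∏ 2 n · ∏ 2 n · (1-q^ (2 ℕ.* suc n) · 1-q^ (2 ℕ.* suc n))
    ≈⟨ solve 2 (λ w e → w :* w :* (e :* e) := w :* e :* (w :* e)) ≈-refl (∏ 2 n) (1-q^ (2 ℕ.* suc n)) ⟩
  ∏ 2 (suc n) · ∏ 2 (suc n) ∎
  where
  open ≈-Reasoning
  open Triangular using (P)
  e  = 1-q^ (suc (dbl n))
  e′ = 1-q^ (suc (suc (dbl n)))
  g  = 1/1-q^ (suc (dbl n))
  e′≈ : e′ ≈ 1-q^ (2 ℕ.* suc n)
  e′≈ = 1-q^-≡ (trans (dbl≡ (suc n)) (cong (suc n ℕ.+_) (sym (ℕP.+-identityʳ (suc n)))))

-- Each 1 - q^(2k) = (1 - q^k)(1 + q^k) clears one denominator and adds a second factor 1 - q^k.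
P-square : ∀ n → Square.P n · ∏ 2 n ≈ ∏ 1 n · ∏ 1 n
P-square zero    = ≈-refl
P-square (suc n) = begin
  P n · (e · i) · (∏ 2 n · 1-q^ (2 ℕ.* suc n)) ≈⟨ ·-cong ≈-refl (·-cong ≈-refl (1-q^-double (suc n))) ⟩
  P n · (e · i) · (∏ 2 n · (e · p)) ≈⟨ solve 5 (λ P e i w p → P :* (e :* i) :* (w :* (e :* p)) := P :* w :* (e :* e) :* (p :* i)) ≈-refl (P n) e i (∏ 2 n) p ⟩
  P n · ∏ 2 n · (e · e) · (p · i) ≈⟨ ≈-trans (·-κ1ʳ (1+q^-inverse n)) (·-cong (P-square n) (·-cong e≈ e≈)) ⟩
  ∏ 1 n · ∏ 1 n · (1-q^ (1 ℕ.* suc n) · 1-q^ (1 ℕ.* suc n)) ≈⟨ solve 2 (λ w e → w :* w :* (e :* e) := w :* e :* (w :* e)) ≈-refl (∏ 1 n) (1-q^ (1 ℕ.* suc n)) ⟩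
  ∏ 1 (suc n) · ∏ 1 (suc n) ∎
  where
  open ≈-Reasoning
  open Square using (P)
  e = 1-q^ (suc n)
  i = 1/1+q^ (suc n)
  p = 1+q^ (suc n)
  e≈ : e ≈ 1-q^ (1 ℕ.* suc n)
  e≈ = 1-q^-≡ (sym (ℕP.*-identityˡ (suc n)))

∏-step : ∀ k .{{_ : NonZero k}} M → ∏ k (suc M) ≈[ suc M ] ∏ k M
∏-step k M = []-trans
  (≈⇒[] (solve 2 (λ w x → w :* (con (+ 1) :+ :- x) := w :+ (:- w) :* x) ≈-refl (∏ k M) (mono (k ℕ.* suc M))))
  (⊕-vanishes-[] (∏ k M) (mono-·-vanishes (⊖ ∏ k M) (ℕP.m≤n*m (suc M) k)))

-- The factor with index m + 1 changes nothing below q^(k(m + 1)), and k ≥ 1; hence the diagonal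
-- definition of `∏∞` agrees with every sufficiently long product.
∏-limit : ∀ k .{{_ : NonZero k}} M → ∏ k M ≈[ suc M ] ∏∞ k
∏-limit k zero    zero    _ = refl
∏-limit k zero    (suc i) (s≤s ())
∏-limit k (suc M) i i<    with i ℕ.≟ suc M
... | yes refl = refl
... | no  i≢   = trans (∏-step k M i i<M) (∏-limit k M i i<M)
  where i<M = ℕP.≤∧≢⇒< (ℕ.s≤s⁻¹ i<) i≢

[]⇒≈ : ∀ {f g} → (∀ k → f ≈[ suc k ] g) → f ≈ g
[]⇒≈ p = ext λ n → p n n ℕP.≤-refl

dil-cong-[] : ∀ c .{{_ : NonZero c}} {k f g} → f ≈[ k ] g → dil c f ≈[ k ] dil c g
dil-cong-[] c {k} {f} {g} p = dil-elim c (λ n → n < k → dil c f n ≡ dil c g n)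
  (λ m lt → trans (dil-multiple c f m) (trans (p m (ℕP.≤-<-trans (ℕP.m≤n*m m c) lt)) (sym (dil-multiple c g m))))
  (λ n c∤n _ → trans (dil-nonmultiple c f n c∤n) (sym (dil-nonmultiple c g n c∤n)))

dil-1-q^ : ∀ c .{{_ : NonZero c}} k → dil c (1-q^ k) ≈ 1-q^ (c ℕ.* k)
dil-1-q^ c k = ≈-trans (dil-⊕ c (κ (+ 1)) (⊖ mono k)) (⊕-cong (dil-κ c (+ 1)) (≈-trans (dil-⊖ c (mono k)) (⊖-cong (dil-mono c k))))

dil-∏ : ∀ c .{{_ : NonZero c}} k M → dil c (∏ k M) ≈ ∏ (c ℕ.* k) M
dil-∏ c k zero    = dil-κ c (+ 1)
dil-∏ c k (suc M) = ≈-trans (dil-· c (∏ k M) (1-q^ (k ℕ.* suc M)))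
  (·-cong (dil-∏ c k M) (≈-trans (dil-1-q^ c (k ℕ.* suc M)) (1-q^-≡ (sym (ℕP.*-assoc c k (suc M))))))

dil-∏∞ : ∀ c k .{{_ : NonZero c}} .{{_ : NonZero k}} .{{_ : NonZero (c ℕ.* k)}} → dil c (∏∞ k) ≈ ∏∞ (c ℕ.* k)
dil-∏∞ c k = []⇒≈ λ M → []-trans (dil-cong-[] c ([]-sym (∏-limit k M))) ([]-trans (≈⇒[] (dil-∏ c k M)) (∏-limit (c ℕ.* k) M))

ψ-product : ψ · ∏∞ 1 ≈ ∏∞ 2 · ∏∞ 2
ψ-product = []⇒≈ λ M → []-trans
  (·-cong-[] (ψ≈P (suc M)) ([]-sym ([]-weaken (s≤s (ℕP.≤-trans (ℕP.m≤m+n M M) (ℕP.≤-trans (ℕP.≤-reflexive (sym (dbl≡ M))) (ℕP.m≤n+m _ 2)))) (∏-limit 1 (dbl (suc M))))))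
  ([]-trans (≈⇒[] (P-triangular (suc M))) (·-cong-[] (wk M) (wk M)))
  where
  wk : ∀ M → ∏ 2 (suc M) ≈[ suc M ] ∏∞ 2
  wk M = []-weaken (ℕP.n≤1+n (suc M)) (∏-limit 2 (suc M))

φ⁻-product : φ⁻ · ∏∞ 2 ≈ ∏∞ 1 · ∏∞ 1
φ⁻-product = []⇒≈ λ M → []-trans
  (·-cong-[] (φ⁻≈P (suc M)) ([]-sym (wk 2 M)))
  ([]-trans (≈⇒[] (P-square (suc M))) (·-cong-[] (wk 1 M) (wk 1 M)))
  where
  wk : ∀ k .{{_ : NonZero k}} M → ∏ k (suc M) ≈[ suc M ] ∏∞ k
  wk k M = []-weaken (ℕP.n≤1+n (suc M)) (∏-limit k (suc M))

·-lowest : ∀ {k f} g → VanishesBelow k f → (f · g) k ≡ f k * g 0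
·-lowest {k} {f} g f≡0 = trans (at ·≈⊛ k) (lemma k f≡0)
  where
  lemma : ∀ k → VanishesBelow k f → sumTo k (λ i → f i * g (k ℕ.∸ i)) ≡ f k * g 0
  lemma zero    _   = refl
  lemma (suc j) f≡0 = trans (cong₂ _+_
    (sumTo-zero j (λ i i≤j → trans (cong (_* g (suc j ℕ.∸ i)) (f≡0 i (s≤s i≤j))) (ℤP.*-zeroˡ (g (suc j ℕ.∸ i)))))
    (cong (λ i → f (suc j) * g i) (ℕP.n∸n≡0 j)))
    (ℤP.+-identityˡ _)

-- The lowest coefficient of the difference survives multiplication by a series with constant term
-- 1. The truncated form is needed where the product itself depends on the coefficient considered.
·-cancelʳ-[] : ∀ {k f g} h → h 0 ≡ + 1 → f · h ≈[ k ] g · h → f ≈[ k ] g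
·-cancelʳ-[] {k} {f} {g} h h₀ eq i i<k = ℤP.i-j≡0⇒i≡j (f i) (g i) (trans (sym (minus i)) (all (suc i) i<k i ℕP.≤-refl))
  where
  D = f ⊕ ⊖ g
  minus : ∀ n → D n ≡ f n - g n
  minus n = trans (⊕-at n) (+-congʳ (f n) (⊖-at n))
  product : ∀ n → n < k → (D · h) n ≡ + 0
  product n n<k = trans (at (solve 3 (λ f g h → (f :+ :- g) :* h := f :* h :+ :- (g :* h)) ≈-refl f g h) n)
    (trans (⊕-at n) (trans (cong₂ _+_ (eq n n<k) (⊖-at n)) (ℤP.+-inverseʳ ((g · h) n))))
  all : ∀ m → m ≤ k → VanishesBelow m D
  all (suc m) m<k i i<1+m with i ℕ.≟ m
  ... | no  i≢m  = all m (ℕP.<⇒≤ m<k) i (ℕP.≤∧≢⇒< (ℕ.s≤s⁻¹ i<1+m) i≢m)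
  ... | yes refl = trans (sym (trans (cong (D m *_) h₀) (ℤP.*-identityʳ (D m)))) (trans (sym (·-lowest h (all m (ℕP.<⇒≤ m<k)))) (product m m<k))

·-cancelʳ : ∀ {f g} h → h 0 ≡ + 1 → f · h ≈ g · h → f ≈ g
·-cancelʳ h h₀ eq = []⇒≈ λ k → ·-cancelʳ-[] h h₀ (≈⇒[] eq)

·-at-0 : ∀ f g → (f · g) 0 ≡ f 0 * g 0
·-at-0 f g = at ·≈⊛ 0

∏∞-0 : ∀ k → ∏∞ k 0 ≡ + 1
∏∞-0 k = κ-zero (+ 1)

-- The two eta quotients

factor : ∀ k m → factorS (suc k ℕ.* suc m) (+ 1) ≈ 1-q^ (suc k ℕ.* suc m)
factor k m = ≈-trans (≈-sym ·≈⊛) (≈-trans (·-cong (oneMinus≈ (m ℕ.+ k ℕ.* suc m)) (≈-sym κ-1)) (solve 1 (λ f → f :* con (+ 1) := f) ≈-refl (1-q^ (suc k ℕ.* suc m))))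

eta₂₄ : ∀ M → etaProdTrunc spec24 M ≈ ∏ 2 M · ∏ 4 M · ∏ 6 M · ∏ 12 M
eta₂₄ zero    = ≈-trans (≈-sym κ-1) (solve 0 (con (+ 1) := con (+ 1) :* con (+ 1) :* con (+ 1) :* con (+ 1)) ≈-refl)
eta₂₄ (suc M) = begin
  etaFactors spec24 M ⊛ etaProdTrunc spec24 M
    ≈⟨ ·≈⊛ ⟨
  etaFactors spec24 M · etaProdTrunc spec24 M
    ≈⟨ ·-cong (≈-trans (≈-sym ·≈⊛) (·-cong (factor 1 M) (≈-trans (≈-sym ·≈⊛) (·-cong (factor 3 M)
         (≈-trans (≈-sym ·≈⊛) (·-cong (factor 5 M) (≈-trans (≈-sym ·≈⊛) (·-cong (factor 11 M) (≈-sym κ-1))))))))) (eta₂₄ M) ⟩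
  e 2 · (e 4 · (e 6 · (e 12 · κ (+ 1)))) · (∏ 2 M · ∏ 4 M · ∏ 6 M · ∏ 12 M)
    ≈⟨ solve 8 (λ a b c d a′ b′ c′ d′ → a :* (b :* (c :* (d :* con (+ 1)))) :* (a′ :* b′ :* c′ :* d′) := a′ :* a :* (b′ :* b) :* (c′ :* c) :* (d′ :* d)) ≈-refl
         (e 2) (e 4) (e 6) (e 12) (∏ 2 M) (∏ 4 M) (∏ 6 M) (∏ 12 M) ⟩
  ∏ 2 (suc M) · ∏ 4 (suc M) · ∏ 6 (suc M) · ∏ 12 (suc M) ∎
  where
  open ≈-Reasoning
  e : ℕ → Series
  e k = 1-q^ (k ℕ.* suc M)

fourth : Series → Series
fourth f = f · (f · (f · f))

factor⁴ : ∀ k m → factorS (suc k ℕ.* suc m) (+ 4) ≈ fourth (1-q^ (suc k ℕ.* suc m))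
factor⁴ k m = ≈-trans (≈-sym ·≈⊛) (·-cong e (≈-trans (≈-sym ·≈⊛) (·-cong e (≈-trans (≈-sym ·≈⊛) (·-cong e (factor k m))))))
  where
  e : oneMinus (suc k ℕ.* suc m) ≈ 1-q^ (suc k ℕ.* suc m)
  e = oneMinus≈ (m ℕ.+ k ℕ.* suc m)

factor⁻¹ : ∀ k m → factorS (suc k ℕ.* suc m) -[1+ 0 ] ≈ geomS (suc k ℕ.* suc m)
factor⁻¹ k m = ≈-trans (≈-sym ·≈⊛) (≈-trans (·-cong ≈-refl (≈-sym κ-1)) (solve 1 (λ f → f :* con (+ 1) := f) ≈-refl (geomS (suc k ℕ.* suc m))))

-- The denominators are multiplied out, so that each geometric series meets its own factor; they are
-- cancelled again in `τ₄₈`.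
eta₄₈ : ∀ M → etaProdTrunc spec48 M · (∏ 2 M · ∏ 6 M · ∏ 8 M · ∏ 24 M) ≈ fourth (∏ 4 M) · fourth (∏ 12 M)
eta₄₈ zero    = ≈-trans (·-cong (≈-sym κ-1) ≈-refl)
  (solve 0 (let i = con (+ 1) in i :* (i :* i :* i :* i) := (i :* (i :* (i :* i))) :* (i :* (i :* (i :* i)))) ≈-refl)
eta₄₈ (suc M) = begin
  etaFactors spec48 M ⊛ T · (∏ 2 (suc M) · ∏ 6 (suc M) · ∏ 8 (suc M) · ∏ 24 (suc M))
    ≈⟨ ·-cong (≈-trans (≈-sym ·≈⊛) (·-cong (≈-trans (≈-sym ·≈⊛) (·-cong (factor⁴ 3 M) (≈-trans (≈-sym ·≈⊛) (·-cong (factor⁴ 11 M)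
         (≈-trans (≈-sym ·≈⊛) (·-cong (factor⁻¹ 1 M) (≈-trans (≈-sym ·≈⊛) (·-cong (factor⁻¹ 5 M) (≈-trans (≈-sym ·≈⊛) (·-cong (factor⁻¹ 7 M)
         (≈-trans (≈-sym ·≈⊛) (·-cong (factor⁻¹ 23 M) (≈-sym κ-1))))))))))))) (≈-refl {T}))) ≈-refl ⟩
  fourth (e 4) · (fourth (e 12) · (g₂ · (g₆ · (g₈ · (g₂₄ · κ (+ 1)))))) · T · (∏ 2 M · e 2 · (∏ 6 M · e 6) · (∏ 8 M · e 8) · (∏ 24 M · e 24))
    ≈⟨ solve 15 (λ a b g₂ g₆ g₈ g₂₄ t p₂ e₂ p₆ e₆ p₈ e₈ p₂₄ e₂₄ →
         a :* (b :* (g₂ :* (g₆ :* (g₈ :* (g₂₄ :* con (+ 1)))))) :* t :* (p₂ :* e₂ :* (p₆ :* e₆) :* (p₈ :* e₈) :* (p₂₄ :* e₂₄)) :=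
         t :* (p₂ :* p₆ :* p₈ :* p₂₄) :* (a :* b) :* (e₂ :* g₂) :* (e₆ :* g₆) :* (e₈ :* g₈) :* (e₂₄ :* g₂₄)) ≈-refl
         (fourth (e 4)) (fourth (e 12)) g₂ g₆ g₈ g₂₄ T (∏ 2 M) (e 2) (∏ 6 M) (e 6) (∏ 8 M) (e 8) (∏ 24 M) (e 24) ⟩
  T · (∏ 2 M · ∏ 6 M · ∏ 8 M · ∏ 24 M) · (fourth (e 4) · fourth (e 12)) · (e 2 · g₂) · (e 6 · g₆) · (e 8 · g₈) · (e 24 · g₂₄)
    ≈⟨ ≈-trans (·-κ1ʳ (1-q^-inverse _)) (≈-trans (·-κ1ʳ (1-q^-inverse _)) (≈-trans (·-κ1ʳ (1-q^-inverse _)) (·-κ1ʳ (1-q^-inverse _)))) ⟩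
  T · (∏ 2 M · ∏ 6 M · ∏ 8 M · ∏ 24 M) · (fourth (e 4) · fourth (e 12))
    ≈⟨ ·-cong (eta₄₈ M) ≈-refl ⟩
  fourth (∏ 4 M) · fourth (∏ 12 M) · (fourth (e 4) · fourth (e 12))
    ≈⟨ solve 4 (λ p r e f → (p :* (p :* (p :* p))) :* (r :* (r :* (r :* r))) :* ((e :* (e :* (e :* e))) :* (f :* (f :* (f :* f)))) :=
         (p :* e :* (p :* e :* (p :* e :* (p :* e)))) :* (r :* f :* (r :* f :* (r :* f :* (r :* f))))) ≈-refl (∏ 4 M) (∏ 12 M) (e 4) (e 12) ⟩
  fourth (∏ 4 (suc M)) · fourth (∏ 12 (suc M)) ∎
  where
  open ≈-Reasoning
  T = etaProdTrunc spec48 M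
  e : ℕ → Series
  e k = 1-q^ (k ℕ.* suc M)
  g₂ = geomS (2 ℕ.* suc M)
  g₆ = geomS (6 ℕ.* suc M)
  g₈ = geomS (8 ℕ.* suc M)
  g₂₄ = geomS (24 ℕ.* suc M)

ψ-at : ∀ c .{{_ : NonZero c}} .{{_ : NonZero (c ℕ.* 1)}} .{{_ : NonZero (c ℕ.* 2)}} → dil c ψ · ∏∞ (c ℕ.* 1) ≈ ∏∞ (c ℕ.* 2) · ∏∞ (c ℕ.* 2)
ψ-at c = begin
  dil c ψ · ∏∞ (c ℕ.* 1) ≈⟨ ·-cong ≈-refl (dil-∏∞ c 1) ⟨
  dil c ψ · dil c (∏∞ 1) ≈⟨ dil-· c ψ (∏∞ 1) ⟨
  dil c (ψ · ∏∞ 1) ≈⟨ dil-cong c ψ-product ⟩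
  dil c (∏∞ 2 · ∏∞ 2) ≈⟨ dil-· c (∏∞ 2) (∏∞ 2) ⟩
  dil c (∏∞ 2) · dil c (∏∞ 2) ≈⟨ ·-cong (dil-∏∞ c 2) (dil-∏∞ c 2) ⟩
  ∏∞ (c ℕ.* 2) · ∏∞ (c ℕ.* 2) ∎
  where open ≈-Reasoning

φ⁻-at : ∀ c .{{_ : NonZero c}} .{{_ : NonZero (c ℕ.* 1)}} .{{_ : NonZero (c ℕ.* 2)}} → dil c φ⁻ · ∏∞ (c ℕ.* 2) ≈ ∏∞ (c ℕ.* 1) · ∏∞ (c ℕ.* 1)
φ⁻-at c = begin
  dil c φ⁻ · ∏∞ (c ℕ.* 2) ≈⟨ ·-cong ≈-refl (dil-∏∞ c 2) ⟨
  dil c φ⁻ · dil c (∏∞ 2) ≈⟨ dil-· c φ⁻ (∏∞ 2) ⟨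
  dil c (φ⁻ · ∏∞ 2) ≈⟨ dil-cong c φ⁻-product ⟩
  dil c (∏∞ 1 · ∏∞ 1) ≈⟨ dil-· c (∏∞ 1) (∏∞ 1) ⟩
  dil c (∏∞ 1) · dil c (∏∞ 1) ≈⟨ ·-cong (dil-∏∞ c 1) (dil-∏∞ c 1) ⟩
  ∏∞ (c ℕ.* 1) · ∏∞ (c ℕ.* 1) ∎
  where open ≈-Reasoning

ψ²-product : ψ² · ∏∞ 2 ≈ ∏∞ 4 · ∏∞ 4
ψ²-product = ≈-trans (·-cong ψ²≈dilψ ≈-refl) (ψ-at 2)

ψ⁶-product : dil 3 ψ² · ∏∞ 6 ≈ ∏∞ 12 · ∏∞ 12
ψ⁶-product = ≈-trans (·-cong (≈-trans (dil-cong 3 ψ²≈dilψ) (dil-dil 3 2 ψ)) ≈-refl) (ψ-at 6)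

∏∞⁴-0 : ∀ j k l m → (∏∞ j · ∏∞ k · ∏∞ l · ∏∞ m) 0 ≡ + 1
∏∞⁴-0 j k l m = trans (·-at-0 _ (∏∞ m)) (cong₂ _*_ (trans (·-at-0 _ (∏∞ l)) (cong₂ _*_ (trans (·-at-0 (∏∞ j) (∏∞ k)) (cong₂ _*_ (∏∞-0 j) (∏∞-0 k))) (∏∞-0 l))) (∏∞-0 m))

-- ψ(q²)ψ(q⁶) φ(-q^c)φ(-q^{3c})
R : (c : ℕ) .{{_ : NonZero c}} → Series
R c = ψ² · dil 3 ψ² · dil c (φ⁻ · dil 3 φ⁻)

dil-φ⁻φ⁻₃ : ∀ c .{{_ : NonZero c}} .{{_ : NonZero (c ℕ.* 3)}} → dil c (φ⁻ · dil 3 φ⁻) ≈ dil c φ⁻ · dil (c ℕ.* 3) φ⁻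
dil-φ⁻φ⁻₃ c = ≈-trans (dil-· c φ⁻ (dil 3 φ⁻)) (·-cong ≈-refl (dil-dil c 3 φ⁻))

-- With E_k = `∏∞ k`, Gauss' formulas give (E₄²/E₂)(E₁₂²/E₆)(E₂²/E₄)(E₆²/E₁₂) = E₂E₄E₆E₁₂. The
-- denominators multiply to the same product, so both sides times it are its square.
τ₂₄ : ∀ n → τ₂,₂₄ (suc n) ≡ R 2 n
τ₂₄ n = trans (at (eta₂₄ n) n) (trans (limit n ℕP.≤-refl) (sym (at R≈ n)))
  where
  limit : ∏ 2 n · ∏ 4 n · ∏ 6 n · ∏ 12 n ≈[ suc n ] ∏∞ 2 · ∏∞ 4 · ∏∞ 6 · ∏∞ 12
  limit = ·-cong-[] (·-cong-[] (·-cong-[] (∏-limit 2 n) (∏-limit 4 n)) (∏-limit 6 n)) (∏-limit 12 n)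
  R≈ : R 2 ≈ ∏∞ 2 · ∏∞ 4 · ∏∞ 6 · ∏∞ 12
  R≈ = ·-cancelʳ (∏∞ 2 · ∏∞ 4 · ∏∞ 6 · ∏∞ 12) (∏∞⁴-0 2 4 6 12) (begin
    R 2 · (∏∞ 2 · ∏∞ 4 · ∏∞ 6 · ∏∞ 12)
      ≈⟨ ·-cong (·-cong ≈-refl (dil-φ⁻φ⁻₃ 2)) ≈-refl ⟩
    ψ² · dil 3 ψ² · (dil 2 φ⁻ · dil 6 φ⁻) · (∏∞ 2 · ∏∞ 4 · ∏∞ 6 · ∏∞ 12)
      ≈⟨ solve 8 (λ a b c d p₂ p₄ p₆ p₁₂ → a :* b :* (c :* d) :* (p₂ :* p₄ :* p₆ :* p₁₂) := (a :* p₂) :* (b :* p₆) :* ((c :* p₄) :* (d :* p₁₂))) ≈-refl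
           ψ² (dil 3 ψ²) (dil 2 φ⁻) (dil 6 φ⁻) (∏∞ 2) (∏∞ 4) (∏∞ 6) (∏∞ 12) ⟩
    (ψ² · ∏∞ 2) · (dil 3 ψ² · ∏∞ 6) · ((dil 2 φ⁻ · ∏∞ 4) · (dil 6 φ⁻ · ∏∞ 12))
      ≈⟨ ·-cong (·-cong ψ²-product ψ⁶-product) (·-cong (φ⁻-at 2) (φ⁻-at 6)) ⟩
    (∏∞ 4 · ∏∞ 4) · (∏∞ 12 · ∏∞ 12) · ((∏∞ 2 · ∏∞ 2) · (∏∞ 6 · ∏∞ 6))
      ≈⟨ solve 4 (λ p₂ p₄ p₆ p₁₂ → (p₄ :* p₄) :* (p₁₂ :* p₁₂) :* ((p₂ :* p₂) :* (p₆ :* p₆)) := p₂ :* p₄ :* p₆ :* p₁₂ :* (p₂ :* p₄ :* p₆ :* p₁₂)) ≈-refl (∏∞ 2) (∏∞ 4) (∏∞ 6) (∏∞ 12) ⟩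
    ∏∞ 2 · ∏∞ 4 · ∏∞ 6 · ∏∞ 12 · (∏∞ 2 · ∏∞ 4 · ∏∞ 6 · ∏∞ 12) ∎)
    where open ≈-Reasoning

-- Here the quotients are (E₄²/E₂)(E₁₂²/E₆)(E₄²/E₈)(E₁₂²/E₂₄), where E_k = `∏∞ k`. The truncated
-- product varies with n, so the cancellation takes place modulo q^(n + 1).
τ₄₈ : ∀ n → τ₂,₄₈ (suc n) ≡ R 4 n
τ₄₈ n = ·-cancelʳ-[] h (∏∞⁴-0 2 6 8 24) ([]-trans (·-cong-[] {suc n} {etaProdTrunc spec48 n} (λ _ _ → refl) ([]-sym limit))
  ([]-trans (≈⇒[] (eta₄₈ n)) ([]-trans (·-cong-[] (fourth-[] (∏-limit 4 n)) (fourth-[] (∏-limit 12 n))) (≈⇒[] (≈-sym R≈))))) n ℕP.≤-refl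
  where
  h = ∏∞ 2 · ∏∞ 6 · ∏∞ 8 · ∏∞ 24
  limit : ∏ 2 n · ∏ 6 n · ∏ 8 n · ∏ 24 n ≈[ suc n ] h
  limit = ·-cong-[] (·-cong-[] (·-cong-[] (∏-limit 2 n) (∏-limit 6 n)) (∏-limit 8 n)) (∏-limit 24 n)
  fourth-[] : ∀ {k f g} → f ≈[ k ] g → fourth f ≈[ k ] fourth g
  fourth-[] p = ·-cong-[] p (·-cong-[] p (·-cong-[] p p))
  R≈ : R 4 · h ≈ fourth (∏∞ 4) · fourth (∏∞ 12)
  R≈ = begin
    R 4 · h
      ≈⟨ ·-cong (·-cong ≈-refl (dil-φ⁻φ⁻₃ 4)) ≈-refl ⟩
    ψ² · dil 3 ψ² · (dil 4 φ⁻ · dil 12 φ⁻) · h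
      ≈⟨ solve 8 (λ a b c d p₂ p₆ p₈ p₂₄ → a :* b :* (c :* d) :* (p₂ :* p₆ :* p₈ :* p₂₄) := (a :* p₂) :* (b :* p₆) :* ((c :* p₈) :* (d :* p₂₄))) ≈-refl
           ψ² (dil 3 ψ²) (dil 4 φ⁻) (dil 12 φ⁻) (∏∞ 2) (∏∞ 6) (∏∞ 8) (∏∞ 24) ⟩
    (ψ² · ∏∞ 2) · (dil 3 ψ² · ∏∞ 6) · ((dil 4 φ⁻ · ∏∞ 8) · (dil 12 φ⁻ · ∏∞ 24))
      ≈⟨ ·-cong (·-cong ψ²-product ψ⁶-product) (·-cong (φ⁻-at 4) (φ⁻-at 12)) ⟩
    (∏∞ 4 · ∏∞ 4) · (∏∞ 12 · ∏∞ 12) · ((∏∞ 4 · ∏∞ 4) · (∏∞ 12 · ∏∞ 12))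
      ≈⟨ solve 2 (λ p r → (p :* p) :* (r :* r) :* ((p :* p) :* (r :* r)) := (p :* (p :* (p :* p))) :* (r :* (r :* (r :* r)))) ≈-refl (∏∞ 4) (∏∞ 12) ⟩
    fourth (∏∞ 4) · fourth (∏∞ 12) ∎
    where open ≈-Reasoning

-- The four products a(q) a(q^b)

aₖ σₖ : (k : ℕ) .{{_ : NonZero k}} → Series
aₖ k = dil k a
σₖ k = dil k σS

a≈a₄+6Y : a ≈ aₖ 4 ⊕ κ (+ 6) · Y
a≈a₄+6Y = ≈-trans a≈a₄+3H (⊕-cong ≈-refl (≈-trans (·-cong ≈-refl H≈2Y) (solve 1 (λ y → con (+ 3) :* (con (+ 2) :* y) := con (+ 6) :* y) ≈-refl Y)))

dil-a≈ : ∀ k .{{_ : NonZero k}} .{{_ : NonZero (k ℕ.* 4)}} → aₖ k ≈ aₖ (k ℕ.* 4) ⊕ κ (+ 6) · dil k Y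
dil-a≈ k = ≈-trans (dil-cong k a≈a₄+6Y) (≈-trans (dil-⊕ k (aₖ 4) (κ (+ 6) · Y)) (⊕-cong (dil-dil k 4 a) (dil-κ· k (+ 6) Y)))

-- Uniqueness was stated for `a` alone; the dissection recovers its companion.
Y≈Yᴸ : Y ≈ Yᴸ
Y≈Yᴸ = κ-cancel (+ 6) (begin
  κ (+ 6) · Y ≈⟨ solve 2 (λ x y → y := x :+ y :+ :- x) ≈-refl (aₖ 4) (κ (+ 6) · Y) ⟩
  aₖ 4 ⊕ κ (+ 6) · Y ⊕ ⊖ aₖ 4 ≈⟨ ⊕-cong (≈-trans (≈-sym a≈a₄+6Y) (≈-trans a≈A A≈A₄+6Y)) (⊖-cong (dil-cong 4 a≈A)) ⟩
  dil 4 A ⊕ κ (+ 6) · Yᴸ ⊕ ⊖ dil 4 A ≈⟨ solve 2 (λ x y → x :+ y :+ :- x := y) ≈-refl (dil 4 A) (κ (+ 6) · Yᴸ) ⟩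
  κ (+ 6) · Yᴸ ∎)
  where open ≈-Reasoning

a² : a · a ≈ κ (+ 1) ⊕ κ (+ 12) · (σS ⊕ ⊖ (κ (+ 3) · σₖ 3))
a² = ≈-trans (·-cong a≈A a≈A) (≈-trans A² (⊕-cong (≈-sym κ-1) ≈-refl))

dil-a² : ∀ k .{{_ : NonZero k}} .{{_ : NonZero (k ℕ.* 3)}} → aₖ k · aₖ k ≈ κ (+ 1) ⊕ κ (+ 12) · (σₖ k ⊕ ⊖ (κ (+ 3) · σₖ (k ℕ.* 3)))
dil-a² k = begin
  aₖ k · aₖ k ≈⟨ dil-· k a a ⟨
  dil k (a · a) ≈⟨ dil-cong k a² ⟩
  dil k (κ (+ 1) ⊕ κ (+ 12) · (σS ⊕ ⊖ (κ (+ 3) · σₖ 3))) ≈⟨ dil-⊕-cong k (dil-κ k (+ 1)) (dil-κ·-cong k (+ 12) (dil-⊕-cong k ≈-refl (dil-⊖-cong k (dil-κ·-cong k (+ 3) (dil-dil k 3 σS))))) ⟩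
  κ (+ 1) ⊕ κ (+ 12) · (σₖ k ⊕ ⊖ (κ (+ 3) · σₖ (k ℕ.* 3))) ∎
  where open ≈-Reasoning

at-⊕ : ∀ {f g n x y} → f n ≡ x → g n ≡ y → (f ⊕ g) n ≡ x + y
at-⊕ {n = n} p q = trans (⊕-at n) (cong₂ _+_ p q)

at-⊖ : ∀ {f g n x y} → f n ≡ x → g n ≡ y → (f ⊕ ⊖ g) n ≡ x - y
at-⊖ {n = n} p q = at-⊕ p (trans (⊖-at n) (cong -_ q))

at-κ : ∀ c {f n x} → f n ≡ x → (κ c · f) n ≡ c * x
at-κ c {f} {n} p = trans (κ-· c f n) (cong (c *_) p)

-- The difference is invariant under q ↦ q², so a nonzero coefficient of positive index would come
-- from one of smaller index.
dil²-unique : ∀ {f g h} → f 0 ≡ g 0 → f ≈ dil 2 f ⊕ h → g ≈ dil 2 g ⊕ h → f ≈ g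
dil²-unique {f} {g} {h} eq₀ f≈ g≈ = vanishes⇒≈ step
  where
  open ≈-Reasoning
  D≈ : f ⊕ ⊖ g ≈ dil 2 (f ⊕ ⊖ g)
  D≈ = begin
    f ⊕ ⊖ g ≈⟨ ⊕-cong f≈ (⊖-cong g≈) ⟩
    dil 2 f ⊕ h ⊕ ⊖ (dil 2 g ⊕ h) ≈⟨ solve 3 (λ f g h → f :+ h :+ :- (g :+ h) := f :+ :- g) ≈-refl (dil 2 f) (dil 2 g) h ⟩
    dil 2 f ⊕ ⊖ dil 2 g ≈⟨ ≈-trans (dil-⊕ 2 f (⊖ g)) (⊕-cong ≈-refl (dil-⊖ 2 g)) ⟨
    dil 2 (f ⊕ ⊖ g) ∎
  step : ∀ k → VanishesBelow k (f ⊕ ⊖ g) → (f ⊕ ⊖ g) k ≡ + 0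
  step zero    _   = trans (⊕-at 0) (trans (+-congʳ (f 0) (⊖-at 0)) (trans (cong (_- g 0) eq₀) (ℤP.+-inverseʳ (g 0))))
  step (suc k) D≡0 = trans (at D≈ (suc k)) (dil-vanishes 2 D≡0 (suc k) (ℕP.m<m+n (suc k) (s≤s z≤n)))

-- In (a(q⁴) + 6Y) a(q²) the first part is the product sought, taken at q². The closed form
-- satisfies the same recursion, and the constant terms agree.
aa₂ : a · aₖ 2 ≈ κ (+ 1) ⊕ κ (+ 6) · (σS ⊕ ⊖ (κ (+ 2) · σₖ 2) ⊕ κ (+ 3) · σₖ 3 ⊕ ⊖ (κ (+ 6) · σₖ 6))
aa₂ = dil²-unique {h = κ (+ 6) · (σᵒ ⊕ κ (+ 3) · dil 3 σᵒ)} eq₀ left right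
  where
  open ≈-Reasoning
  f = σS ⊕ ⊖ (κ (+ 2) · σₖ 2) ⊕ κ (+ 3) · σₖ 3 ⊕ ⊖ (κ (+ 6) · σₖ 6)
  dil-0 : ∀ k .{{_ : NonZero k}} g → dil k g 0 ≡ g 0
  dil-0 k g = trans (cong (dil k g) (sym (ℕP.*-zeroʳ k))) (dil-multiple k g 0)
  f₀ : f 0 ≡ + 0
  f₀ = at-⊖ (at-⊕ (at-⊖ {σS} refl (at-κ (+ 2) (dil-0 2 σS))) (at-κ (+ 3) (dil-0 3 σS))) (at-κ (+ 6) (dil-0 6 σS))
  eq₀ : (a · aₖ 2) 0 ≡ (κ (+ 1) ⊕ κ (+ 6) · f) 0
  eq₀ = trans (trans (·-at-0 a (aₖ 2)) (cong (+ 1 *_) (dil-0 2 a)))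
    (sym (at-⊕ (κ-zero (+ 1)) (at-κ (+ 6) f₀)))
  left : a · aₖ 2 ≈ dil 2 (a · aₖ 2) ⊕ κ (+ 6) · (σᵒ ⊕ κ (+ 3) · dil 3 σᵒ)
  left = begin
    a · aₖ 2 ≈⟨ ·-cong a≈a₄+6Y ≈-refl ⟩
    (aₖ 4 ⊕ κ (+ 6) · Y) · aₖ 2 ≈⟨ solve 3 (λ a y b → (a :+ con (+ 6) :* y) :* b := b :* a :+ con (+ 6) :* (y :* b)) ≈-refl (aₖ 4) Y (aₖ 2) ⟩
    aₖ 2 · aₖ 4 ⊕ κ (+ 6) · (Y · aₖ 2) ≈⟨ ⊕-cong (≈-sym (≈-trans (dil-· 2 a (aₖ 2)) (·-cong ≈-refl (dil-dil 2 2 a))))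
        (·-cong ≈-refl (≈-trans (·-cong Y≈Yᴸ (dil-cong 2 a≈A)) YA₂)) ⟩
    dil 2 (a · aₖ 2) ⊕ κ (+ 6) · (σᵒ ⊕ κ (+ 3) · dil 3 σᵒ) ∎
  dil-f : dil 2 f ≈ σₖ 2 ⊕ ⊖ (κ (+ 2) · σₖ 4) ⊕ κ (+ 3) · σₖ 6 ⊕ ⊖ (κ (+ 6) · σₖ 12)
  dil-f = dil-⊕-cong 2 (dil-⊕-cong 2 (dil-⊕-cong 2 ≈-refl (dil-⊖-cong 2 (dil-κ·-cong 2 (+ 2) (dil-dil 2 2 σS))))
    (dil-κ·-cong 2 (+ 3) (dil-dil 2 3 σS))) (dil-⊖-cong 2 (dil-κ·-cong 2 (+ 6) (dil-dil 2 6 σS)))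
  dil-σᵒ : dil 3 σᵒ ≈ σₖ 3 ⊕ ⊖ (κ (+ 3) · σₖ 6) ⊕ κ (+ 2) · σₖ 12
  dil-σᵒ = ≈-trans (dil-cong 3 σᵒ≈) (dil-⊕-cong 3 (dil-⊕-cong 3 ≈-refl (dil-⊖-cong 3 (dil-κ·-cong 3 (+ 3) (dil-dil 3 2 σS))))
    (dil-κ·-cong 3 (+ 2) (dil-dil 3 4 σS)))
  right : κ (+ 1) ⊕ κ (+ 6) · f ≈ dil 2 (κ (+ 1) ⊕ κ (+ 6) · f) ⊕ κ (+ 6) · (σᵒ ⊕ κ (+ 3) · dil 3 σᵒ)
  right = begin
    κ (+ 1) ⊕ κ (+ 6) · f
      ≈⟨ solve 6 (λ s₁ s₂ s₃ s₄ s₆ s₁₂ → con (+ 1) :+ con (+ 6) :* (s₁ :+ :- (con (+ 2) :* s₂) :+ con (+ 3) :* s₃ :+ :- (con (+ 6) :* s₆)) :=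
           con (+ 1) :+ con (+ 6) :* (s₂ :+ :- (con (+ 2) :* s₄) :+ con (+ 3) :* s₆ :+ :- (con (+ 6) :* s₁₂))
           :+ con (+ 6) :* (s₁ :+ :- (con (+ 3) :* s₂) :+ con (+ 2) :* s₄ :+ con (+ 3) :* (s₃ :+ :- (con (+ 3) :* s₆) :+ con (+ 2) :* s₁₂))) ≈-refl
           σS (σₖ 2) (σₖ 3) (σₖ 4) (σₖ 6) (σₖ 12) ⟩
    κ (+ 1) ⊕ κ (+ 6) · (σₖ 2 ⊕ ⊖ (κ (+ 2) · σₖ 4) ⊕ κ (+ 3) · σₖ 6 ⊕ ⊖ (κ (+ 6) · σₖ 12))
      ⊕ κ (+ 6) · (σS ⊕ ⊖ (κ (+ 3) · σₖ 2) ⊕ κ (+ 2) · σₖ 4 ⊕ κ (+ 3) · (σₖ 3 ⊕ ⊖ (κ (+ 3) · σₖ 6) ⊕ κ (+ 2) · σₖ 12))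
      ≈⟨ ⊕-cong (≈-trans (dil-⊕ 2 _ _) (⊕-cong (dil-κ 2 (+ 1)) (≈-trans (dil-κ· 2 (+ 6) f) (·-cong ≈-refl dil-f))))
                (·-cong ≈-refl (⊕-cong σᵒ≈ (·-cong ≈-refl dil-σᵒ))) ⟨
    dil 2 (κ (+ 1) ⊕ κ (+ 6) · f) ⊕ κ (+ 6) · (σᵒ ⊕ κ (+ 3) · dil 3 σᵒ) ∎

dil-aa₂ : ∀ k .{{_ : NonZero k}} .{{_ : NonZero (k ℕ.* 2)}} .{{_ : NonZero (k ℕ.* 3)}} .{{_ : NonZero (k ℕ.* 6)}} →
  aₖ k · aₖ (k ℕ.* 2) ≈ κ (+ 1) ⊕ κ (+ 6) · (σₖ k ⊕ ⊖ (κ (+ 2) · σₖ (k ℕ.* 2)) ⊕ κ (+ 3) · σₖ (k ℕ.* 3) ⊕ ⊖ (κ (+ 6) · σₖ (k ℕ.* 6)))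
dil-aa₂ k = begin
  aₖ k · aₖ (k ℕ.* 2) ≈⟨ ·-cong ≈-refl (dil-dil k 2 a) ⟨
  aₖ k · dil k (aₖ 2) ≈⟨ dil-· k a (aₖ 2) ⟨
  dil k (a · aₖ 2) ≈⟨ dil-cong k aa₂ ⟩
  dil k (κ (+ 1) ⊕ κ (+ 6) · (σS ⊕ ⊖ (κ (+ 2) · σₖ 2) ⊕ κ (+ 3) · σₖ 3 ⊕ ⊖ (κ (+ 6) · σₖ 6)))
        ≈⟨ dil-⊕-cong k (dil-κ k (+ 1)) (dil-κ·-cong k (+ 6) (dil-⊕-cong k (dil-⊕-cong k (dil-⊕-cong k ≈-refl (dil-⊖-cong k (dil-κ·-cong k (+ 2) (dil-dil k 2 σS))))
      (dil-κ·-cong k (+ 3) (dil-dil k 3 σS))) (dil-⊖-cong k (dil-κ·-cong k (+ 6) (dil-dil k 6 σS))))) ⟩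
  κ (+ 1) ⊕ κ (+ 6) · (σₖ k ⊕ ⊖ (κ (+ 2) · σₖ (k ℕ.* 2)) ⊕ κ (+ 3) · σₖ (k ℕ.* 3) ⊕ ⊖ (κ (+ 6) · σₖ (k ℕ.* 6))) ∎
  where open ≈-Reasoning

-- The conic reads 3 a(q²)² = a(q)² - 2 a(q) a(q⁴) + 4 a(q⁴)².
aa₄′ : κ (+ 2) · (a · aₖ 4) ≈ a · a ⊕ κ (+ 4) · (aₖ 4 · aₖ 4) ⊕ ⊖ (κ (+ 3) · (aₖ 2 · aₖ 2))
aa₄′ = begin
  κ (+ 2) · (a · aₖ 4)
    ≈⟨ ·-cong ≈-refl (·-cong a≈a₄+6Y ≈-refl) ⟩
  κ (+ 2) · ((aₖ 4 ⊕ κ (+ 6) · Y) · aₖ 4)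
    ≈⟨ solve 2 (λ b y → con (+ 2) :* ((b :+ con (+ 6) :* y) :* b) := (b :+ con (+ 6) :* y) :* (b :+ con (+ 6) :* y) :+ con (+ 4) :* (b :* b) :+ :- (con (+ 3) :* (b :* b :+ con (+ 3) :* ((con (+ 2) :* y) :* (con (+ 2) :* y))))) ≈-refl (aₖ 4) Y ⟩
  (aₖ 4 ⊕ κ (+ 6) · Y) · (aₖ 4 ⊕ κ (+ 6) · Y) ⊕ κ (+ 4) · (aₖ 4 · aₖ 4) ⊕ ⊖ (κ (+ 3) · (aₖ 4 · aₖ 4 ⊕ κ (+ 3) · (κ (+ 2) · Y · (κ (+ 2) · Y))))
    ≈⟨ ⊕-cong (⊕-cong (·-cong a≈a₄+6Y a≈a₄+6Y) ≈-refl) (⊖-cong (·-cong ≈-refl (≈-trans (≈-sym (dil-· 2 a a)) (≈-trans conic (⊕-cong ≈-refl (·-cong ≈-refl (·-cong H≈2Y H≈2Y))))))) ⟨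
  a · a ⊕ κ (+ 4) · (aₖ 4 · aₖ 4) ⊕ ⊖ (κ (+ 3) · (aₖ 2 · aₖ 2)) ∎
  where open ≈-Reasoning

aa₄ : a · aₖ 4 ≈ κ (+ 1) ⊕ κ (+ 6) · (σS ⊕ ⊖ (κ (+ 3) · σₖ 2) ⊕ ⊖ (κ (+ 3) · σₖ 3) ⊕ κ (+ 4) · σₖ 4 ⊕ κ (+ 9) · σₖ 6 ⊕ ⊖ (κ (+ 12) · σₖ 12))
aa₄ = κ-cancel (+ 2) (≈-trans aa₄′ (≈-trans (⊕-cong (⊕-cong a² (·-cong ≈-refl (dil-a² 4))) (⊖-cong (·-cong ≈-refl (dil-a² 2))))
  (solve 6 (λ s₁ s₂ s₃ s₄ s₆ s₁₂ →
    con (+ 1) :+ con (+ 12) :* (s₁ :+ :- (con (+ 3) :* s₃)) :+ con (+ 4) :* (con (+ 1) :+ con (+ 12) :* (s₄ :+ :- (con (+ 3) :* s₁₂))) :+ :- (con (+ 3) :* (con (+ 1) :+ con (+ 12) :* (s₂ :+ :- (con (+ 3) :* s₆))))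
    := con (+ 2) :* (con (+ 1) :+ con (+ 6) :* (s₁ :+ :- (con (+ 3) :* s₂) :+ :- (con (+ 3) :* s₃) :+ con (+ 4) :* s₄ :+ con (+ 9) :* s₆ :+ :- (con (+ 12) :* s₁₂)))) ≈-refl
    σS (σₖ 2) (σₖ 3) (σₖ 4) (σₖ 6) (σₖ 12))))

dil-aa₄ : aₖ 4 · aₖ 16 ≈ κ (+ 1) ⊕ κ (+ 6) · (σₖ 4 ⊕ ⊖ (κ (+ 3) · σₖ 8) ⊕ ⊖ (κ (+ 3) · σₖ 12) ⊕ κ (+ 4) · σₖ 16 ⊕ κ (+ 9) · σₖ 24 ⊕ ⊖ (κ (+ 12) · σₖ 48))
dil-aa₄ = begin
  aₖ 4 · aₖ 16 ≈⟨ ·-cong ≈-refl (dil-dil 4 4 a) ⟨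
  aₖ 4 · dil 4 (aₖ 4) ≈⟨ dil-· 4 a (aₖ 4) ⟨
  dil 4 (a · aₖ 4) ≈⟨ dil-cong 4 aa₄ ⟩
  dil 4 (κ (+ 1) ⊕ κ (+ 6) · (σS ⊕ ⊖ (κ (+ 3) · σₖ 2) ⊕ ⊖ (κ (+ 3) · σₖ 3) ⊕ κ (+ 4) · σₖ 4 ⊕ κ (+ 9) · σₖ 6 ⊕ ⊖ (κ (+ 12) · σₖ 12)))
        ≈⟨ dil-⊕-cong 4 (dil-κ 4 (+ 1)) (dil-κ·-cong 4 (+ 6) (dil-⊕-cong 4 (dil-⊕-cong 4 (dil-⊕-cong 4 (dil-⊕-cong 4 (dil-⊕-cong 4 ≈-refl (dil-⊖-cong 4 (dil-κ·-cong 4 (+ 3) (dil-dil 4 2 σS))))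
        (dil-⊖-cong 4 (dil-κ·-cong 4 (+ 3) (dil-dil 4 3 σS)))) (dil-κ·-cong 4 (+ 4) (dil-dil 4 4 σS))) (dil-κ·-cong 4 (+ 9) (dil-dil 4 6 σS))) (dil-⊖-cong 4 (dil-κ·-cong 4 (+ 12) (dil-dil 4 12 σS))))) ⟩
  κ (+ 1) ⊕ κ (+ 6) · (σₖ 4 ⊕ ⊖ (κ (+ 3) · σₖ 8) ⊕ ⊖ (κ (+ 3) · σₖ 12) ⊕ κ (+ 4) · σₖ 16 ⊕ κ (+ 9) · σₖ 24 ⊕ ⊖ (κ (+ 12) · σₖ 48)) ∎
  where open ≈-Reasoning

-- The factor q completes ψ(q²) ψ(q⁶) to `Y`, and the product of the two φ is a(q⁴) - 2Y taken at
-- q^k.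
mono·R : ∀ k .{{_ : NonZero k}} .{{_ : NonZero (k ℕ.* 4)}} → mono 1 · R k ≈ Y · (aₖ (k ℕ.* 4) ⊕ ⊖ (κ (+ 2) · dil k Y))
mono·R k = begin
  mono 1 · (ψ² · dil 3 ψ² · dil k (φ⁻ · dil 3 φ⁻)) ≈⟨ ·-assoc (mono 1) (ψ² · dil 3 ψ²) _ ⟨
  Y · dil k (φ⁻ · dil 3 φ⁻) ≈⟨ ·-cong ≈-refl (dil-cong k (≈-trans φ⁻φ⁻₃≈a₄-H (⊕-cong ≈-refl (⊖-cong H≈2Y)))) ⟩
  Y · dil k (aₖ 4 ⊕ ⊖ (κ (+ 2) · Y)) ≈⟨ ·-cong ≈-refl (≈-trans (dil-⊕ k (aₖ 4) _) (⊕-cong (dil-dil k 4 a) (≈-trans (dil-⊖ k _) (⊖-cong (dil-κ· k (+ 2) Y))))) ⟩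
  Y · (aₖ (k ℕ.* 4) ⊕ ⊖ (κ (+ 2) · dil k Y)) ∎
  where open ≈-Reasoning

-- Twice the product is given because half-integers occur in its divisor-sum expansion; the proof
-- needs a further factor 2 and cancels it.
aa₈ : κ (+ 2) · (a · aₖ 8) ≈ κ (+ 2) ⊕ (κ (+ 3) · σS ⊕ ⊖ (κ (+ 9) · σₖ 2) ⊕ κ (+ 9) · σₖ 3 ⊕ κ (+ 18) · σₖ 4
  ⊕ ⊖ (κ (+ 27) · σₖ 6) ⊕ ⊖ (κ (+ 24) · σₖ 8) ⊕ κ (+ 54) · σₖ 12 ⊕ ⊖ (κ (+ 72) · σₖ 24) ⊕ κ (+ 9) · (mono 1 · R 2))
aa₈ = κ-cancel (+ 2) (begin
  κ (+ 2) · (κ (+ 2) · (a · aₖ 8))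
    ≈⟨ ·-cong ≈-refl (·-cong ≈-refl (·-cong a≈a₄+6Y ≈-refl)) ⟩
  κ (+ 2) · (κ (+ 2) · ((aₖ 4 ⊕ κ (+ 6) · Y) · aₖ 8))
    -- The first two products leave 6 Y(q) a(q²) = 6 Y(q) a(q⁸) + 36 Y(q) Y(q²). Adding 18 Y(q)
    -- (a(q⁸) - 2 Y(q²)) removes the mixed term and leaves 24 Y(q) a(q⁸), which is 4 · 6 as
    -- required.
    ≈⟨ solve 4 (λ a₄ y a₈ y₂ → con (+ 2) :* (con (+ 2) :* ((a₄ :+ con (+ 6) :* y) :* a₈)) :=
         (a₄ :+ con (+ 6) :* y) :* (a₈ :+ con (+ 6) :* y₂) :+ :- ((a₈ :+ con (+ 6) :* y₂) :* a₄) :+ con (+ 4) :* (a₄ :* a₈) :+ con (+ 18) :* (y :* (a₈ :+ :- (con (+ 2) :* y₂)))) ≈-refl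
         (aₖ 4) Y (aₖ 8) (dil 2 Y) ⟩
  (aₖ 4 ⊕ κ (+ 6) · Y) · (aₖ 8 ⊕ κ (+ 6) · dil 2 Y) ⊕ ⊖ ((aₖ 8 ⊕ κ (+ 6) · dil 2 Y) · aₖ 4) ⊕ κ (+ 4) · (aₖ 4 · aₖ 8) ⊕ κ (+ 18) · (Y · (aₖ 8 ⊕ ⊖ (κ (+ 2) · dil 2 Y)))
    ≈⟨ ⊕-cong (⊕-cong (⊕-cong (·-cong a≈a₄+6Y (dil-a≈ 2)) (⊖-cong (·-cong (dil-a≈ 2) ≈-refl))) ≈-refl) (·-cong ≈-refl (mono·R 2)) ⟨
  a · aₖ 2 ⊕ ⊖ (aₖ 2 · aₖ 4) ⊕ κ (+ 4) · (aₖ 4 · aₖ 8) ⊕ κ (+ 18) · (mono 1 · R 2)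
    ≈⟨ ⊕-cong (⊕-cong (⊕-cong aa₂ (⊖-cong (dil-aa₂ 2))) (·-cong ≈-refl (dil-aa₂ 4))) ≈-refl ⟩
  _ ≈⟨ solve 9 (λ s₁ s₂ s₃ s₄ s₆ s₈ s₁₂ s₂₄ t →
         con (+ 1) :+ con (+ 6) :* (s₁ :+ :- (con (+ 2) :* s₂) :+ con (+ 3) :* s₃ :+ :- (con (+ 6) :* s₆))
         :+ :- (con (+ 1) :+ con (+ 6) :* (s₂ :+ :- (con (+ 2) :* s₄) :+ con (+ 3) :* s₆ :+ :- (con (+ 6) :* s₁₂)))
         :+ con (+ 4) :* (con (+ 1) :+ con (+ 6) :* (s₄ :+ :- (con (+ 2) :* s₈) :+ con (+ 3) :* s₁₂ :+ :- (con (+ 6) :* s₂₄)))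
         :+ con (+ 18) :* t :=
         con (+ 2) :* (con (+ 2) :+ (con (+ 3) :* s₁ :+ :- (con (+ 9) :* s₂) :+ con (+ 9) :* s₃ :+ con (+ 18) :* s₄
           :+ :- (con (+ 27) :* s₆) :+ :- (con (+ 24) :* s₈) :+ con (+ 54) :* s₁₂ :+ :- (con (+ 72) :* s₂₄) :+ con (+ 9) :* t))) ≈-refl
         σS (σₖ 2) (σₖ 3) (σₖ 4) (σₖ 6) (σₖ 8) (σₖ 12) (σₖ 24) (mono 1 · R 2) ⟩
  _ ∎)
  where open ≈-Reasoning

aa₁₆ : κ (+ 2) · (a · aₖ 16) ≈ κ (+ 2) ⊕ (κ (+ 3) · σS ⊕ ⊖ (κ (+ 9) · σₖ 2) ⊕ ⊖ (κ (+ 9) · σₖ 3) ⊕ κ (+ 18) · σₖ 4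
  ⊕ κ (+ 27) · σₖ 6 ⊕ ⊖ (κ (+ 36) · σₖ 8) ⊕ ⊖ (κ (+ 54) · σₖ 12) ⊕ κ (+ 48) · σₖ 16 ⊕ κ (+ 108) · σₖ 24 ⊕ ⊖ (κ (+ 144) · σₖ 48) ⊕ κ (+ 9) · (mono 1 · R 4))
aa₁₆ = κ-cancel (+ 2) (begin
  κ (+ 2) · (κ (+ 2) · (a · aₖ 16))
    ≈⟨ ·-cong ≈-refl (·-cong ≈-refl (·-cong (≈-trans a≈a₄+6Y (⊕-cong (dil-a≈ 4) ≈-refl)) ≈-refl)) ⟩
  κ (+ 2) · (κ (+ 2) · ((aₖ 16 ⊕ κ (+ 6) · dil 4 Y ⊕ κ (+ 6) · Y) · aₖ 16))
    -- The same elimination with a(q⁴) = a(q¹⁶) + 6 Y(q⁴) in place of a(q²) removes 36 Y(q) Y(q⁴).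
    ≈⟨ solve 3 (λ y a₁₆ y₄ → let a₄ = a₁₆ :+ con (+ 6) :* y₄ in con (+ 2) :* (con (+ 2) :* ((a₄ :+ con (+ 6) :* y) :* a₁₆)) :=
         (a₄ :+ con (+ 6) :* y) :* a₄ :+ :- (a₄ :* a₄) :+ con (+ 4) :* (a₄ :* a₁₆) :+ con (+ 18) :* (y :* (a₁₆ :+ :- (con (+ 2) :* y₄)))) ≈-refl
         Y (aₖ 16) (dil 4 Y) ⟩
  _ ≈⟨ ⊕-cong (⊕-cong (⊕-cong (·-cong (≈-trans a≈a₄+6Y (⊕-cong (dil-a≈ 4) ≈-refl)) (dil-a≈ 4)) (⊖-cong (·-cong (dil-a≈ 4) (dil-a≈ 4)))) (·-cong ≈-refl (·-cong (dil-a≈ 4) ≈-refl))) (·-cong ≈-refl (mono·R 4)) ⟨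
  a · aₖ 4 ⊕ ⊖ (aₖ 4 · aₖ 4) ⊕ κ (+ 4) · (aₖ 4 · aₖ 16) ⊕ κ (+ 18) · (mono 1 · R 4)
    ≈⟨ ⊕-cong (⊕-cong (⊕-cong aa₄ (⊖-cong (dil-a² 4))) (·-cong ≈-refl dil-aa₄)) ≈-refl ⟩
  _ ≈⟨ solve 11 (λ s₁ s₂ s₃ s₄ s₆ s₈ s₁₂ s₁₆ s₂₄ s₄₈ t →
         con (+ 1) :+ con (+ 6) :* (s₁ :+ :- (con (+ 3) :* s₂) :+ :- (con (+ 3) :* s₃) :+ con (+ 4) :* s₄ :+ con (+ 9) :* s₆ :+ :- (con (+ 12) :* s₁₂))
         :+ :- (con (+ 1) :+ con (+ 12) :* (s₄ :+ :- (con (+ 3) :* s₁₂)))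
         :+ con (+ 4) :* (con (+ 1) :+ con (+ 6) :* (s₄ :+ :- (con (+ 3) :* s₈) :+ :- (con (+ 3) :* s₁₂) :+ con (+ 4) :* s₁₆ :+ con (+ 9) :* s₂₄ :+ :- (con (+ 12) :* s₄₈)))
         :+ con (+ 18) :* t :=
         con (+ 2) :* (con (+ 2) :+ (con (+ 3) :* s₁ :+ :- (con (+ 9) :* s₂) :+ :- (con (+ 9) :* s₃) :+ con (+ 18) :* s₄ :+ con (+ 27) :* s₆ :+ :- (con (+ 36) :* s₈)
           :+ :- (con (+ 54) :* s₁₂) :+ con (+ 48) :* s₁₆ :+ con (+ 108) :* s₂₄ :+ :- (con (+ 144) :* s₄₈) :+ con (+ 9) :* t))) ≈-refl
         σS (σₖ 2) (σₖ 3) (σₖ 4) (σₖ 6) (σₖ 8) (σₖ 12) (σₖ 16) (σₖ 24) (σₖ 48) (mono 1 · R 4) ⟩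
  _ ∎)
  where open ≈-Reasoning

-- Divisor sums, solution counts and the formulas

σS≡σ : ∀ n → σS n ≡ + σ n
σS≡σ n = begin
  σS n ≡⟨ ⟦⟧-list divisorPairs (λ (d , e) → + suc d) n unique sound complete ⟩
  sumL (λ (d , e) → + suc d) (map pair (filter divides? (upTo n))) ≡⟨ sumL-map (λ (d , e) → + suc d) pair (filter divides? (upTo n)) ⟩
  sumL (λ i → + suc i) (filter divides? (upTo n)) ≡⟨ sumL-cong (filter divides? (upTo n)) (λ {i} p → on i (proj₂ (∈-filter⁻ divides? {xs = upTo n} p))) ⟩
  sumL (λ i → + h i) (filter divides? (upTo n)) ≡⟨ sumL-filter divides? (λ i → + h i) off (upTo n) ⟩
  sumL (λ i → + h i) (upTo n) ≡⟨ sum-pos (upTo n) ⟩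
  + σ n ∎
  where
  open ≡-Reasoning
  divides? : ∀ i → Dec (suc i ∣ n)
  divides? i = suc i ∣? n
  h : ℕ → ℕ
  h i = if does (suc i ∣? n) then suc i else 0
  -- A divisor determines its cofactor; both are stored shifted by one, hence the predecessor.
  pair : ℕ → ℕ × ℕ
  pair i = i , ℕ.pred (n / suc i)
  on : ∀ i → suc i ∣ n → + suc i ≡ + h i
  on i i∣n = cong (λ b → + (if b then suc i else 0)) (sym (dec-true (suc i ∣? n) i∣n))
  off : ∀ i → ¬ (suc i ∣ n) → + h i ≡ + 0
  off i i∤n = cong (λ b → + (if b then suc i else 0)) (dec-false (suc i ∣? n) i∤n)
  sum-pos : ∀ xs → sumL (λ i → + h i) xs ≡ + foldr ℕ._+_ 0 (map h xs)
  sum-pos []       = refl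
  sum-pos (x ∷ xs) = +-congʳ (+ h x) (sum-pos xs)
  unique : Unique (map pair (filter divides? (upTo n)))
  unique = Uniq.map⁺ (cong proj₁) (Uniq.filter⁺ divides? (Uniq.upTo⁺ n))
  quotient : ∀ d e → suc d ℕ.* suc e ≡ n → n / suc d ≡ suc e
  quotient d e refl = trans (cong (_/ suc d) (ℕP.*-comm (suc d) (suc e))) (m*n/n≡m (suc e) (suc d))
  sound : ∀ {p} → p ∈ map pair (filter divides? (upTo n)) → wt divisorPairs p ≡ n
  sound p∈ with ∈-map⁻ pair p∈
  ... | i , i∈ , refl with ∈-filter⁻ divides? {xs = upTo n} i∈
  -- Cofactor 0 would mean n = 0, which has no candidate i < n.
  ...   | i<n , divides zero    eq = ⊥-elim (ℕP.n≮0 (subst (i <_) eq (∈-upTo⁻ i<n)))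
  ...   | _   , divides (suc q) eq = trans (cong (λ z → suc i ℕ.* suc (ℕ.pred z)) (quotient i q (trans (ℕP.*-comm (suc i) (suc q)) (sym eq))))
        (trans (ℕP.*-comm (suc i) (suc q)) (sym eq))
  complete : ∀ p → wt divisorPairs p ≡ n → p ∈ map pair (filter divides? (upTo n))
  complete (d , e) eq = subst (λ z → (d , z) ∈ map pair (filter divides? (upTo n))) (cong ℕ.pred (quotient d e eq))
    (∈-map⁺ pair (∈-filter⁺ divides? (∈-upTo⁺ (subst (suc d ≤_) eq (ℕP.m≤m*n (suc d) (suc e)))) (divides (suc e) (trans (sym eq) (ℕP.*-comm (suc d) (suc e))))))

σₖ-at : ∀ k .{{_ : NonZero k}} n → σₖ k n ≡ σ[ n / k ]
σₖ-at k n = trans (dil-at k σS n) (cong (λ z → if does (k ∣? n) then z else + 0) (σS≡σ (n / k)))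

σS-at : ∀ n → σS n ≡ σ[ n / 1 ]
σS-at n = trans (trans (sym (dil-multiple 1 σS n)) (cong (dil 1 σS) (ℕP.*-identityˡ n))) (σₖ-at 1 n)

-- The fibre over n in the product class is already a repetition-free list of the solutions, and its
-- length is the coefficient because every solution has weight one. `Q≥0` makes passing to
-- natural-number weights harmless.
count : ∀ b .{{_ : NonZero b}} n → Σ ℕ λ k → (𝒩₂[ 1 , b , n ]≡ k) × (+ k ≡ (a · aₖ b) n)
count b n = length solutions , (solutions , unique , (λ x → mk⇔ sound (complete x)) , refl) , trans (cong +_ (length-map flatten (fibre w n))) (trans (sym (length≡sumL (fibre w n)))
  (at (≈-trans (⟦⊗⟧ hexagonal (scale b hexagonal) one one) (·-cong ≈-refl (⟦scale⟧ b hexagonal one))) n))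
  where
  w = hexagonal ⊗ scale b hexagonal
  flatten : (ℤ × ℤ) × (ℤ × ℤ) → ℤ⁴
  flatten ((x₁ , x₂) , (x₃ , x₄)) = x₁ , x₂ , x₃ , x₄
  solutions = map flatten (fibre w n)
  length≡sumL : ∀ {I : Set} (xs : List I) → sumL one xs ≡ + length xs
  length≡sumL []       = refl
  length≡sumL (x ∷ xs) = +-congʳ (+ 1) (length≡sumL xs)
  weight : ∀ x₁ x₂ x₃ x₄ → + 1 * Q x₁ x₂ + + b * Q x₃ x₄ ≡ + wt w ((x₁ , x₂) , (x₃ , x₄))
  weight x₁ x₂ x₃ x₄ = cong₂ _+_ (trans (ℤP.*-identityˡ (Q x₁ x₂)) (sym (Q≥0 x₁ x₂)))
    (trans (cong (+ b *_) (sym (Q≥0 x₃ x₄))) (sym (ℤP.pos-* b ∣ Q x₃ x₄ ∣)))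
  unique : Unique solutions
  unique = Uniq.map⁺ (λ {x} {y} → flatten-injective {x} {y}) (fibre-unique w n)
    where
    flatten-injective : ∀ {x y} → flatten x ≡ flatten y → x ≡ y
    flatten-injective refl = refl
  sound : ∀ {x} → x ∈ solutions → _
  sound x∈ with ∈-map⁻ flatten x∈
  ... | ((x₁ , x₂) , (x₃ , x₄)) , p , refl = trans (weight x₁ x₂ x₃ x₄) (cong +_ (∈-fibre⁻ w p))
  complete : ∀ x → _ → x ∈ solutions
  complete (x₁ , x₂ , x₃ , x₄) eq = ∈-map⁺ flatten (∈-fibre⁺ w ((x₁ , x₂) , (x₃ , x₄)) (ℤP.+-injective (trans (sym (weight x₁ x₂ x₃ x₄)) eq)))

-- For n ≥ 1 the constant term of the series, which stands for the zero vector, drops out of the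
-- formulas.
κ-positive : ∀ c {n} → 1 ≤ n → κ c n ≡ + 0
κ-positive c (s≤s {n = m} _) = κ-suc c m

module _ (n : ℕ) (1≤n : 1 ≤ n) {x₁ x₂ x₃ x₆ : ℤ} (s₁ : σS n ≡ x₁) (s₂ : σₖ 2 n ≡ x₂) (s₃ : σₖ 3 n ≡ x₃) (s₆ : σₖ 6 n ≡ x₆) where

  aa₂-at : (a · aₖ 2) n ≡ + 6 * x₁ - + 12 * x₂ + + 18 * x₃ - + 36 * x₆
  aa₂-at = trans (at aa₂ n) (trans (at-⊕ (κ-positive (+ 1) 1≤n)
    (at-κ (+ 6) (at-⊖ (at-⊕ (at-⊖ s₁ (at-κ (+ 2) s₂)) (at-κ (+ 3) s₃)) (at-κ (+ 6) s₆))))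
    (expand x₁ x₂ x₃ x₆))
    where
    expand : ∀ x₁ x₂ x₃ x₆ → + 0 + + 6 * (x₁ - + 2 * x₂ + + 3 * x₃ - + 6 * x₆) ≡ + 6 * x₁ - + 12 * x₂ + + 18 * x₃ - + 36 * x₆
    expand = solve-∀

  module _ {x₄ x₁₂ : ℤ} (s₄ : σₖ 4 n ≡ x₄) (s₁₂ : σₖ 12 n ≡ x₁₂) where

    aa₄-at : (a · aₖ 4) n ≡ + 6 * x₁ - + 18 * x₂ - + 18 * x₃ + + 24 * x₄ + + 54 * x₆ - + 72 * x₁₂
    aa₄-at = trans (at aa₄ n) (trans (at-⊕ (κ-positive (+ 1) 1≤n)
      (at-κ (+ 6) (at-⊖ (at-⊕ (at-⊕ (at-⊖ (at-⊖ s₁ (at-κ (+ 3) s₂)) (at-κ (+ 3) s₃)) (at-κ (+ 4) s₄)) (at-κ (+ 9) s₆)) (at-κ (+ 12) s₁₂))))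
      (expand x₁ x₂ x₃ x₄ x₆ x₁₂))
      where
      expand : ∀ x₁ x₂ x₃ x₄ x₆ x₁₂ → + 0 + + 6 * (x₁ - + 3 * x₂ - + 3 * x₃ + + 4 * x₄ + + 9 * x₆ - + 12 * x₁₂) ≡
        + 6 * x₁ - + 18 * x₂ - + 18 * x₃ + + 24 * x₄ + + 54 * x₆ - + 72 * x₁₂
      expand = solve-∀

    module _ {x₈ x₂₄ : ℤ} (s₈ : σₖ 8 n ≡ x₈) (s₂₄ : σₖ 24 n ≡ x₂₄) where

      aa₈-at : ∀ {t} → (mono 1 · R 2) n ≡ t → + 2 * (a · aₖ 8) n ≡
        + 3 * x₁ - + 9 * x₂ + + 9 * x₃ + + 18 * x₄ - + 27 * x₆ - + 24 * x₈ + + 54 * x₁₂ - + 72 * x₂₄ + + 9 * t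
      aa₈-at {t} eq = trans (sym (κ-· (+ 2) (a · aₖ 8) n)) (trans (at aa₈ n) (trans (at-⊕ (κ-positive (+ 2) 1≤n)
        (at-⊕ (at-⊖ (at-⊕ (at-⊖ (at-⊖ (at-⊕ (at-⊕ (at-⊖ (at-κ (+ 3) s₁) (at-κ (+ 9) s₂)) (at-κ (+ 9) s₃)) (at-κ (+ 18) s₄))
          (at-κ (+ 27) s₆)) (at-κ (+ 24) s₈)) (at-κ (+ 54) s₁₂)) (at-κ (+ 72) s₂₄)) (at-κ (+ 9) eq)))
        (ℤP.+-identityˡ _)))

      aa₁₆-at : ∀ {x₁₆ x₄₈ t} → σₖ 16 n ≡ x₁₆ → σₖ 48 n ≡ x₄₈ → (mono 1 · R 4) n ≡ t → + 2 * (a · aₖ 16) n ≡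
        + 3 * x₁ - + 9 * x₂ - + 9 * x₃ + + 18 * x₄ + + 27 * x₆ - + 36 * x₈ - + 54 * x₁₂ + + 48 * x₁₆ + + 108 * x₂₄ - + 144 * x₄₈ + + 9 * t
      aa₁₆-at s₁₆ s₄₈ eq = trans (sym (κ-· (+ 2) (a · aₖ 16) n)) (trans (at aa₁₆ n) (trans (at-⊕ (κ-positive (+ 2) 1≤n)
        (at-⊕ (at-⊖ (at-⊕ (at-⊕ (at-⊖ (at-⊖ (at-⊕ (at-⊕ (at-⊖ (at-⊖ (at-κ (+ 3) s₁) (at-κ (+ 9) s₂)) (at-κ (+ 9) s₃)) (at-κ (+ 18) s₄))
          (at-κ (+ 27) s₆)) (at-κ (+ 36) s₈)) (at-κ (+ 54) s₁₂)) (at-κ (+ 48) s₁₆)) (at-κ (+ 108) s₂₄)) (at-κ (+ 144) s₄₈)) (at-κ (+ 9) eq)))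
        (ℤP.+-identityˡ _)))

mono·R-τ₂₄ : ∀ n → 1 ≤ n → (mono 1 · R 2) n ≡ τ₂,₂₄ n
mono·R-τ₂₄ (suc m) _ = trans (mono-1-suc (R 2) m) (sym (τ₂₄ m))

mono·R-τ₄₈ : ∀ n → 1 ≤ n → (mono 1 · R 4) n ≡ τ₂,₄₈ n
mono·R-τ₄₈ (suc m) _ = trans (mono-1-suc (R 4) m) (sym (τ₄₈ m))

count-≡ : ∀ b .{{_ : NonZero b}} n {x} → (a · aₖ b) n ≡ x → Σ ℕ λ k → 𝒩₂[ 1 , b , n ]≡ k × + k ≡ x
count-≡ b n eq = let k , card , k≡ = count b n in k , card , trans k≡ eq

count-2*≡ : ∀ b .{{_ : NonZero b}} n {x} → + 2 * (a · aₖ b) n ≡ x → Σ ℕ λ k → 𝒩₂[ 1 , b , n ]≡ k × + 2 * + k ≡ x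
count-2*≡ b n eq = let k , card , k≡ = count b n in k , card , trans (cong (+ 2 *_) k≡) eq

theorem2p2 : (n : ℕ) → 1 ≤ n →
    (Σ ℕ λ k → 𝒩₂[ 1 , 2 , n ]≡ k ×
    + k ≡ + 6 * σ[ n / 1 ] - + 12 * σ[ n / 2 ] + + 18 * σ[ n / 3 ] - + 36 * σ[ n / 6 ])
    × (Σ ℕ λ k → 𝒩₂[ 1 , 4 , n ]≡ k ×
    + k ≡ + 6 * σ[ n / 1 ] - + 18 * σ[ n / 2 ] - + 18 * σ[ n / 3 ] + + 24 * σ[ n / 4 ]
    + + 54 * σ[ n / 6 ] - + 72 * σ[ n / 12 ])
    × (Σ ℕ λ k → 𝒩₂[ 1 , 8 , n ]≡ k ×
    + 2 * + k ≡ + 3 * σ[ n / 1 ] - + 9 * σ[ n / 2 ] + + 9 * σ[ n / 3 ] + + 18 * σ[ n / 4 ]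
    - + 27 * σ[ n / 6 ] - + 24 * σ[ n / 8 ] + + 54 * σ[ n / 12 ] - + 72 * σ[ n / 24 ]
    + + 9 * τ₂,₂₄ n)
    × (Σ ℕ λ k → 𝒩₂[ 1 , 16 , n ]≡ k ×
    + 2 * + k ≡ + 3 * σ[ n / 1 ] - + 9 * σ[ n / 2 ] - + 9 * σ[ n / 3 ] + + 18 * σ[ n / 4 ]
    + + 27 * σ[ n / 6 ] - + 36 * σ[ n / 8 ] - + 54 * σ[ n / 12 ] + + 48 * σ[ n / 16 ]
    + + 108 * σ[ n / 24 ] - + 144 * σ[ n / 48 ] + + 9 * τ₂,₄₈ n)
theorem2p2 n 1≤n =
  count-≡ 2 n (aa₂-at n 1≤n (σS-at n) (σₖ-at 2 n) (σₖ-at 3 n) (σₖ-at 6 n)) ,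
  count-≡ 4 n (aa₄-at n 1≤n (σS-at n) (σₖ-at 2 n) (σₖ-at 3 n) (σₖ-at 6 n) (σₖ-at 4 n) (σₖ-at 12 n)) ,
  count-2*≡ 8 n (aa₈-at n 1≤n (σS-at n) (σₖ-at 2 n) (σₖ-at 3 n) (σₖ-at 6 n) (σₖ-at 4 n) (σₖ-at 12 n) (σₖ-at 8 n) (σₖ-at 24 n)
    (mono·R-τ₂₄ n 1≤n)) ,
  count-2*≡ 16 n (aa₁₆-at n 1≤n (σS-at n) (σₖ-at 2 n) (σₖ-at 3 n) (σₖ-at 6 n) (σₖ-at 4 n) (σₖ-at 12 n) (σₖ-at 8 n) (σₖ-at 24 n)
    (σₖ-at 16 n) (σₖ-at 48 n) (mono·R-τ₄₈ n 1≤n))
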